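{- Let $a\ge 1$, $l\ge 2$, $1\le h\le l-1$, and $n=a+l+1$. Let $K_a^l$ be the lollipop consisting of a complete graph $K_a$ together with a path $v_0v_1\cdots v_l$ of length $l$ where $v_0$ is a vertex of $K_a$ and $v_1,\dots,v_l$ are new vertices. Let $\mathrm{tw}_h(K_a^l)$ be the graph obtained from $K_a^l$ by adding a new vertex adjacent to $v_{l-h}$ and to all neighbors of $v_{l-h}$ (i.e. to $v_{l-h-1},v_{l-h},v_{l-h+1}$). Then \begin{align*} \frac{X_{\mathrm{tw}_h(K_a^l)}}{2(a-1)!}&=\sum_{\substack{K\vDash n,\ k_{ -1}\ge a\\ \Theta_K(h)\ge 3}}2w_Ke_K+\sum_{\substack{I\vDash n-1,\ i_{ -1}\ge a\\ \Theta_I(h)\ge 3}}w_Ie_{1I}+\sum_{\substack{K\vDash n,\ \Theta_K(h)\le 1,\ k_{ -1}\ge 3\\ k_{ -1}+k_{ -2}\ge n-h+1\text{ or }k_{ -2}\ge a}}(k_{ -1}-2)w_{K\setminus k_{ -1}}e_K\\ &\quad+\sum_{K\vDash n,\ k_{ -1}\ge a,\ \Theta_K(h+3)\ge\Theta_K(h)=2}\frac{\Theta_K(h+3)-1}{\Theta_K(h+3)}w_Ke_K. \end{align*}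
   Context: $X_G=\sum_\kappa\prod_{v\in V(G)}x_{\kappa(v)}$ summed over proper colorings $\kappa:V(G)\to\{1,2,\dots\}$. A composition $K=k_1\cdots k_l\vDash n$ is a sequence of positive integers with sum $n$, of length $l$; $k_{ -j}=k_{l+1-j}$ (conditions involving $k_{ -2}$ refer to compositions of length at least 2); $K\setminus k_{ -1}$ is $K$ with its last part removed; $1I$ is the composition obtained by prepending a part $1$ to $I$. $e_K=e_{k_1}\cdots e_{k_l}$ with $e_k$ elementary symmetric functions. $w_K=k_1(k_2-1)\cdots(k_l-1)$. For $0\le c\le n$, $\sigma_K(c)=\min\{k_1+\dots+k_j:0\le j\le l,\ k_1+\dots+k_j\ge c\}$ and $\Theta_K(c)=\sigma_K(c)-c$. -}

module Defs where

open import Data.Bool using (Bool; true; false; _∧_; _∨_; not; if_then_else_)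
open import Data.Nat using (ℕ; zero; suc; _+_; _*_; _∸_; _≤ᵇ_; _<ᵇ_; _≡ᵇ_; _⊓_; _!)
open import Data.Fin using (Fin; toℕ)
open import Data.Vec using (Vec; []; _∷_; lookup)
open import Data.List using (List; []; _∷_; map; concatMap; allFin; length; filterᵇ; foldr; scanl; reverse)
open import Data.Nat.ListAction using (sum; product)
open import Data.Integer using (+_)
open import Data.Rational using (ℚ; 0ℚ; _/_)

-- Graphs on the vertex set {0,…,m-1} (as ℕ), given by an adjacency test.

-- Lollipop K_a^l : clique on vertices 0 … a-1; path v_0 v_1 … v_l with
-- v_j = a - 1 + j  (so v_0 = a-1 lies in K_a, and v_1 … v_l = a … a+l-1
-- are new).  Total number of vertices: a + l.
lollipopLt : ℕ → ℕ → ℕ → ℕ → Bool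
lollipopLt a l u v =
  (u <ᵇ v) ∧ ((v <ᵇ a) ∨ ((v ≡ᵇ suc u) ∧ (a ≤ᵇ v) ∧ (v <ᵇ a + l)))

lollipop : ℕ → ℕ → ℕ → ℕ → Bool
lollipop a l u v = lollipopLt a l u v ∨ lollipopLt a l v u

pathVertex : ℕ → ℕ → ℕ
pathVertex a j = (a ∸ 1) + j

twin : (ℕ → ℕ → Bool) → ℕ → ℕ → ℕ → ℕ → Bool
twin adj m x u v =
  (((u <ᵇ m) ∧ (v <ᵇ m)) ∧ adj u v)
  ∨ ((u ≡ᵇ m) ∧ (v <ᵇ m) ∧ ((v ≡ᵇ x) ∨ adj x v))
  ∨ ((v ≡ᵇ m) ∧ (u <ᵇ m) ∧ ((u ≡ᵇ x) ∨ adj x u))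

twLollipop : ℕ → ℕ → ℕ → ℕ → ℕ → Bool
twLollipop a l h = twin (lollipop a l) (a + l) (pathVertex a (l ∸ h))

-- Coefficients of monomials.
-- A symmetric function (formal power series in x_1,x_2,…) is determined by
-- its coefficients [x^α] for all finitely supported exponent vectors α;
-- we represent α as  Vec ℕ N  (exponents of x_1 … x_N, all others 0),
-- ranging over all N.

allVecs : (N n : ℕ) → List (Vec (Fin N) n)
allVecs N zero = [] ∷ []
allVecs N (suc n) = concatMap (λ i → map (i ∷_) (allVecs N n)) (allFin N)

finEq : ∀ {N} → Fin N → Fin N → Bool
finEq i j = toℕ i ≡ᵇ toℕ j

allB : ∀ {A : Set} → (A → Bool) → List A → Bool
allB p = foldr (λ x b → p x ∧ b) true

classSize : ∀ {N n} → Vec (Fin N) n → Fin N → ℕ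
classSize κ i = length (filterᵇ (λ j → finEq (lookup κ j) i) (allFin _))

proper : ∀ {N n} → (ℕ → ℕ → Bool) → Vec (Fin N) n → Bool
proper {n = n} adj κ =
  allB (λ u → allB (λ v → not (adj (toℕ u) (toℕ v)) ∨ not (finEq (lookup κ u) (lookup κ v))) (allFin n)) (allFin n)

hasContent : ∀ {N n} → Vec (Fin N) n → Vec ℕ N → Bool
hasContent {N} κ α = allB (λ i → classSize κ i ≡ᵇ lookup α i) (allFin N)

coeffX : (adj : ℕ → ℕ → Bool) (n : ℕ) {N : ℕ} → Vec ℕ N → ℕ
coeffX adj n {N} α = length (filterᵇ (λ κ → proper adj κ ∧ hasContent κ α) (allVecs N n))

subsets : (N : ℕ) → List (Vec Bool N)
subsets zero = [] ∷ []
subsets (suc N) = concatMap (λ b → map (b ∷_) (subsets N)) (true ∷ false ∷ [])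

card : ∀ {N} → Vec Bool N → ℕ
card [] = 0
card (b ∷ S) = (if b then 1 else 0) + card S

fitsB : ∀ {N} → Vec Bool N → Vec ℕ N → Bool
fitsB [] [] = true
fitsB (b ∷ S) (x ∷ α) = (not b ∨ (1 ≤ᵇ x)) ∧ fitsB S α

minusS : ∀ {N} → Vec ℕ N → Vec Bool N → Vec ℕ N
minusS [] [] = []
minusS (x ∷ α) (b ∷ S) = (if b then x ∸ 1 else x) ∷ minusS α S

allZero : ∀ {N} → Vec ℕ N → Bool
allZero [] = true
allZero (x ∷ α) = (x ≡ᵇ 0) ∧ allZero α

-- [x^α] e_K = [x^α] e_{k_1} ⋯ e_{k_l}, e_k = Σ_{|S|=k} Π_{i∈S} x_i
coeffE : List ℕ → ∀ {N} → Vec ℕ N → ℕ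
coeffE [] α = if allZero α then 1 else 0
coeffE (k ∷ K) {N} α =
  sum (map (λ S → coeffE K (minusS α S))
           (filterᵇ (λ S → (card S ≡ᵇ k) ∧ fitsB S α) (subsets N)))

-- all compositions of n (each composition of n+1 arises uniquely from one
-- of n by prepending a part 1 or increasing the first part by 1)
compositions : ℕ → List (List ℕ)
compositions zero = [] ∷ []
compositions (suc n) = concatMap step (compositions n)
  where
  step : List ℕ → List (List ℕ)
  step [] = (1 ∷ []) ∷ []
  step (k ∷ K) = (1 ∷ k ∷ K) ∷ (suc k ∷ K) ∷ []

w : List ℕ → ℕ
w [] = 1
w (k ∷ K) = k * product (map (_∸ 1) K)

-- σ_K(c) = min { k_1+…+k_j : 0 ≤ j ≤ l, k_1+…+k_j ≥ c }  (for c ≤ |K|;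
-- the fold starts from |K| = k_1+…+k_l, itself one of the partial sums)
σ : List ℕ → ℕ → ℕ
σ K c = foldr _⊓_ (sum K) (filterᵇ (c ≤ᵇ_) (scanl Data.Nat._+_ 0 K))

Θ : List ℕ → ℕ → ℕ
Θ K c = σ K c ∸ c

lastPart : List ℕ → ℕ
lastPart K with reverse K
... | [] = 0
... | k ∷ _ = k

secondLast : List ℕ → ℕ
secondLast K with reverse K
... | k ∷ k' ∷ _ = k'
... | _ = 0

dropLast : List ℕ → List ℕ
dropLast K with reverse K
... | [] = []
... | _ ∷ R = reverse R

ℕ→ℚ : ℕ → ℚ
ℕ→ℚ m = (+ m) / 1

-- p / q  (q ≠ 0 in all uses; 0 if q = 0)
frac : ℕ → ℕ → ℚ
frac p zero = 0ℚ
frac p (suc q) = (+ p) / suc q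

Σℚ : ∀ {A : Set} → List A → (A → ℚ) → ℚ
Σℚ xs f = foldr (λ x r → f x Data.Rational.+ r) 0ℚ xs

lhs : ℕ → ℕ → ℕ → ∀ {N} → Vec ℕ N → ℚ
lhs a l h α =
  frac (coeffX (twLollipop a l h) (a + l + 1) α) (2 * (a ∸ 1) !)

rhs : ℕ → ℕ → ℕ → ∀ {N} → Vec ℕ N → ℚ
rhs a l h α =
  Σℚ (filterᵇ cond1 (compositions n)) (λ K → ℕ→ℚ (2 * w K * coeffE K α))
  Data.Rational.+ Σℚ (filterᵇ cond1 (compositions (n ∸ 1))) (λ I → ℕ→ℚ (w I * coeffE (1 ∷ I) α))
  Data.Rational.+ Σℚ (filterᵇ cond3 (compositions n))
       (λ K → ℕ→ℚ ((lastPart K ∸ 2) * w (dropLast K) * coeffE K α))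
  Data.Rational.+ Σℚ (filterᵇ cond4 (compositions n))
       (λ K → frac (Θ K (h + 3) ∸ 1) (Θ K (h + 3)) Data.Rational.* ℕ→ℚ (w K * coeffE K α))
  where
  n = a + l + 1
  cond1 : List ℕ → Bool
  cond1 K = (a ≤ᵇ lastPart K) ∧ (3 ≤ᵇ Θ K h)
  cond3 : List ℕ → Bool
  cond3 K = (Θ K h ≤ᵇ 1) ∧ (3 ≤ᵇ lastPart K) ∧
            ((2 ≤ᵇ length K) ∧ (((n ∸ h) + 1 ≤ᵇ lastPart K + secondLast K) ∨ (a ≤ᵇ secondLast K)))
  cond4 : List ℕ → Bool
  cond4 K = (a ≤ᵇ lastPart K) ∧ (Θ K h ≡ᵇ 2) ∧ (2 ≤ᵇ Θ K (h + 3))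

{-# OPTIONS --safe #-}
module Submission where

-- Everything takes place in the ring of power series in x_1, …, x_N, seen as an
-- arbitrary commutative ring R with elements x i. Colourings of a path are counted by
-- the transfer operator (M φ) i = x i (|φ| - φ i) on vectors indexed by the colour of
-- the last vertex, |φ| being the sum of the entries. The clique K_{k+1} gives k! ε k
-- with ε k i = x i e_k(x without x i), and e_{k+1}(x) = e_{k+1}(x∖i) + x i e_k(x∖i)
-- says M (ε k) = ε (k + 1) + k e_{k+1} x. Iterating, |M^j (ε k)| is the sum of w_K e_K
-- over the compositions K of k + 1 + j whose last part is at least k + 1.
--
-- Crossing the twinned vertex is another operator T, and a computation with power sums
-- writes T φ as
--   4 M³φ + 2 e_1 M²φ - 2|φ| M²x - 2|Mφ| M x - 2|M²φ| x + |M x||φ| x.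
-- Hence X / (2 (a-1)!) is a combination of products of path and lollipop expansions.
-- On the other side, cutting each composition at the least partial sum h + r that is
-- at least h factors each of the four sums: with A_r the part before the cut, they are
-- combinations of A_r V and A_r U for the two weights V and U of the part after it, and
-- the linear relation between U, V and w (lemma U+W) gives the same products. In the
-- third sum the first part after the cut has been moved to the end of the composition.

open import Defs
open import Level using (0ℓ)
open import Algebra.Bundles using (CommutativeRing)
import Algebra.Construct.Pointwise
import Algebra.Properties.Ring
import Algebra.Properties.Semiring.Mult
import Algebra.Solver.Ring
open import Algebra.Solver.Ring.AlmostCommutativeRing
  using (fromCommutativeRing; _-Raw-AlmostCommutative⟶_)
open import Data.Bool using (Bool; true; false; _∧_; _∨_; not; if_then_else_)
import Data.Bool.Properties as Boolₚ
open import Data.Empty using (⊥-elim)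
open import Data.Fin using (Fin; zero; suc; toℕ)
open import Data.Integer as ℤ using (ℤ; +_; -[1+_])
import Data.Integer.Properties as ℤₚ
open import Data.List
  using (List; []; _∷_; _++_; _∷ʳ_; allFin; concatMap; filterᵇ; foldr; initLast; _∷ʳ′_; length; map; reverse; scanl; tabulate)
import Data.List.Properties as Listₚ
open import Data.List.Relation.Unary.All as All using (All; []; _∷_)
open import Data.List.Relation.Unary.All.Properties using (concat⁺; map⁺; ++⁻ʳ)
open import Data.Maybe using (Maybe; just; nothing)
open import Data.Nat as ℕ
  using (ℕ; zero; suc; _≤_; _<_; _∸_; _⊓_; z≤n; s≤s; _≡ᵇ_; _<ᵇ_; _≤ᵇ_; _!)
open import Data.Nat.DivMod using (m*n/n≡m)
open import Data.Nat.ListAction using (sum; product)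
open import Data.Nat.ListAction.Properties using (sum-++; product-++)
import Data.Nat.Properties as ℕₚ
open import Data.Nat.Solver using (module +-*-Solver)
open +-*-Solver using ()
  renaming (solve to ℕ-solve; _:+_ to _ℕ:+_; _:*_ to _ℕ:*_; _:=_ to _ℕ:=_; con to ℕcon)
open import Data.Product using (_×_; _,_; ∃; ∃₂)
open import Data.Rational as ℚ using (ℚ)
import Data.Rational.Properties as ℚₚ
open import Data.Rational.Unnormalised as ℚᵘ using (mkℚᵘ; *≡*)
import Data.Rational.Unnormalised.Properties as ℚᵘₚ
open import Data.Sum using (_⊎_; inj₁; inj₂)
open import Data.Vec using (Vec; []; _∷_; lookup)
open import Function using (_∘_)
open import Relation.Binary.PropositionalEquality as ≡ using (_≡_; _≢_)
open import Relation.Nullary using (yes; no; contradiction)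

-- Three features of the statement shape the proof. The twin is adjacent to three consecutive
-- vertices, so its colour couples them and no single transfer step describes it. What makes the
-- formula for T useful is that each of its vectors is a power of M applied to φ or to x: every term
-- turns into a lollipop expansion, possibly times path expansions. Its last term also has a second
-- task: |M x| = 2 e_2 is what corrects the path on h + 2 vertices to A_2. The last sum has rational
-- coefficients, while R has no division. With the cut at h + 2, the denominator Θ_K(h+3) is the
-- next part less one and hence a factor of w_K, so all coefficients are natural numbers. The
-- identity is proved multiplied by 2 (a-1)!, then R is specialised to iterated power series over
-- the integers, and division takes place only between coefficients. The condition of the third sum
-- is, after the rotation of the parts behind the cut, nothing but the usual requirement that the
-- last part be at least a.

module RingTools (R : CommutativeRing 0ℓ 0ℓ) where

  open CommutativeRing R public
    hiding (zero; _-_)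
  open Algebra.Properties.Ring ring public
    using (-‿+-comm; -‿distribˡ-*; -‿distribʳ-*; -‿involutive; -0#≈0#)
  open Algebra.Properties.Semiring.Mult semiring using (×-homo-+; ×1-homo-*) renaming (_×_ to _·_)
  open import Relation.Binary.Reasoning.Setoid setoid public

  infixl 6 _-_
  _-_ : Carrier → Carrier → Carrier
  x - y = x + (- y)

  ι : ℕ → Carrier
  ι n = n · 1#

  ι-+ : ∀ m n → ι (m ℕ.+ n) ≈ ι m + ι n
  ι-+ = ×-homo-+ 1#

  ι-* : ∀ m n → ι (m ℕ.* n) ≈ ι m * ι n
  ι-* = ×1-homo-*

  ι-cong : ∀ {m n} → m ≡ n → ι m ≈ ι n
  ι-cong ≡.refl = refl

  -- The coefficient map that lets the ring solver handle integer constants over an arbitrary R. A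
  -- constant `con (+ n)` is read as `ι n`; in particular `con (+ 1)` is `1# + 0#` and not `1#`
  -- itself.
  ιℤ : ℤ → Carrier
  ιℤ (+ n) = ι n
  ιℤ -[1+ n ] = - ι (suc n)

  private
    cancel-suc : ∀ a b c → (c + a) - (c + b) ≈ a - b
    cancel-suc a b c = begin
      (c + a) + - (c + b)     ≈⟨ +-cong (+-comm c a) (sym (-‿+-comm c b)) ⟩
      (a + c) + (- c + - b)   ≈⟨ +-assoc a c _ ⟩
      a + (c + (- c + - b))   ≈⟨ +-congˡ (+-assoc c _ _) ⟨
      a + ((c + - c) + - b)   ≈⟨ +-congˡ (+-congʳ (-‿inverseʳ c)) ⟩
      a + (0# + - b)          ≈⟨ +-congˡ (+-identityˡ _) ⟩
      a - b                   ∎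

    ιℤ-⊖ : ∀ m n → ιℤ (m ℤ.⊖ n) ≈ ι m - ι n
    ιℤ-⊖ zero zero = sym (-‿inverseʳ 0#)
    ιℤ-⊖ zero (suc n) = sym (+-identityˡ _)
    ιℤ-⊖ (suc m) zero = sym (trans (+-congˡ -0#≈0#) (+-identityʳ _))
    ιℤ-⊖ (suc m) (suc n) rewrite ℤₚ.[1+m]⊖[1+n]≡m⊖n m n =
      trans (ιℤ-⊖ m n) (sym (cancel-suc _ _ _))

    ιℤ-+ : ∀ i j → ιℤ (i ℤ.+ j) ≈ ιℤ i + ιℤ j
    ιℤ-+ (+ m) (+ n) = ι-+ m n
    ιℤ-+ (+ m) -[1+ n ] = ιℤ-⊖ m (suc n)
    ιℤ-+ -[1+ m ] (+ n) = trans (ιℤ-⊖ n (suc m)) (+-comm _ _)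
    ιℤ-+ -[1+ m ] -[1+ n ] = begin
      - ι (2 ℕ.+ (m ℕ.+ n))         ≈⟨ -‿cong (ι-cong (≡.cong suc (≡.sym (ℕₚ.+-suc m n)))) ⟩
      - ι (suc m ℕ.+ suc n)         ≈⟨ -‿cong (ι-+ (suc m) (suc n)) ⟩
      - (ι (suc m) + ι (suc n))     ≈⟨ -‿+-comm _ _ ⟨
      - ι (suc m) + - ι (suc n)     ∎
    ιℤ-neg : ∀ i → ιℤ (ℤ.- i) ≈ - ιℤ i
    ιℤ-neg (+ zero) = sym -0#≈0#
    ιℤ-neg (+ suc n) = refl
    ιℤ-neg -[1+ n ] = sym (-‿involutive _)

    ιℤ-* : ∀ i j → ιℤ (i ℤ.* j) ≈ ιℤ i * ιℤ j
    ιℤ-* (+ m) (+ n) rewrite ℤₚ.+◃n≡+n (m ℕ.* n) = ι-* m n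
    ιℤ-* (+ m) -[1+ n ] rewrite ℤₚ.-◃n≡-n (m ℕ.* suc n) =
      trans (ιℤ-neg (+ (m ℕ.* suc n))) (trans (-‿cong (ι-* m (suc n))) (-‿distribʳ-* _ _))
    ιℤ-* -[1+ m ] (+ n) rewrite ℤₚ.-◃n≡-n (suc m ℕ.* n) =
      trans (ιℤ-neg (+ (suc m ℕ.* n))) (trans (-‿cong (ι-* (suc m) n)) (-‿distribˡ-* _ _))
    ιℤ-* -[1+ m ] -[1+ n ] = begin
      ι (suc m ℕ.* suc n)           ≈⟨ ι-* (suc m) (suc n) ⟩
      ι (suc m) * ι (suc n)         ≈⟨ -‿involutive _ ⟨
      - - (ι (suc m) * ι (suc n))   ≈⟨ -‿cong (-‿distribʳ-* _ _) ⟩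
      - (ι (suc m) * - ι (suc n))   ≈⟨ -‿distribˡ-* _ _ ⟩
      - ι (suc m) * - ι (suc n)     ∎

    ιℤ-hom : CommutativeRing.rawRing ℤₚ.+-*-commutativeRing
               -Raw-AlmostCommutative⟶ fromCommutativeRing R
    ιℤ-hom = record
      { ⟦_⟧ = ιℤ
      ; +-homo = ιℤ-+
      ; *-homo = ιℤ-*
      ; -‿homo = ιℤ-neg
      ; 0-homo = refl
      ; 1-homo = +-identityʳ 1#
      }

    ιℤ-≟ : ∀ i j → Maybe (ιℤ i ≈ ιℤ j)
    ιℤ-≟ i j with i ℤ.≟ j
    ... | yes ≡.refl = just refl
    ... | no _ = nothing

  open Algebra.Solver.Ring (CommutativeRing.rawRing ℤₚ.+-*-commutativeRing)
    (fromCommutativeRing R) ιℤ-hom ιℤ-≟ public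
    using (solve; _:=_; _:+_; _:*_; _:-_; :-_; con)

  ⟦_⟧ : Bool → Carrier
  ⟦ b ⟧ = if b then 1# else 0#

  ⟦⟧-cong : ∀ {b c} → b ≡ c → ⟦ b ⟧ ≈ ⟦ c ⟧
  ⟦⟧-cong ≡.refl = refl

  ⟦⟧-∧ : ∀ b c → ⟦ b ∧ c ⟧ ≈ ⟦ b ⟧ * ⟦ c ⟧
  ⟦⟧-∧ true c = sym (*-identityˡ _)
  ⟦⟧-∧ false c = sym (zeroˡ _)

  *-congʳ-if : ∀ b {x y} → (b ≡ true → x ≈ y) → ⟦ b ⟧ * x ≈ ⟦ b ⟧ * y
  *-congʳ-if true eq = *-congˡ (eq ≡.refl)
  *-congʳ-if false eq = trans (zeroˡ _) (sym (zeroˡ _))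

  private variable
    A B : Set

  Σ : List A → (A → Carrier) → Carrier
  Σ xs f = foldr (λ x r → f x + r) 0# xs

  Σ-cong : ∀ (xs : List A) {f g : A → Carrier} → (∀ x → f x ≈ g x) → Σ xs f ≈ Σ xs g
  Σ-cong [] eq = refl
  Σ-cong (x ∷ xs) eq = +-cong (eq x) (Σ-cong xs eq)

  Σ-0 : ∀ (xs : List A) {f : A → Carrier} → (∀ x → f x ≈ 0#) → Σ xs f ≈ 0#
  Σ-0 [] eq = refl
  Σ-0 (x ∷ xs) eq = trans (+-cong (eq x) (Σ-0 xs eq)) (+-identityʳ 0#)

  Σ-+ : ∀ (xs : List A) (f g : A → Carrier) → Σ xs (λ x → f x + g x) ≈ Σ xs f + Σ xs g
  Σ-+ [] f g = sym (+-identityʳ 0#)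
  Σ-+ (x ∷ xs) f g = trans (+-congˡ (Σ-+ xs f g))
    (solve 4 (λ a b c d → (a :+ b) :+ (c :+ d) := (a :+ c) :+ (b :+ d)) refl _ _ _ _)

  Σ-*ˡ : ∀ (xs : List A) c (f : A → Carrier) → Σ xs (λ x → c * f x) ≈ c * Σ xs f
  Σ-*ˡ [] c f = sym (zeroʳ c)
  Σ-*ˡ (x ∷ xs) c f = trans (+-congˡ (Σ-*ˡ xs c f)) (sym (distribˡ c _ _))

  Σ-*ʳ : ∀ (xs : List A) c (f : A → Carrier) → Σ xs (λ x → f x * c) ≈ Σ xs f * c
  Σ-*ʳ xs c f = trans (Σ-cong xs λ x → *-comm (f x) c) (trans (Σ-*ˡ xs c f) (*-comm c _))

  Σ-- : ∀ (xs : List A) (f g : A → Carrier) → Σ xs (λ x → f x - g x) ≈ Σ xs f - Σ xs g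
  Σ-- [] f g = sym (-‿inverseʳ 0#)
  Σ-- (x ∷ xs) f g = trans (+-congˡ (Σ-- xs f g))
    (solve 4 (λ a b c d → (a :- b) :+ (c :- d) := (a :+ c) :- (b :+ d)) refl _ _ _ _)

  Σ-swap : ∀ (xs : List A) (ys : List B) (f : A → B → Carrier) →
    Σ xs (λ x → Σ ys (f x)) ≈ Σ ys (λ y → Σ xs (λ x → f x y))
  Σ-swap [] ys f = sym (Σ-0 ys λ _ → refl)
  Σ-swap (x ∷ xs) ys f = trans (+-congˡ (Σ-swap xs ys f)) (sym (Σ-+ ys _ _))

  Σ-++ : ∀ (xs ys : List A) (f : A → Carrier) → Σ (xs ++ ys) f ≈ Σ xs f + Σ ys f
  Σ-++ [] ys f = sym (+-identityˡ _)
  Σ-++ (x ∷ xs) ys f = trans (+-congˡ (Σ-++ xs ys f)) (sym (+-assoc _ _ _))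

  Σ-concatMap : ∀ (g : A → List B) xs (f : B → Carrier) →
    Σ (concatMap g xs) f ≈ Σ xs (λ x → Σ (g x) f)
  Σ-concatMap g [] f = refl
  Σ-concatMap g (x ∷ xs) f = trans (Σ-++ (g x) _ f) (+-congˡ (Σ-concatMap g xs f))

  Σ-map : ∀ (g : A → B) xs (f : B → Carrier) → Σ (map g xs) f ≈ Σ xs (f ∘ g)
  Σ-map g [] f = refl
  Σ-map g (x ∷ xs) f = +-congˡ (Σ-map g xs f)

  Σ-filter : ∀ (p : A → Bool) xs (f : A → Carrier) →
    Σ (filterᵇ p xs) f ≈ Σ xs (λ x → ⟦ p x ⟧ * f x)
  Σ-filter p [] f = refl
  Σ-filter p (x ∷ xs) f with p x
  ... | true = +-cong (sym (*-identityˡ _)) (Σ-filter p xs f)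
  ... | false = trans (Σ-filter p xs f) (sym (trans (+-congʳ (zeroˡ _)) (+-identityˡ _)))

  Σ-tabulate : ∀ {n} (g : Fin n → A) (f : A → Carrier) → Σ (tabulate g) f ≈ Σ (allFin n) (f ∘ g)
  Σ-tabulate {n = zero} g f = refl
  Σ-tabulate {n = suc n} g f = +-congˡ (trans (Σ-tabulate (g ∘ suc) f) (sym (Σ-tabulate suc (f ∘ g))))

  Σ-allFin-suc : ∀ {n} (f : Fin (suc n) → Carrier) → Σ (allFin (suc n)) f ≈ f zero + Σ (allFin n) (f ∘ suc)
  Σ-allFin-suc f = +-congˡ (Σ-tabulate suc f)

  -- Turns the requirement that two adjacent vertices differ in colour into the difference that
  -- occurs in `M`.
  Σ-avoid : ∀ {n} (c : Fin n) (f : Fin n → Carrier) →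
    Σ (allFin n) (λ j → ⟦ not (finEq j c) ⟧ * f j) ≈ Σ (allFin n) f - f c
  Σ-avoid {suc n} zero f = begin
    Σ (allFin (suc n)) (λ j → ⟦ not (finEq j zero) ⟧ * f j)
      ≈⟨ Σ-allFin-suc (λ j → ⟦ not (finEq j zero) ⟧ * f j) ⟩
    0# * f zero + Σ (allFin n) (λ j → 1# * f (suc j))
      ≈⟨ +-cong (zeroˡ _) (Σ-cong (allFin n) λ j → *-identityˡ _) ⟩
    0# + Σ (allFin n) (f ∘ suc)
      ≈⟨ solve 2 (λ a b → con (+ 0) :+ b := (a :+ b) :- a) refl (f zero) _ ⟩
    f zero + Σ (allFin n) (f ∘ suc) - f zero
      ≈⟨ +-congʳ (Σ-allFin-suc f) ⟨
    Σ (allFin (suc n)) f - f zero ∎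
  Σ-avoid {suc n} (suc c) f = begin
    Σ (allFin (suc n)) (λ j → ⟦ not (finEq j (suc c)) ⟧ * f j)
      ≈⟨ Σ-allFin-suc (λ j → ⟦ not (finEq j (suc c)) ⟧ * f j) ⟩
    1# * f zero + Σ (allFin n) (λ j → ⟦ not (finEq j c) ⟧ * f (suc j))
      ≈⟨ +-cong (*-identityˡ _) (Σ-avoid c (f ∘ suc)) ⟩
    f zero + (Σ (allFin n) (f ∘ suc) - f (suc c))
      ≈⟨ +-assoc _ _ _ ⟨
    f zero + Σ (allFin n) (f ∘ suc) - f (suc c)
      ≈⟨ +-congʳ (Σ-allFin-suc f) ⟨
    Σ (allFin (suc n)) f - f (suc c) ∎

-- Sums over compositions and cutting them at a partial sum.

IsComposition : ℕ → List ℕ → Set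
IsComposition n K = sum K ≡ n × All (1 ≤_) K

-- Agrees with Θ K c for c ≤ sum K; junk value 0 beyond.
θ : List ℕ → ℕ → ℕ
θ K zero = 0
θ [] (suc c) = 0
θ (k ∷ K) (suc c) = if c <ᵇ k then k ∸ suc c else θ K (suc c ∸ k)

module CompositionSums (R : CommutativeRing 0ℓ 0ℓ) where
  open RingTools R

  opaque
    𝒮 : ℕ → (List ℕ → Carrier) → Carrier
    𝒮 n f = Σ (compositions n) f

  opaque
    unfolding 𝒮

    𝒮-filter : ∀ p n f → Σ (filterᵇ p (compositions n)) f ≈ 𝒮 n (λ K → ⟦ p K ⟧ * f K)
    𝒮-filter p n = Σ-filter p (compositions n)

    𝒮-0 : ∀ f → 𝒮 0 f ≈ f []
    𝒮-0 f = +-identityʳ _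

    𝒮-+ : ∀ n f g → 𝒮 n (λ K → f K + g K) ≈ 𝒮 n f + 𝒮 n g
    𝒮-+ n = Σ-+ (compositions n)

    𝒮-*ˡ : ∀ n c f → 𝒮 n (λ K → c * f K) ≈ c * 𝒮 n f
    𝒮-*ˡ n = Σ-*ˡ (compositions n)

    𝒮-*ʳ : ∀ n c f → 𝒮 n (λ K → f K * c) ≈ 𝒮 n f * c
    𝒮-*ʳ n = Σ-*ʳ (compositions n)

  -- The transpose of the step that generates `compositions`: instead of enlarging the compositions,
  -- the function is pulled back, which makes induction on n possible for an arbitrary summand.
  extend : (List ℕ → Carrier) → List ℕ → Carrier
  extend f [] = f (1 ∷ [])
  extend f (k ∷ K) = f (1 ∷ k ∷ K) + f (suc k ∷ K)

  opaque
    unfolding 𝒮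

    𝒮-suc : ∀ n f → 𝒮 (suc n) f ≈ 𝒮 n (extend f)
    𝒮-suc n f = trans (Σ-concatMap _ (compositions n) f)
      (Σ-cong (compositions n) λ { [] → +-identityʳ _ ; (k ∷ K) → +-congˡ (+-identityʳ _) })

  𝒮-cong : ∀ n {f g} → (∀ K → IsComposition n K → f K ≈ g K) → 𝒮 n f ≈ 𝒮 n g
  𝒮-cong zero eq = trans (𝒮-0 _) (trans (eq [] (≡.refl , [])) (sym (𝒮-0 _)))
  𝒮-cong (suc n) {f} {g} eq = trans (𝒮-suc n f) (trans (𝒮-cong n step) (sym (𝒮-suc n g)))
    where
    step : ∀ K → IsComposition n K → extend f K ≈ extend g K
    step [] (≡.refl , []) = eq _ (≡.refl , s≤s z≤n ∷ [])
    step (k ∷ K) (s , p ∷ ps) = +-cong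
      (eq _ (≡.cong suc s , s≤s z≤n ∷ p ∷ ps))
      (eq _ (≡.cong suc s , s≤s z≤n ∷ ps))

  -- The sum of F k r over all pairs with k + r = m and k ≥ 1.
  opaque
    D : ℕ → (ℕ → ℕ → Carrier) → Carrier
    D zero F = 0#
    D (suc m) F = F 1 m + D m (F ∘ suc)

    D-0 : ∀ F → D 0 F ≈ 0#
    D-0 F = refl

    D-suc : ∀ m F → D (suc m) F ≈ F 1 m + D m (λ k → F (suc k))
    D-suc m F = refl

    D-cong : ∀ m {F G : ℕ → ℕ → Carrier} →
      (∀ k r → suc k ℕ.+ r ≡ m → F (suc k) r ≈ G (suc k) r) → D m F ≈ D m G
    D-cong zero eq = refl
    D-cong (suc m) eq = +-cong (eq 0 m ≡.refl) (D-cong m λ k r e → eq (suc k) r (≡.cong suc e))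

    D-+ : ∀ m F G → D m (λ k r → F k r + G k r) ≈ D m F + D m G
    D-+ zero F G = sym (+-identityʳ 0#)
    D-+ (suc m) F G = trans (+-congˡ (D-+ m (F ∘ suc) (G ∘ suc)))
      (solve 4 (λ a b c d → (a :+ b) :+ (c :+ d) := (a :+ c) :+ (b :+ d)) refl _ _ _ _)

    D-snoc : ∀ m F → D (suc m) F ≈ D m (λ k r → F k (suc r)) + F (suc m) 0
    D-snoc zero F = +-comm _ _
    D-snoc (suc m) F = trans (+-congˡ (D-snoc m (F ∘ suc))) (sym (+-assoc _ _ _))

  D-1 : ∀ F → D 1 F ≈ F 1 0
  D-1 F = trans (D-suc 0 F) (trans (+-congˡ (D-0 _)) (+-identityʳ _))

  𝒮-1 : ∀ f → 𝒮 1 f ≈ f (1 ∷ [])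
  𝒮-1 f = trans (𝒮-suc 0 f) (𝒮-0 _)

  𝒮-first : ∀ n f → 𝒮 (suc n) f ≈ D (suc n) (λ k r → 𝒮 r (λ K → f (k ∷ K)))
  𝒮-first zero f = trans (𝒮-1 f) (sym (trans (D-1 _) (𝒮-0 _)))
  𝒮-first (suc n) f = begin
    𝒮 (suc (suc n)) f
      ≈⟨ 𝒮-suc (suc n) f ⟩
    𝒮 (suc n) (extend f)
      ≈⟨ 𝒮-first n (extend f) ⟩
    D (suc n) (λ k r → 𝒮 r (λ K → f (1 ∷ k ∷ K) + f (suc k ∷ K)))
      ≈⟨ D-cong (suc n) (λ k r _ → 𝒮-+ r _ _) ⟩
    D (suc n) (λ k r → 𝒮 r (λ K → f (1 ∷ k ∷ K)) + 𝒮 r (λ K → f (suc k ∷ K)))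
      ≈⟨ D-+ (suc n) _ _ ⟩
    D (suc n) (λ k r → 𝒮 r (λ K → f (1 ∷ k ∷ K))) + D (suc n) (λ k r → 𝒮 r (λ K → f (suc k ∷ K)))
      ≈⟨ +-congʳ (𝒮-first n (λ K → f (1 ∷ K))) ⟨
    𝒮 (suc n) (λ K → f (1 ∷ K)) + D (suc n) (λ k r → 𝒮 r (λ K → f (suc k ∷ K)))
      ≈⟨ D-suc (suc n) _ ⟨
    D (suc (suc n)) (λ k r → 𝒮 r (λ K → f (k ∷ K))) ∎

  𝒮-last : ∀ n f → 𝒮 (suc n) f ≈ D (suc n) (λ k r → 𝒮 r (λ K → f (K ∷ʳ k)))
  𝒮-last zero f = trans (𝒮-1 f) (sym (trans (D-1 _) (𝒮-0 _)))
  𝒮-last (suc n) f = begin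
    𝒮 (suc (suc n)) f
      ≈⟨ 𝒮-suc (suc n) f ⟩
    𝒮 (suc n) (extend f)
      ≈⟨ 𝒮-last n (extend f) ⟩
    D (suc n) (λ k r → 𝒮 r (λ K → extend f (K ∷ʳ k)))
      -- The empty K is split off because only there can `extend` alter the last part; it produces
      -- the terms `G (suc n) 1` and `G (suc (suc n)) 0`.
      ≈⟨ D-snoc n _ ⟩
    D n (λ k r → 𝒮 (suc r) (λ K → extend f (K ∷ʳ k))) + 𝒮 0 (λ K → extend f (K ∷ʳ suc n))
      ≈⟨ +-cong (D-cong n λ k r _ → shift (suc k) r) (trans (𝒮-0 _) (+-cong (sym G1) (sym (𝒮-0 _)))) ⟩
    D n (λ k r → G k (suc (suc r))) + (G (suc n) 1 + G (suc (suc n)) 0)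
      ≈⟨ +-assoc _ _ _ ⟨
    D n (λ k r → G k (suc (suc r))) + G (suc n) 1 + G (suc (suc n)) 0
      ≈⟨ +-congʳ (D-snoc n (λ k r → G k (suc r))) ⟨
    D (suc n) (λ k r → G k (suc r)) + G (suc (suc n)) 0
      ≈⟨ D-snoc (suc n) G ⟨
    D (suc (suc n)) G ∎
    where
    G : ℕ → ℕ → Carrier
    G k r = 𝒮 r (λ K → f (K ∷ʳ k))
    G1 : G (suc n) 1 ≈ f (1 ∷ suc n ∷ [])
    G1 = 𝒮-1 _
    shift : ∀ k r → 𝒮 (suc r) (λ K → extend f (K ∷ʳ k)) ≈ G k (suc (suc r))
    shift k r = trans (𝒮-cong (suc r) λ { (j ∷ K) _ → refl }) (sym (𝒮-suc (suc r) _))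

  private
    inc : List ℕ → List ℕ
    inc [] = []
    inc (k ∷ K) = suc k ∷ K

    θ-split₁ : ∀ r m f → 𝒮 (suc r ℕ.+ m) (λ K → ⟦ θ K 1 ≡ᵇ r ⟧ * f K) ≈ 𝒮 m (λ J → f (suc r ∷ J))
    θ-split₁ zero m f = trans (𝒮-suc m _) (𝒮-cong m λ
      { [] _ → *-identityˡ _
      ; (suc k ∷ K) _ → trans (+-cong (*-identityˡ _) (zeroˡ _)) (+-identityʳ _)
      ; (zero ∷ K) (_ , () ∷ _) })
    θ-split₁ (suc r) m f = trans (𝒮-suc (suc r ℕ.+ m) _) (trans
      (𝒮-cong (suc r ℕ.+ m) λ
        { (suc k ∷ K) _ → trans (+-congʳ (zeroˡ _)) (+-identityˡ _)
        ; (zero ∷ K) (_ , () ∷ _) })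
      (θ-split₁ r m (f ∘ inc)))

  -- Prepending a 1 and enlarging the first part both move the cut from h + 1 to h + 2 without
  -- changing `θ`, and they do so by mere computation. Hence `extend` passes through the indicator,
  -- and through `I ++ J` because I is nonempty. For h = 0 the cut comes right after the first part.
  θ-split : ∀ h r m f →
    𝒮 (suc h ℕ.+ r ℕ.+ m) (λ K → ⟦ θ K (suc h) ≡ᵇ r ⟧ * f K) ≈
    𝒮 (suc h ℕ.+ r) (λ I → ⟦ θ I (suc h) ≡ᵇ r ⟧ * 𝒮 m (λ J → f (I ++ J)))
  θ-split zero r m f = trans (θ-split₁ r m f) (sym (begin
    𝒮 (suc r) (λ I → ⟦ θ I 1 ≡ᵇ r ⟧ * 𝒮 m (λ J → f (I ++ J)))
      ≡⟨ ≡.cong (λ n → 𝒮 n (λ I → ⟦ θ I 1 ≡ᵇ r ⟧ * 𝒮 m (λ J → f (I ++ J)))) (ℕₚ.+-identityʳ (suc r)) ⟨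
    𝒮 (suc r ℕ.+ 0) (λ I → ⟦ θ I 1 ≡ᵇ r ⟧ * 𝒮 m (λ J → f (I ++ J)))
      ≈⟨ θ-split₁ r 0 _ ⟩
    𝒮 0 (λ I → 𝒮 m (λ J → f (suc r ∷ I ++ J)))
      ≈⟨ 𝒮-0 _ ⟩
    𝒮 m (λ J → f (suc r ∷ J)) ∎))
  θ-split (suc h) r m f = begin
    𝒮 (suc (suc h ℕ.+ r ℕ.+ m)) (λ K → ⟦ θ K (suc (suc h)) ≡ᵇ r ⟧ * f K)
      ≈⟨ 𝒮-suc (suc h ℕ.+ r ℕ.+ m) _ ⟩
    𝒮 (suc h ℕ.+ r ℕ.+ m) (extend λ K → ⟦ θ K (suc (suc h)) ≡ᵇ r ⟧ * f K)
      ≈⟨ 𝒮-cong (suc h ℕ.+ r ℕ.+ m) (λ { (k ∷ K) _ → sym (distribˡ _ _ _) }) ⟩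
    𝒮 (suc h ℕ.+ r ℕ.+ m) (λ K → ⟦ θ K (suc h) ≡ᵇ r ⟧ * extend f K)
      ≈⟨ θ-split h r m (extend f) ⟩
    𝒮 (suc h ℕ.+ r) (λ I → ⟦ θ I (suc h) ≡ᵇ r ⟧ * 𝒮 m (λ J → extend f (I ++ J)))
      ≈⟨ 𝒮-cong (suc h ℕ.+ r) (λ { (k ∷ K) _ → trans (*-congˡ (𝒮-+ m _ _)) (distribˡ _ _ _) }) ⟩
    𝒮 (suc h ℕ.+ r) (extend λ I → ⟦ θ I (suc (suc h)) ≡ᵇ r ⟧ * 𝒮 m (λ J → f (I ++ J)))
      ≈⟨ 𝒮-suc (suc h ℕ.+ r) _ ⟨
    𝒮 (suc (suc h ℕ.+ r)) (λ I → ⟦ θ I (suc (suc h)) ≡ᵇ r ⟧ * 𝒮 m (λ J → f (I ++ J))) ∎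

-- Weights and last parts of concatenations; the recursive form of Θ.

≤ᵇ-true : ∀ {m n} → m ≤ n → (m ≤ᵇ n) ≡ true
≤ᵇ-true {m} {n} p with m ≤ᵇ n | ℕₚ.≤⇒≤ᵇ p
... | true | _ = ≡.refl

≤ᵇ-false : ∀ {m n} → n < m → (m ≤ᵇ n) ≡ false
≤ᵇ-false {m} {n} p with m ≤ᵇ n in eq
... | false = ≡.refl
... | true = contradiction (ℕₚ.≤ᵇ⇒≤ m n (≡.subst Data.Bool.T (≡.sym eq) _)) (ℕₚ.<⇒≱ p)

≡ᵇ-sym : ∀ m n → (m ≡ᵇ n) ≡ (n ≡ᵇ m)
≡ᵇ-sym zero zero = ≡.refl
≡ᵇ-sym zero (suc n) = ≡.refl
≡ᵇ-sym (suc m) zero = ≡.refl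
≡ᵇ-sym (suc m) (suc n) = ≡ᵇ-sym m n

finEq-sym : ∀ {n} (i j : Fin n) → finEq i j ≡ finEq j i
finEq-sym i j = ≡ᵇ-sym (toℕ i) (toℕ j)

-- The weight of a block of parts that is not at the start of its composition, where the exceptional
-- first factor of `w` is absent.
v : List ℕ → ℕ
v K = product (map (_∸ 1) K)

w-++ : ∀ k I J → w ((k ∷ I) ++ J) ≡ w (k ∷ I) ℕ.* v J
w-++ k I J = ≡.trans
  (≡.cong (k ℕ.*_) (≡.trans (≡.cong product (Listₚ.map-++ (_∸ 1) I J)) (product-++ (map (_∸ 1) I) _)))
  (≡.sym (ℕₚ.*-assoc k _ _))

private
  headOr0 : List ℕ → ℕ
  headOr0 [] = 0
  headOr0 (k ∷ _) = k

  lastPart-headOr0 : ∀ K → lastPart K ≡ headOr0 (reverse K)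
  lastPart-headOr0 K with reverse K
  ... | [] = ≡.refl
  ... | k ∷ _ = ≡.refl

lastPart-∷ʳ : ∀ K k → lastPart (K ∷ʳ k) ≡ k
lastPart-∷ʳ K k rewrite Listₚ.reverse-++ K (k ∷ []) = ≡.refl

dropLast-∷ʳ : ∀ K k → dropLast (K ∷ʳ k) ≡ K
dropLast-∷ʳ K k rewrite Listₚ.reverse-++ K (k ∷ []) = Listₚ.reverse-involutive K

secondLast-∷ʳ : ∀ K k → secondLast (K ∷ʳ k) ≡ lastPart K
secondLast-∷ʳ K k rewrite Listₚ.reverse-++ K (k ∷ []) with reverse K
... | [] = ≡.refl
... | _ ∷ _ = ≡.refl

lastPart-++ : ∀ I j J → lastPart (I ++ j ∷ J) ≡ lastPart (j ∷ J)
lastPart-++ I j J = begin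
  lastPart (I ++ j ∷ J)                             ≡⟨ lastPart-headOr0 (I ++ j ∷ J) ⟩
  headOr0 (reverse (I ++ j ∷ J))                    ≡⟨ ≡.cong headOr0 (Listₚ.reverse-++ I (j ∷ J)) ⟩
  headOr0 (reverse (j ∷ J) ++ reverse I)            ≡⟨ ≡.cong (λ L → headOr0 (L ++ reverse I)) (Listₚ.unfold-reverse j J) ⟩
  headOr0 ((reverse J ∷ʳ j) ++ reverse I)           ≡⟨ headOr0-++ (reverse J) ⟩
  headOr0 (reverse J ∷ʳ j)                          ≡⟨ ≡.cong headOr0 (Listₚ.unfold-reverse j J) ⟨
  headOr0 (reverse (j ∷ J))                         ≡⟨ lastPart-headOr0 (j ∷ J) ⟨
  lastPart (j ∷ J)                                  ∎
  where
  open ≡.≡-Reasoning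
  headOr0-++ : ∀ L → headOr0 ((L ∷ʳ j) ++ reverse I) ≡ headOr0 (L ∷ʳ j)
  headOr0-++ [] = ≡.refl
  headOr0-++ (_ ∷ _) = ≡.refl

lastPart-pos : ∀ {k K} → All (1 ≤_) (k ∷ K) → 1 ≤ lastPart (k ∷ K)
lastPart-pos {k} {[]} (p ∷ []) = p
lastPart-pos {k} {j ∷ K} (_ ∷ ps) = ≡.subst (1 ≤_) (≡.sym (lastPart-++ (k ∷ []) j K)) (lastPart-pos ps)

lastPart≤sum : ∀ K → lastPart K ≤ sum K
lastPart≤sum [] = z≤n
lastPart≤sum (k ∷ []) = ℕₚ.m≤m+n k 0
lastPart≤sum (k ∷ j ∷ K) = ≡.subst (_≤ sum (k ∷ j ∷ K)) (≡.sym (lastPart-++ (k ∷ []) j K))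
  (ℕₚ.≤-trans (lastPart≤sum (j ∷ K)) (ℕₚ.m≤n+m _ k))

-- The two branches of `θ`, with sums in place of truncated differences: the cut is either the end
-- of the part k, or lies in K with b + 1 still to be covered.
data θ-View (k : ℕ) (K : List ℕ) (c : ℕ) : ℕ → Set where
  inside : ∀ d → k ≡ suc c ℕ.+ d → θ-View k K c d
  beyond : ∀ b → suc c ≡ k ℕ.+ suc b → θ-View k K c (θ K (suc b))

θ-view : ∀ k K c → θ-View k K c (θ (k ∷ K) (suc c))
θ-view k K c with c <ᵇ k in eq
... | true = inside (k ∸ suc c) (≡.sym (ℕₚ.m+[n∸m]≡n (ℕₚ.<ᵇ⇒< c k (≡.subst Data.Bool.T (≡.sym eq) _))))
... | false = ≡.subst (λ b → θ-View k K c (θ K b)) (≡.sym (ℕₚ.+-∸-assoc 1 k≤c))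
    (beyond (c ∸ k) (≡.sym (≡.trans (ℕₚ.+-suc k _) (≡.cong suc (ℕₚ.m+[n∸m]≡n k≤c)))))
  where
  k≤c : k ≤ c
  k≤c = ℕₚ.≮⇒≥ λ p → ≡.subst Data.Bool.T eq (ℕₚ.<⇒<ᵇ p)

-- The whole sum is itself a partial sum that reaches h.
θ-≤ : ∀ K h d → sum K ≡ h ℕ.+ d → θ K h ≤ d
θ-≤ K zero d eq = z≤n
θ-≤ [] (suc c) d ()
θ-≤ (k ∷ K) (suc c) d eq with θ (k ∷ K) (suc c) | θ-view k K c
... | .b | inside b k≡ = ℕₚ.+-cancelˡ-≤ (suc c) b d (≡.subst₂ _≤_ k≡ eq (ℕₚ.m≤m+n k (sum K)))
... | ._ | beyond b c≡ = θ-≤ K (suc b) d (ℕₚ.+-cancelˡ-≡ k _ _ (≡.trans eq (≡.trans (≡.cong (ℕ._+ d) c≡) (ℕₚ.+-assoc k (suc b) d))))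

θ-∷ : ∀ i J c → θ (i ∷ J) (i ℕ.+ suc c) ≡ θ J (suc c)
θ-∷ i J c rewrite ℕₚ.+-suc i c | ≤ᵇ-false {suc (i ℕ.+ c)} {i} (s≤s (ℕₚ.m≤m+n i c)) | ≡.sym (ℕₚ.+-suc i c)
  = ≡.cong (θ J) (ℕₚ.m+n∸m≡n i (suc c))

θ-++ : ∀ I J c → θ (I ++ J) (sum I ℕ.+ suc c) ≡ θ J (suc c)
θ-++ [] J c = ≡.refl
θ-++ (i ∷ I) J c = begin
  θ (i ∷ I ++ J) (i ℕ.+ sum I ℕ.+ suc c)    ≡⟨ ≡.cong (θ (i ∷ I ++ J)) (≡.trans (ℕₚ.+-assoc i (sum I) (suc c)) (≡.cong (i ℕ.+_) (ℕₚ.+-suc (sum I) c))) ⟩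
  θ (i ∷ I ++ J) (i ℕ.+ suc (sum I ℕ.+ c))  ≡⟨ θ-∷ i (I ++ J) (sum I ℕ.+ c) ⟩
  θ (I ++ J) (suc (sum I ℕ.+ c))            ≡⟨ ≡.cong (θ (I ++ J)) (ℕₚ.+-suc (sum I) c) ⟨
  θ (I ++ J) (sum I ℕ.+ suc c)              ≡⟨ θ-++ I J c ⟩
  θ J (suc c)                               ∎
  where open ≡.≡-Reasoning

-- The total is the first partial sum to reach h + 1, so the sum without the last part is at most h,
-- and the last part makes up the remaining r + 1 at least.
last-after-θ : ∀ K h r → All (1 ≤_) K → θ K (suc h) ≡ r → sum K ≡ suc h ℕ.+ r → suc r ≤ lastPart K
last-after-θ [] h r ps θ≡ ()
last-after-θ (k ∷ K) h r ps θ≡ eq with θ (k ∷ K) (suc h) | θ-view k K h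
last-after-θ (k ∷ []) h r ps ≡.refl eq | .r | inside .r ≡.refl = s≤s (ℕₚ.m≤n+m r h)
last-after-θ (k ∷ suc j ∷ K) h r ps ≡.refl eq | .r | inside .r ≡.refl =
  contradiction (ℕₚ.+-cancelˡ-≡ k (suc (j ℕ.+ sum K)) 0 (≡.trans eq (≡.sym (ℕₚ.+-identityʳ k)))) λ ()
last-after-θ (k ∷ zero ∷ K) h r (_ ∷ () ∷ _) ≡.refl eq | .r | inside .r ≡.refl
last-after-θ (k ∷ K) h r (_ ∷ ps) θ≡ eq | ._ | beyond b c≡
  with last-after-θ K b r ps θ≡ (ℕₚ.+-cancelˡ-≡ k _ _ (≡.trans eq (≡.trans (≡.cong (ℕ._+ r) c≡) (ℕₚ.+-assoc k (suc b) r))))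
last-after-θ (k ∷ []) h r (_ ∷ ps) θ≡ eq | ._ | beyond b c≡ | ()
last-after-θ (k ∷ j ∷ K) h r (_ ∷ ps) θ≡ eq | ._ | beyond b c≡ | p =
  ≡.subst (suc r ≤_) (≡.sym (lastPart-++ (k ∷ []) j K)) p

-- The cut of an individual composition; `θ-split` gives it only under the summation sign. Needed
-- for the divisibility behind the rational coefficients.
θ-prefix : ∀ K h → h ≤ sum K → ∃₂ λ I J → K ≡ I ++ J × sum I ≡ h ℕ.+ θ K h
θ-prefix K zero p = [] , K , ≡.refl , ≡.refl
θ-prefix [] (suc h) ()
θ-prefix (k ∷ K) (suc h) p with θ (k ∷ K) (suc h) | θ-view k K h
... | .b | inside b k≡ = k ∷ [] , K , ≡.refl , ≡.trans (ℕₚ.+-identityʳ k) k≡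
... | ._ | beyond b h≡ with θ-prefix K (suc b) (ℕₚ.+-cancelˡ-≤ k _ _ (≡.subst (_≤ sum (k ∷ K)) h≡ p))
... | I , J , ≡.refl , s = k ∷ I , J , ≡.refl ,
  ≡.trans (≡.cong (k ℕ.+_) s) (≡.trans (≡.sym (ℕₚ.+-assoc k (suc b) _)) (≡.cong (ℕ._+ θ (I ++ J) (suc b)) (≡.sym h≡)))

private
  -- `σ` with the scan started at s, so that induction along the list is possible.
  σ′ : ℕ → List ℕ → ℕ → ℕ
  σ′ s K c = foldr _⊓_ (s ℕ.+ sum K) (filterᵇ (c ≤ᵇ_) (scanl ℕ._+_ s K))

  σ′-≥ : ∀ s t K c → t ≤ s → t ≤ σ′ s K c
  σ′-≥ s t [] c p with c ≤ᵇ s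
  ... | true = ℕₚ.⊓-glb p (ℕₚ.≤-trans p (ℕₚ.m≤m+n s 0))
  ... | false = ℕₚ.≤-trans p (ℕₚ.m≤m+n s 0)
  σ′-≥ s t (k ∷ K) c p rewrite ≡.sym (ℕₚ.+-assoc s k (sum K)) with c ≤ᵇ s
  ... | true = ℕₚ.⊓-glb p (σ′-≥ (s ℕ.+ k) t K c (ℕₚ.≤-trans p (ℕₚ.m≤m+n s k)))
  ... | false = σ′-≥ (s ℕ.+ k) t K c (ℕₚ.≤-trans p (ℕₚ.m≤m+n s k))

  σ′-at : ∀ s K c → c ≤ s → σ′ s K c ≡ s
  σ′-at s [] c p rewrite ≤ᵇ-true p = ℕₚ.m≤n⇒m⊓n≡m (ℕₚ.m≤m+n s 0)
  σ′-at s (k ∷ K) c p rewrite ≤ᵇ-true p | ≡.sym (ℕₚ.+-assoc s k (sum K)) =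
    ℕₚ.m≤n⇒m⊓n≡m (σ′-≥ (s ℕ.+ k) s K c (ℕₚ.m≤m+n s k))

  σ′-θ : ∀ s K c → suc c ≤ sum K → σ′ s K (s ℕ.+ suc c) ≡ s ℕ.+ suc c ℕ.+ θ K (suc c)
  σ′-θ s [] c ()
  σ′-θ s (k ∷ K) c p rewrite ≤ᵇ-false (ℕₚ.m<m+n s {suc c} (s≤s z≤n)) | ≡.sym (ℕₚ.+-assoc s k (sum K))
    with θ (k ∷ K) (suc c) | θ-view k K c
  ... | .d | inside d ≡.refl = ≡.trans (σ′-at (s ℕ.+ k) K _ (ℕₚ.+-monoʳ-≤ s (ℕₚ.m≤m+n (suc c) d))) (≡.sym (ℕₚ.+-assoc s (suc c) d))
  ... | ._ | beyond b c≡ rewrite c≡ | ≡.sym (ℕₚ.+-assoc s k (suc b)) =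
    σ′-θ (s ℕ.+ k) K b (ℕₚ.+-cancelˡ-≤ k _ _ p)

Θ≡θ : ∀ K c → c ≤ sum K → Θ K c ≡ θ K c
Θ≡θ K zero p = σ′-at 0 K 0 z≤n
Θ≡θ K (suc c) p = ≡.trans (≡.cong (_∸ suc c) (σ′-θ 0 K c p)) (ℕₚ.m+n∸m≡n (suc c) _)

-- Vectors indexed by colours and elementary symmetric functions.

module ColourVectors (R : CommutativeRing 0ℓ 0ℓ) where
  open RingTools R

  infixl 8 _∖_
  -- The entry is replaced by 0 and not deleted, so that the set of colours stays fixed; elementary
  -- symmetric functions do not see the difference.
  _∖_ : ∀ {n} → (Fin n → Carrier) → Fin n → Fin n → Carrier
  (y ∖ i) j = ⟦ not (finEq j i) ⟧ * y j

  opaque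
    ∥_∥ : ∀ {n} → (Fin n → Carrier) → Carrier
    ∥_∥ {n} f = Σ (allFin n) f

    ∥∥-Σ : ∀ {n} (f : Fin n → Carrier) → Σ (allFin n) f ≈ ∥ f ∥
    ∥∥-Σ f = refl

    ∥∥-zero : (f : Fin 0 → Carrier) → ∥ f ∥ ≈ 0#
    ∥∥-zero f = refl

    ∥∥-suc : ∀ {n} (f : Fin (suc n) → Carrier) → ∥ f ∥ ≈ f zero + ∥ f ∘ suc ∥
    ∥∥-suc f = Σ-allFin-suc f

    ∥∥-cong : ∀ {n} {f g : Fin n → Carrier} → (∀ i → f i ≈ g i) → ∥ f ∥ ≈ ∥ g ∥
    ∥∥-cong {n} = Σ-cong (allFin n)

    ∥∥-+ : ∀ {n} (f g : Fin n → Carrier) → ∥ (λ i → f i + g i) ∥ ≈ ∥ f ∥ + ∥ g ∥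
    ∥∥-+ {n} = Σ-+ (allFin n)

    ∥∥-- : ∀ {n} (f g : Fin n → Carrier) → ∥ (λ i → f i - g i) ∥ ≈ ∥ f ∥ - ∥ g ∥
    ∥∥-- {n} = Σ-- (allFin n)

    ∥∥-*ˡ : ∀ {n} c (f : Fin n → Carrier) → ∥ (λ i → c * f i) ∥ ≈ c * ∥ f ∥
    ∥∥-*ˡ {n} = Σ-*ˡ (allFin n)

    ∥∥-*ʳ : ∀ {n} c (f : Fin n → Carrier) → ∥ (λ i → f i * c) ∥ ≈ ∥ f ∥ * c
    ∥∥-*ʳ {n} = Σ-*ʳ (allFin n)

    ∥∥-swap : ∀ {m n} (f : Fin m → Fin n → Carrier) →
      ∥ (λ i → ∥ f i ∥) ∥ ≈ ∥ (λ j → ∥ (λ i → f i j) ∥) ∥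
    ∥∥-swap {m} {n} = Σ-swap (allFin m) (allFin n)

    ∥∥-∖ : ∀ {n} (f : Fin n → Carrier) (c : Fin n) → ∥ f ∖ c ∥ ≈ ∥ f ∥ - f c
    ∥∥-∖ f c = Σ-avoid c f

  e : ℕ → ∀ {n} → (Fin n → Carrier) → Carrier
  e zero y = 1#
  e (suc k) {zero} y = 0#
  e (suc k) {suc n} y = e (suc k) (y ∘ suc) + y zero * e k (y ∘ suc)

  e-cong : ∀ k {n} {y z : Fin n → Carrier} → (∀ i → y i ≈ z i) → e k y ≈ e k z
  e-cong zero eq = refl
  e-cong (suc k) {zero} eq = refl
  e-cong (suc k) {suc n} eq = +-cong (e-cong (suc k) (eq ∘ suc)) (*-cong (eq zero) (e-cong k (eq ∘ suc)))

  private
    e-∖zero : ∀ k {n} (y : Fin (suc n) → Carrier) → e k (y ∖ zero) ≈ e k (y ∘ suc)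
    e-∖zero zero y = refl
    e-∖zero (suc k) y = begin
      e (suc k) (λ i → 1# * y (suc i)) + (0# * y zero) * e k ((y ∖ zero) ∘ suc)
        ≈⟨ +-cong (e-cong (suc k) λ i → *-identityˡ (y (suc i))) (trans (*-congʳ (zeroˡ _)) (zeroˡ _)) ⟩
      e (suc k) (y ∘ suc) + 0#
        ≈⟨ +-identityʳ _ ⟩
      e (suc k) (y ∘ suc) ∎

  e-split : ∀ k {n} (y : Fin n → Carrier) i → e (suc k) y ≈ e (suc k) (y ∖ i) + y i * e k (y ∖ i)
  e-split k y zero = sym (+-cong (e-∖zero (suc k) y) (*-congˡ (e-∖zero k y)))
  e-split zero y (suc i) = begin
    e 1 (y ∘ suc) + y zero * 1#
      ≈⟨ +-congʳ (e-split zero (y ∘ suc) i) ⟩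
    e 1 ((y ∘ suc) ∖ i) + y (suc i) * 1# + y zero * 1#
      -- The variable o stands for `1#`, which the solver keeps apart from its own constant
      -- `con (+ 1)`; the next step reconciles the two.
      ≈⟨ solve 4 (λ a b c o → a :+ b :* o :+ c :* o := (a :+ (con (+ 1) :* c) :* o) :+ b :* o)
           refl _ _ _ 1# ⟩
    (e 1 ((y ∘ suc) ∖ i) + ι 1 * y zero * 1#) + y (suc i) * 1#
      ≈⟨ +-congʳ (+-congˡ (*-congʳ (*-congʳ (+-identityʳ 1#)))) ⟩
    (e 1 ((y ∘ suc) ∖ i) + (1# * y zero) * 1#) + y (suc i) * 1# ∎
  e-split (suc k) y (suc i) = begin
    e (2 ℕ.+ k) (y ∘ suc) + y zero * e (suc k) (y ∘ suc)
      ≈⟨ +-cong (e-split (suc k) (y ∘ suc) i) (*-congˡ (e-split k (y ∘ suc) i)) ⟩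
    (E₂ + y (suc i) * E₁) + y zero * (E₁ + y (suc i) * E₀)
      ≈⟨ solve 5 (λ E₂ E₁ E₀ a b → (E₂ :+ b :* E₁) :+ a :* (E₁ :+ b :* E₀)
           := (E₂ :+ a :* E₁) :+ b :* (E₁ :+ a :* E₀)) refl E₂ E₁ E₀ (y zero) (y (suc i)) ⟩
    (E₂ + y zero * E₁) + y (suc i) * (E₁ + y zero * E₀)
      ≈⟨ +-cong (+-congˡ (*-congʳ (*-identityˡ _))) (*-congˡ (+-congˡ (*-congʳ (*-identityˡ _)))) ⟨
    (E₂ + (1# * y zero) * E₁) + y (suc i) * (E₁ + (1# * y zero) * E₀) ∎
    where
    E₂ = e (2 ℕ.+ k) ((y ∘ suc) ∖ i)
    E₁ = e (suc k) ((y ∘ suc) ∖ i)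
    E₀ = e k ((y ∘ suc) ∖ i)

  -- Each squarefree monomial of degree k + 1 arises once for every variable in it.
  e-euler : ∀ k {n} (y : Fin n → Carrier) → ∥ (λ i → y i * e k (y ∖ i)) ∥ ≈ ι (suc k) * e (suc k) y
  e-euler k {zero} y = trans (∥∥-zero _) (sym (zeroʳ _))
  e-euler zero {suc n} y = begin
    ∥ (λ i → y i * 1#) ∥
      ≈⟨ ∥∥-suc _ ⟩
    y zero * 1# + ∥ (λ i → y (suc i) * 1#) ∥
      ≈⟨ +-congˡ (e-euler zero (y ∘ suc)) ⟩
    y zero * 1# + ι 1 * e 1 (y ∘ suc)
      ≈⟨ solve 3 (λ a b o → a :* o :+ con (+ 1) :* b := con (+ 1) :* (b :+ a :* o)) refl (y zero) _ 1# ⟩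
    ι 1 * (e 1 (y ∘ suc) + y zero * 1#) ∎
  e-euler (suc k) {suc n} y = begin
    ∥ (λ i → y i * e (suc k) (y ∖ i)) ∥
      ≈⟨ ∥∥-suc _ ⟩
    y zero * e (suc k) (y ∖ zero) + ∥ (λ i → y (suc i) * (e (suc k) (y′ ∖ i) + (1# * y zero) * e k (y′ ∖ i))) ∥
      ≈⟨ +-cong (*-congˡ (e-∖zero (suc k) y)) (∥∥-cong λ i →
           trans (*-congˡ (+-congˡ (*-congʳ (*-identityˡ _))))
             (solve 4 (λ a b c d → a :* (b :+ c :* d) := a :* b :+ c :* (a :* d)) refl _ _ _ _)) ⟩
    y zero * e (suc k) y′ + ∥ (λ i → y′ i * e (suc k) (y′ ∖ i) + y zero * (y′ i * e k (y′ ∖ i))) ∥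
      ≈⟨ +-congˡ (trans (∥∥-+ _ _) (+-cong (e-euler (suc k) y′)
           (trans (∥∥-*ˡ (y zero) _) (*-congˡ (e-euler k y′))))) ⟩
    y zero * e (suc k) y′ + (ι (2 ℕ.+ k) * e (2 ℕ.+ k) y′ + y zero * (ι (suc k) * e (suc k) y′))
      ≈⟨ +-congˡ (+-congʳ (*-congʳ (ι-+ 1 (suc k)))) ⟩
    y zero * e (suc k) y′ + ((ι 1 + ι (suc k)) * e (2 ℕ.+ k) y′ + y zero * (ι (suc k) * e (suc k) y′))
      ≈⟨ solve 4 (λ a b c d → a :* b :+ ((con (+ 1) :+ c) :* d :+ a :* (c :* b))
           := (con (+ 1) :+ c) :* (d :+ a :* b)) refl (y zero) (e (suc k) y′) (ι (suc k)) (e (2 ℕ.+ k) y′) ⟩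
    (ι 1 + ι (suc k)) * (e (2 ℕ.+ k) y′ + y zero * e (suc k) y′)
      ≈⟨ *-congʳ (ι-+ 1 (suc k)) ⟨
    ι (2 ℕ.+ k) * (e (2 ℕ.+ k) y′ + y zero * e (suc k) y′) ∎
    where y′ = y ∘ suc

-- Transfer operators for the path and for the twinned vertex.

module Transfer (R : CommutativeRing 0ℓ 0ℓ) {N : ℕ} (x : Fin N → CommutativeRing.Carrier R) where
  open RingTools R
  open ColourVectors R

  infix 4 _≋_
  _≋_ : (φ ψ : Fin N → Carrier) → Set
  φ ≋ ψ = ∀ i → φ i ≈ ψ i

  M : (Fin N → Carrier) → Fin N → Carrier
  M φ i = x i * (∥ φ ∥ - φ i)

  infixr 8 M^_∙_
  M^_∙_ : ℕ → (Fin N → Carrier) → Fin N → Carrier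
  M^ zero ∙ φ = φ
  M^ suc j ∙ φ = M (M^ j ∙ φ)

  M-cong : ∀ {φ ψ} → φ ≋ ψ → M φ ≋ M ψ
  M-cong eq i = *-congˡ (+-cong (∥∥-cong eq) (-‿cong (eq i)))

  M^-cong : ∀ j {φ ψ} → φ ≋ ψ → M^ j ∙ φ ≋ M^ j ∙ ψ
  M^-cong zero eq = eq
  M^-cong (suc j) eq = M-cong (M^-cong j eq)

  M^-M : ∀ j φ → M^ j ∙ M φ ≋ M (M^ j ∙ φ)
  M^-M zero φ i = refl
  M^-M (suc j) φ = M-cong (M^-M j φ)

  M^-+ : ∀ j φ ψ → M^ j ∙ (λ i → φ i + ψ i) ≋ (λ i → (M^ j ∙ φ) i + (M^ j ∙ ψ) i)
  M^-+ zero φ ψ i = refl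
  M^-+ (suc j) φ ψ i = trans (M-cong (M^-+ j φ ψ) i) (trans
    (*-congˡ (+-congʳ (∥∥-+ _ _)))
    (solve 5 (λ x a b c d → x :* (a :+ b :- (c :+ d)) := x :* (a :- c) :+ x :* (b :- d)) refl _ _ _ _ _))

  M^-*ˡ : ∀ j c φ → M^ j ∙ (λ i → c * φ i) ≋ (λ i → c * (M^ j ∙ φ) i)
  M^-*ˡ zero c φ i = refl
  M^-*ˡ (suc j) c φ i = trans (M-cong (M^-*ˡ j c φ) i) (trans
    (*-congˡ (+-congʳ (∥∥-*ˡ c _)))
    (solve 4 (λ x c a b → x :* (c :* a :- c :* b) := c :* (x :* (a :- b))) refl _ _ _ _))

  -- Lets the sum over the colour of the twin pass through the stretch of path that lies beyond its
  -- neighbours.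
  M^-∥∥ : ∀ j {n} (Φ : Fin n → Fin N → Carrier) →
    M^ j ∙ (λ t → ∥ (λ c → Φ c t) ∥) ≋ (λ t → ∥ (λ c → (M^ j ∙ Φ c) t) ∥)
  M^-∥∥ zero Φ t = refl
  M^-∥∥ (suc j) Φ t = begin
    M (M^ j ∙ (λ t → ∥ (λ c → Φ c t) ∥)) t
      ≈⟨ M-cong (M^-∥∥ j Φ) t ⟩
    x t * (∥ (λ s → ∥ (λ c → (M^ j ∙ Φ c) s) ∥) ∥ - ∥ (λ c → (M^ j ∙ Φ c) t) ∥)
      ≈⟨ *-congˡ (+-congʳ (∥∥-swap _)) ⟩
    x t * (∥ (λ c → ∥ M^ j ∙ Φ c ∥) ∥ - ∥ (λ c → (M^ j ∙ Φ c) t) ∥)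
      ≈⟨ *-congˡ (∥∥-- _ _) ⟨
    x t * ∥ (λ c → ∥ M^ j ∙ Φ c ∥ - (M^ j ∙ Φ c) t) ∥
      ≈⟨ ∥∥-*ˡ (x t) _ ⟨
    ∥ (λ c → (M^ suc j ∙ Φ c) t) ∥ ∎

  ∥M∥ : ∀ φ → ∥ M φ ∥ ≈ ∥ x ∥ * ∥ φ ∥ - ∥ (λ i → x i * φ i) ∥
  ∥M∥ φ = begin
    ∥ (λ i → x i * (∥ φ ∥ - φ i)) ∥
      ≈⟨ ∥∥-cong (λ i → solve 3 (λ x s f → x :* (s :- f) := x :* s :- x :* f) refl (x i) ∥ φ ∥ (φ i)) ⟩
    ∥ (λ i → x i * ∥ φ ∥ - x i * φ i) ∥
      ≈⟨ ∥∥-- _ _ ⟩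
    ∥ (λ i → x i * ∥ φ ∥) ∥ - ∥ (λ i → x i * φ i) ∥
      ≈⟨ +-congʳ (∥∥-*ʳ ∥ φ ∥ x) ⟩
    ∥ x ∥ * ∥ φ ∥ - ∥ (λ i → x i * φ i) ∥ ∎

  ε : ℕ → Fin N → Carrier
  ε k i = x i * e k (x ∖ i)

  ∥ε∥ : ∀ k → ∥ ε k ∥ ≈ ι (suc k) * e (suc k) x
  ∥ε∥ k = e-euler k x

  ε-0 : ε 0 ≋ x
  ε-0 i = *-identityʳ _

  Mε : ∀ k → M (ε k) ≋ (λ i → ε (suc k) i + (ι k * e (suc k) x) * x i)
  Mε k i = begin
    x i * (∥ ε k ∥ - x i * e k (x ∖ i))
      ≈⟨ *-congˡ (+-congʳ (trans (∥ε∥ k) (*-congʳ (ι-+ 1 k)))) ⟩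
    x i * ((ι 1 + ι k) * e (suc k) x - x i * e k (x ∖ i))
      ≈⟨ solve 4 (λ x c E f → x :* ((con (+ 1) :+ c) :* E :- x :* f)
           := x :* (E :- x :* f) :+ (c :* E) :* x) refl (x i) (ι k) (e (suc k) x) _ ⟩
    x i * (e (suc k) x - x i * e k (x ∖ i)) + (ι k * e (suc k) x) * x i
      ≈⟨ +-congʳ (*-congˡ (+-congʳ (e-split k x i))) ⟩
    x i * ((e (suc k) (x ∖ i) + x i * e k (x ∖ i)) - x i * e k (x ∖ i)) + (ι k * e (suc k) x) * x i
      ≈⟨ +-congʳ (*-congˡ (solve 2 (λ a b → a :+ b :- b := a) refl _ _)) ⟩
    ε (suc k) i + (ι k * e (suc k) x) * x i ∎

  -- (a-1)! L (a-1) j is the chromatic symmetric function of the lollipop K_a^j,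
  -- and P n is that of the path on n vertices.
  L : ℕ → ℕ → Carrier
  L k j = ∥ M^ j ∙ ε k ∥

  P : ℕ → Carrier
  P zero = 1#
  P (suc j) = ∥ M^ j ∙ x ∥

  L-0 : ∀ k → L k 0 ≈ ι (suc k) * e (suc k) x
  L-0 = ∥ε∥

  -- Powers of `M` commute, so the extra step can be taken at the clique end of the path, where `Mε`
  -- resolves it.
  L-suc : ∀ k j → L k (suc j) ≈ L (suc k) j + ι k * e (suc k) x * P (suc j)
  L-suc k j = begin
    ∥ M (M^ j ∙ ε k) ∥
      ≈⟨ ∥∥-cong (M^-M j (ε k)) ⟨
    ∥ M^ j ∙ M (ε k) ∥
      ≈⟨ ∥∥-cong (M^-cong j (Mε k)) ⟩
    ∥ M^ j ∙ (λ i → ε (suc k) i + (ι k * e (suc k) x) * x i) ∥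
      ≈⟨ ∥∥-cong (M^-+ j _ _) ⟩
    ∥ (λ i → (M^ j ∙ ε (suc k)) i + (M^ j ∙ (λ i → (ι k * e (suc k) x) * x i)) i) ∥
      ≈⟨ ∥∥-+ _ _ ⟩
    L (suc k) j + ∥ M^ j ∙ (λ i → (ι k * e (suc k) x) * x i) ∥
      ≈⟨ +-congˡ (trans (∥∥-cong (M^-*ˡ j _ x)) (∥∥-*ˡ _ _)) ⟩
    L (suc k) j + ι k * e (suc k) x * P (suc j) ∎

  P≈L : ∀ j → P (suc j) ≈ L 0 j
  P≈L j = ∥∥-cong (M^-cong j λ i → sym (ε-0 i))

  -- Transfer across the twinned vertex: c is the colour of the twin, which the
  -- three consecutive path vertices adjacent to it must avoid.
  T : (Fin N → Carrier) → Fin N → Carrier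
  T φ t = ∥ (λ c → x c * (M (M (φ ∖ c) ∖ c) ∖ c) t) ∥

  module _ (φ : Fin N → Carrier) where
    private
      s = ∥ φ ∥
      p = ∥ x ∥
      q = ∥ (λ i → x i * φ i) ∥
      p₂ = ∥ (λ i → x i * x i) ∥
      r = ∥ (λ i → x i * (x i * φ i)) ∥

      M²-norm : ∀ ψ → ∥ M (M ψ) ∥ ≈ p * (p * ∥ ψ ∥ - ∥ (λ i → x i * ψ i) ∥)
        - (p₂ * ∥ ψ ∥ - ∥ (λ i → x i * (x i * ψ i)) ∥)
      M²-norm ψ = begin
        ∥ M (M ψ) ∥
          ≈⟨ ∥M∥ (M ψ) ⟩
        p * ∥ M ψ ∥ - ∥ (λ i → x i * (x i * (∥ ψ ∥ - ψ i))) ∥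
          ≈⟨ +-cong (*-congˡ (∥M∥ ψ)) (-‿cong (begin
             ∥ (λ i → x i * (x i * (∥ ψ ∥ - ψ i))) ∥
               ≈⟨ ∥∥-cong (λ i → solve 3 (λ x s f → x :* (x :* (s :- f)) := x :* x :* s :- x :* (x :* f)) refl (x i) ∥ ψ ∥ (ψ i)) ⟩
             ∥ (λ i → x i * x i * ∥ ψ ∥ - x i * (x i * ψ i)) ∥
               ≈⟨ trans (∥∥-- _ _) (+-congʳ (∥∥-*ʳ ∥ ψ ∥ _)) ⟩
             p₂ * ∥ ψ ∥ - ∥ (λ i → x i * (x i * ψ i)) ∥ ∎)) ⟩
        p * (p * ∥ ψ ∥ - ∥ (λ i → x i * ψ i) ∥) - (p₂ * ∥ ψ ∥ - ∥ (λ i → x i * (x i * ψ i)) ∥) ∎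

      M-∖ : ∀ c ψ j → (M (ψ ∖ c) ∖ c) j ≈ ((λ j → x j * (∥ ψ ∥ - ψ c - ψ j)) ∖ c) j
      M-∖ c ψ j = *-congʳ-if (not (finEq j c)) λ eq →
        *-congˡ (+-cong (∥∥-∖ ψ c) (-‿cong (trans (*-congʳ (⟦⟧-cong eq)) (*-identityˡ (ψ j)))))

      H : Fin N → Fin N → Carrier
      H c j = x j * (s - φ c - φ j)

      norm-H : ∀ c → ∥ H c ∥ ≈ p * (s - φ c) - q
      norm-H c = begin
        ∥ (λ j → x j * (s - φ c - φ j)) ∥
          ≈⟨ ∥∥-cong (λ j → solve 3 (λ x s f → x :* (s :- f) := x :* s :- x :* f) refl (x j) (s - φ c) (φ j)) ⟩
        ∥ (λ j → x j * (s - φ c) - x j * φ j) ∥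
          ≈⟨ trans (∥∥-- _ _) (+-congʳ (∥∥-*ʳ (s - φ c) x)) ⟩
        p * (s - φ c) - q ∎

      -- The summand of `T φ t` for a twin of colour c different from t. Being a polynomial, it also
      -- has a value at c = t, so the sum over c is a full sum minus its diagonal term.
      G : Fin N → Fin N → Carrier
      G t c = x c * (x t * ((p * (s - φ c) - q) - x c * (s - φ c - φ c) - x t * (s - φ c - φ t)))

      T-summand : ∀ t c → x c * (M (M (φ ∖ c) ∖ c) ∖ c) t ≈ (G t ∖ t) c
      T-summand t c = begin
        x c * (M (M (φ ∖ c) ∖ c) ∖ c) t
          ≈⟨ *-congˡ (*-congˡ (*-congˡ (+-cong (∥∥-cong (M-∖ c φ)) (-‿cong (M-∖ c φ t))))) ⟩
        x c * (M (H c ∖ c) ∖ c) t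
          ≈⟨ *-congˡ (M-∖ c (H c) t) ⟩
        x c * (⟦ not (finEq t c) ⟧ * (x t * (∥ H c ∥ - H c c - H c t)))
          ≈⟨ *-congˡ (*-congˡ (*-congˡ (+-congʳ (+-congʳ (norm-H c))))) ⟩
        x c * (⟦ not (finEq t c) ⟧ * (x t * ((p * (s - φ c) - q) - H c c - H c t)))
          ≈⟨ solve 3 (λ a b c → a :* (b :* c) := b :* (a :* c)) refl _ _ _ ⟩
        ⟦ not (finEq t c) ⟧ * G t c
          ≈⟨ *-congʳ (⟦⟧-cong (≡.cong not (finEq-sym t c))) ⟩
        ⟦ not (finEq c t) ⟧ * G t c ∎

      norm-G : ∀ t → ∥ G t ∥ ≈
        x t * (p * (p * s - q - x t * (s - φ t)) + q * (x t - p) - p₂ * s + ι 2 * r)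
      norm-G t = begin
        ∥ G t ∥
          ≈⟨ ∥∥-cong (λ c → solve 7 (λ xc fc xt ft s p q →
               xc :* (xt :* ((p :* (s :- fc) :- q) :- xc :* (s :- fc :- fc) :- xt :* (s :- fc :- ft)))
               := (xt :* (p :* s :- q :- xt :* (s :- ft))) :* xc :+ (xt :* (xt :- p)) :* (xc :* fc)
                  :+ ((con (+ 0) :- xt :* s) :* (xc :* xc) :+ (con (+ 2) :* xt) :* (xc :* (xc :* fc))))
               refl (x c) (φ c) (x t) (φ t) s p q) ⟩
        ∥ (λ c → a₁ * x c + a₂ * (x c * φ c) + (a₃ * (x c * x c) + a₄ * (x c * (x c * φ c)))) ∥
          ≈⟨ trans (∥∥-+ _ _) (+-cong (trans (∥∥-+ _ _) (+-cong (∥∥-*ˡ a₁ x) (∥∥-*ˡ a₂ _)))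
               (trans (∥∥-+ _ _) (+-cong (∥∥-*ˡ a₃ _) (∥∥-*ˡ a₄ _)))) ⟩
        a₁ * p + a₂ * q + (a₃ * p₂ + a₄ * r)
          ≈⟨ solve 7 (λ xt ft s p q p₂ r →
               (xt :* (p :* s :- q :- xt :* (s :- ft))) :* p :+ (xt :* (xt :- p)) :* q
                  :+ ((con (+ 0) :- xt :* s) :* p₂ :+ (con (+ 2) :* xt) :* r)
               := xt :* (p :* (p :* s :- q :- xt :* (s :- ft)) :+ q :* (xt :- p) :- p₂ :* s :+ con (+ 2) :* r))
               refl (x t) (φ t) s p q p₂ r ⟩
        x t * (p * (p * s - q - x t * (s - φ t)) + q * (x t - p) - p₂ * s + ι 2 * r) ∎
        where
        a₁ = x t * (p * s - q - x t * (s - φ t))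
        a₂ = x t * (x t - p)
        a₃ = 0# - x t * s
        a₄ = ι 2 * x t

    -- After the sum over c, everything is a polynomial in `x t`, `φ t` and the five sums s, p, q,
    -- p₂, r, so the claim is a polynomial identity.
    T-expand : T φ ≋ λ t →
      ι 4 * (M^ 3 ∙ φ) t + ι 2 * p * (M^ 2 ∙ φ) t - ι 2 * ∥ φ ∥ * (M^ 2 ∙ x) t
      - ι 2 * ∥ M φ ∥ * M x t - ι 2 * ∥ M^ 2 ∙ φ ∥ * x t + ∥ M x ∥ * ∥ φ ∥ * x t
    T-expand t = begin
      T φ t
        ≈⟨ ∥∥-cong (T-summand t) ⟩
      ∥ G t ∖ t ∥
        ≈⟨ ∥∥-∖ (G t) t ⟩
      ∥ G t ∥ - G t t
        ≈⟨ +-congʳ (norm-G t) ⟩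
      x t * (p * (p * s - q - x t * (s - φ t)) + q * (x t - p) - p₂ * s + ι 2 * r) - G t t
        -- Here m, m₂ and n are the norms of `M φ`, `M^ 2 ∙ φ` and `M x`, written through the five
        -- sums.
        ≈⟨ solve 7 (λ xt ft s p q p₂ r →
             let m = p :* s :- q
                 m₂ = p :* m :- (p₂ :* s :- r)
                 n = p :* p :- p₂
             in xt :* (p :* (p :* s :- q :- xt :* (s :- ft)) :+ q :* (xt :- p) :- p₂ :* s :+ con (+ 2) :* r)
                :- xt :* (xt :* ((p :* (s :- ft) :- q) :- xt :* (s :- ft :- ft) :- xt :* (s :- ft :- ft)))
             := con (+ 4) :* (xt :* (m₂ :- xt :* (m :- xt :* (s :- ft))))
                :+ con (+ 2) :* p :* (xt :* (m :- xt :* (s :- ft)))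
                :- con (+ 2) :* s :* (xt :* (n :- xt :* (p :- xt)))
                :- con (+ 2) :* m :* (xt :* (p :- xt))
                :- con (+ 2) :* m₂ :* xt
                :+ n :* s :* xt)
             refl (x t) (φ t) s p q p₂ r ⟩
      ι 4 * (x t * (m₂ - x t * (m - x t * (s - φ t)))) + ι 2 * p * (x t * (m - x t * (s - φ t)))
      - ι 2 * s * (x t * (n - x t * (p - x t))) - ι 2 * m * (x t * (p - x t)) - ι 2 * m₂ * x t + n * s * x t
        ≈⟨ +-cong (+-cong (+-cong (+-cong (+-cong
             (*-congˡ (*-congˡ (+-cong (M²-norm φ) (-‿cong (*-congˡ (+-congʳ (∥M∥ φ)))))))
             (*-congˡ (*-congˡ (+-congʳ (∥M∥ φ)))))
             (-‿cong (*-congˡ (*-congˡ (+-congʳ (∥M∥ x))))))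
             (-‿cong (*-congʳ (*-congˡ (∥M∥ φ)))))
             (-‿cong (*-congʳ (*-congˡ (M²-norm φ)))))
             (*-congʳ (*-congʳ (∥M∥ x))) ⟨
      ι 4 * (M^ 3 ∙ φ) t + ι 2 * p * (M^ 2 ∙ φ) t - ι 2 * ∥ φ ∥ * (M^ 2 ∙ x) t
      - ι 2 * ∥ M φ ∥ * M x t - ι 2 * ∥ M^ 2 ∙ φ ∥ * x t + ∥ M x ∥ * ∥ φ ∥ * x t ∎
      where
      m = p * s - q
      m₂ = p * m - (p₂ * s - r)
      n = p * p - p₂

  norm^-+ : ∀ h φ ψ → ∥ M^ h ∙ (λ i → φ i + ψ i) ∥ ≈ ∥ M^ h ∙ φ ∥ + ∥ M^ h ∙ ψ ∥
  norm^-+ h φ ψ = trans (∥∥-cong (M^-+ h φ ψ)) (∥∥-+ _ _)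

  norm^-*ˡ : ∀ h c φ → ∥ M^ h ∙ (λ i → c * φ i) ∥ ≈ c * ∥ M^ h ∙ φ ∥
  norm^-*ˡ h c φ = trans (∥∥-cong (M^-*ˡ h c φ)) (∥∥-*ˡ _ _)

  norm^-- : ∀ h φ ψ → ∥ M^ h ∙ (λ i → φ i - ψ i) ∥ ≈ ∥ M^ h ∙ φ ∥ - ∥ M^ h ∙ ψ ∥
  norm^-- h φ ψ = begin
    ∥ M^ h ∙ (λ i → φ i - ψ i) ∥
      ≈⟨ ∥∥-cong (M^-cong h λ i → solve 2 (λ a b → a :- b := a :+ (:- con (+ 1)) :* b) refl (φ i) (ψ i)) ⟩
    ∥ M^ h ∙ (λ i → φ i + (- ι 1) * ψ i) ∥
      ≈⟨ trans (norm^-+ h _ _) (+-congˡ (norm^-*ˡ h _ ψ)) ⟩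
    ∥ M^ h ∙ φ ∥ + (- ι 1) * ∥ M^ h ∙ ψ ∥
      ≈⟨ solve 2 (λ a b → a :+ (:- con (+ 1)) :* b := a :- b) refl _ _ ⟩
    ∥ M^ h ∙ φ ∥ - ∥ M^ h ∙ ψ ∥ ∎

  M^-∘ : ∀ i j φ → M^ i ∙ M^ j ∙ φ ≡ M^ (i ℕ.+ j) ∙ φ
  M^-∘ zero j φ = ≡.refl
  M^-∘ (suc i) j φ = ≡.cong M (M^-∘ i j φ)

  -- Here h counts the path vertices beyond the three neighbours of the twin, which is one less than
  -- the h of the theorem; i is the index of the first of the three.
  twin-expand : ∀ h i k → ∥ M^ h ∙ T (M^ i ∙ ε k) ∥ ≈
    ι 4 * L k (h ℕ.+ (3 ℕ.+ i)) + ι 2 * P 1 * L k (h ℕ.+ (2 ℕ.+ i))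
    - ι 2 * L k i * P (3 ℕ.+ h) - ι 2 * L k (1 ℕ.+ i) * P (2 ℕ.+ h) - ι 2 * L k (2 ℕ.+ i) * P (1 ℕ.+ h)
    + P 2 * L k i * P (1 ℕ.+ h)
  twin-expand h i k = begin
    ∥ M^ h ∙ T φ ∥
      ≈⟨ ∥∥-cong (M^-cong h (T-expand φ)) ⟩
    _ ≈⟨ norm^-+ h _ _ ⟩
    _ ≈⟨ +-cong (norm^-- h _ _) (norm^-*ˡ h _ _) ⟩
    _ ≈⟨ +-congʳ (+-cong (norm^-- h _ _) (-‿cong (norm^-*ˡ h _ _))) ⟩
    _ ≈⟨ +-congʳ (+-congʳ (+-cong (norm^-- h _ _) (-‿cong (norm^-*ˡ h _ _)))) ⟩
    _ ≈⟨ +-congʳ (+-congʳ (+-congʳ (+-cong (norm^-+ h _ _) (-‿cong (norm^-*ˡ h _ _))))) ⟩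
    _ ≈⟨ +-congʳ (+-congʳ (+-congʳ (+-congʳ (+-cong (norm^-*ˡ h _ _) (norm^-*ˡ h _ _))))) ⟩
    ι 4 * ∥ M^ h ∙ M^ 3 ∙ φ ∥ + ι 2 * ∥ x ∥ * ∥ M^ h ∙ M^ 2 ∙ φ ∥ - ι 2 * ∥ φ ∥ * ∥ M^ h ∙ M^ 2 ∙ x ∥
      - ι 2 * ∥ M φ ∥ * ∥ M^ h ∙ M x ∥ - ι 2 * ∥ M^ 2 ∙ φ ∥ * ∥ M^ h ∙ x ∥ + ∥ M x ∥ * ∥ φ ∥ * ∥ M^ h ∙ x ∥
      ≈⟨ +-congʳ (+-congʳ (+-cong (+-cong (+-cong
           (*-congˡ (reflexive (≡.cong ∥_∥ (M^-∘ h (3 ℕ.+ i) (ε k)))))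
           (*-congˡ (reflexive (≡.cong ∥_∥ (M^-∘ h (2 ℕ.+ i) (ε k))))))
           (-‿cong (*-congˡ (shift 2))))
           (-‿cong (*-congˡ (shift 1))))) ⟩
    ι 4 * L k (h ℕ.+ (3 ℕ.+ i)) + ι 2 * P 1 * L k (h ℕ.+ (2 ℕ.+ i))
      - ι 2 * L k i * P (3 ℕ.+ h) - ι 2 * L k (1 ℕ.+ i) * P (2 ℕ.+ h) - ι 2 * L k (2 ℕ.+ i) * P (1 ℕ.+ h)
      + P 2 * L k i * P (1 ℕ.+ h) ∎
    where
    φ = M^ i ∙ ε k
    shift : ∀ j → ∥ M^ h ∙ M^ j ∙ x ∥ ≈ P (suc j ℕ.+ h)
    shift j = reflexive (≡.trans (≡.cong ∥_∥ (M^-∘ h j x)) (≡.cong (λ m → ∥ M^ m ∙ x ∥) (ℕₚ.+-comm h j)))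

-- Expansions over compositions and the four sums of the theorem.

quotient : ℕ → ℕ → ℕ
quotient p zero = 0
quotient p (suc q) = p ℕ./ suc q

module ElementaryExpansions (R : CommutativeRing 0ℓ 0ℓ) {N : ℕ} (x : Fin N → CommutativeRing.Carrier R) where
  open RingTools R
  open CompositionSums R
  open ColourVectors R
  open Transfer R x

  eₚ : List ℕ → Carrier
  eₚ = foldr (λ k E → e k x * E) 1#

  eₚ-++ : ∀ I J → eₚ (I ++ J) ≈ eₚ I * eₚ J
  eₚ-++ [] J = sym (*-identityˡ _)
  eₚ-++ (i ∷ I) J = trans (*-congˡ (eₚ-++ I J)) (sym (*-assoc _ _ _))

  we ve : List ℕ → Carrier
  we K = ι (w K) * eₚ K
  ve K = ι (v K) * eₚ K

  we-++ : ∀ k I J → we ((k ∷ I) ++ J) ≈ we (k ∷ I) * ve J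
  we-++ k I J = trans (*-cong (trans (ι-cong (w-++ k I J)) (ι-* (w (k ∷ I)) (v J))) (eₚ-++ (k ∷ I) J))
    (solve 4 (λ a b c d → (a :* b) :* (c :* d) := (a :* c) :* (b :* d)) refl (ι (w (k ∷ I))) (ι (v J)) (eₚ (k ∷ I)) (eₚ J))

  W : ℕ → ℕ → Carrier
  W a m = 𝒮 m (λ K → ⟦ a ≤ᵇ lastPart K ⟧ * we K)

  private
    we-∷ʳ : ∀ r i K → IsComposition r K →
      we (K ∷ʳ suc i) ≈ (ι i * we K + ⟦ r ≡ᵇ 0 ⟧) * e (suc i) x
    we-∷ʳ .0 i [] (≡.refl , []) = begin
      ι (suc i ℕ.* 1) * (e (suc i) x * 1#)
        ≈⟨ *-cong (trans (ι-cong (ℕₚ.*-identityʳ (suc i))) (ι-+ 1 i)) (*-identityʳ _) ⟩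
      (ι 1 + ι i) * e (suc i) x
        ≈⟨ solve 2 (λ a b → (con (+ 1) :+ a) :* b := (a :* (con (+ 1) :* con (+ 1)) :+ con (+ 1)) :* b) refl (ι i) (e (suc i) x) ⟩
      (ι i * (ι 1 * ι 1) + ι 1) * e (suc i) x
        ≈⟨ *-congʳ (+-cong (*-congˡ (*-congˡ ι1)) ι1) ⟩
      (ι i * (ι 1 * 1#) + 1#) * e (suc i) x ∎
      where
      ι1 : ι 1 ≈ 1#
      ι1 = +-identityʳ 1#
    we-∷ʳ .(suc k ℕ.+ sum K) i (suc k ∷ K) (≡.refl , _) = begin
      we ((suc k ∷ K) ++ suc i ∷ [])
        ≈⟨ we-++ (suc k) K (suc i ∷ []) ⟩
      we (suc k ∷ K) * (ι (i ℕ.* 1) * (e (suc i) x * 1#))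
        ≈⟨ *-congˡ (*-cong (ι-cong (ℕₚ.*-identityʳ i)) (*-identityʳ _)) ⟩
      we (suc k ∷ K) * (ι i * e (suc i) x)
        ≈⟨ solve 3 (λ a b c → a :* (b :* c) := (b :* a :+ con (+ 0)) :* c) refl _ (ι i) (e (suc i) x) ⟩
      (ι i * we (suc k ∷ K) + 0#) * e (suc i) x ∎
    we-∷ʳ r i (zero ∷ K) (_ , () ∷ _)

    -- ⟦ r ≡ᵇ 0 ⟧ accounts for w (i ∷ []) being i rather than i - 1.
    term : (ℕ → Carrier) → ℕ → ℕ → Carrier
    term p i r = (ι (i ∸ 1) * p r + ⟦ r ≡ᵇ 0 ⟧) * e i x

    W-last : ∀ a n → W a (suc n) ≈ D (suc n) (λ i r → ⟦ a ≤ᵇ i ⟧ * term (λ r → 𝒮 r we) i r)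
    W-last a n = trans (𝒮-last n _) (D-cong (suc n) λ i r _ → begin
      𝒮 r (λ K → ⟦ a ≤ᵇ lastPart (K ∷ʳ suc i) ⟧ * we (K ∷ʳ suc i))
        ≈⟨ 𝒮-cong r (λ K c → *-cong (⟦⟧-cong (≡.cong (a ≤ᵇ_) (lastPart-∷ʳ K (suc i)))) (we-∷ʳ r i K c)) ⟩
      𝒮 r (λ K → ⟦ a ≤ᵇ suc i ⟧ * ((ι i * we K + ⟦ r ≡ᵇ 0 ⟧) * e (suc i) x))
        ≈⟨ trans (𝒮-*ˡ r _ _) (*-congˡ (𝒮-*ʳ r (e (suc i) x) _)) ⟩
      ⟦ a ≤ᵇ suc i ⟧ * (𝒮 r (λ K → ι i * we K + ⟦ r ≡ᵇ 0 ⟧) * e (suc i) x)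
        ≈⟨ *-congˡ (*-congʳ (trans (𝒮-+ r _ _) (+-cong (𝒮-*ˡ r _ _) (const r)))) ⟩
      ⟦ a ≤ᵇ suc i ⟧ * ((ι i * 𝒮 r we + ⟦ r ≡ᵇ 0 ⟧) * e (suc i) x) ∎)
      where
      const : ∀ r → 𝒮 r (λ _ → ⟦ r ≡ᵇ 0 ⟧) ≈ ⟦ r ≡ᵇ 0 ⟧
      const zero = 𝒮-0 _
      const (suc r) = trans (𝒮-cong (suc r) λ K _ → sym (zeroˡ 1#)) (trans (𝒮-*ˡ (suc r) 0# (λ _ → 1#)) (zeroˡ _))

    -- The recursion `L-suc`, unrolled down to `L-0`: each step splits off e_{k+1} as a last part,
    -- with a path on the remaining vertices in front of it.
    L-last : ∀ j k → D (suc j) (λ i → term P (k ℕ.+ i)) ≈ L k j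
    L-last zero k = begin
      D 1 (λ i → term P (k ℕ.+ i))
        ≈⟨ D-1 _ ⟩
      term P (k ℕ.+ 1) 0
        ≈⟨ reflexive (≡.cong (λ i → term P i 0) (ℕₚ.+-comm k 1)) ⟩
      (ι k * 1# + 1#) * e (suc k) x
        ≈⟨ *-congʳ (trans (+-congʳ (*-identityʳ _)) (+-comm _ _)) ⟩
      ι (suc k) * e (suc k) x
        ≈⟨ L-0 k ⟨
      L k 0 ∎
    L-last (suc j) k = begin
      D (suc (suc j)) (λ i → term P (k ℕ.+ i))
        ≈⟨ D-suc (suc j) _ ⟩
      term P (k ℕ.+ 1) (suc j) + D (suc j) (λ i → term P (k ℕ.+ suc i))
        ≈⟨ +-cong (reflexive (≡.cong (λ i → term P i (suc j)) (ℕₚ.+-comm k 1)))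
             (D-cong (suc j) λ i r _ → reflexive (≡.cong (λ i → term P i r) (ℕₚ.+-suc k (suc i)))) ⟩
      (ι k * P (suc j) + 0#) * e (suc k) x + D (suc j) (λ i → term P (suc k ℕ.+ i))
        ≈⟨ +-congˡ (L-last j (suc k)) ⟩
      (ι k * P (suc j) + 0#) * e (suc k) x + L (suc k) j
        ≈⟨ solve 4 (λ a p E l → (a :* p :+ con (+ 0)) :* E :+ l := l :+ a :* E :* p) refl (ι k) (P (suc j)) (e (suc k) x) (L (suc k) j) ⟩
      L (suc k) j + ι k * e (suc k) x * P (suc j)
        ≈⟨ L-suc k j ⟨
      L k (suc j) ∎

    D-drop : ∀ k m (F : ℕ → ℕ → Carrier) → D (k ℕ.+ m) (λ i r → ⟦ suc k ≤ᵇ i ⟧ * F i r) ≈ D m (λ i r → F (k ℕ.+ i) r)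
    D-drop zero m F = D-cong m λ i r _ → *-identityˡ _
    D-drop (suc k) m F = trans (D-suc (k ℕ.+ m) _)
      (trans (+-cong (zeroˡ _) (D-drop k m (F ∘ suc))) (+-identityˡ _))

    -- Strong induction on n, bounded by b: removing the last part leaves a shorter composition, and
    -- `L-last` with k = 0 reassembles the path.
    𝒮we≈P-below : ∀ b n → n < b → 𝒮 n we ≈ P n
    𝒮we≈P-below (suc b) zero p = trans (𝒮-0 we) (trans (*-identityʳ _) (+-identityʳ 1#))
    𝒮we≈P-below (suc b) (suc n) (s≤s p) = begin
      𝒮 (suc n) we
        ≈⟨ 𝒮-cong (suc n) (λ K _ → sym (*-identityˡ _)) ⟩
      W 0 (suc n)
        ≈⟨ W-last 0 n ⟩
      D (suc n) (λ i r → 1# * term (λ r → 𝒮 r we) i r)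
        ≈⟨ D-cong (suc n) (λ i r eq → trans (*-identityˡ _) (*-congʳ (+-congʳ (*-congˡ
             (𝒮we≈P-below b r (ℕₚ.≤-trans (≡.subst (suc r ≤_) eq (s≤s (ℕₚ.m≤n+m r i))) p)))))) ⟩
      D (suc n) (term P)
        ≈⟨ L-last n 0 ⟩
      L 0 n
        ≈⟨ P≈L n ⟨
      P (suc n) ∎

  𝒮we≈P : ∀ n → 𝒮 n we ≈ P n
  𝒮we≈P n = 𝒮we≈P-below (suc n) n ℕₚ.≤-refl

  -- Demanding a last part above k cuts the sum of `W-last` down to the tail that `L-last`
  -- evaluates.
  L≈W : ∀ k j → L k j ≈ W (suc k) (suc k ℕ.+ j)
  L≈W k j = sym (begin
    W (suc k) (suc (k ℕ.+ j))
      ≈⟨ W-last (suc k) (k ℕ.+ j) ⟩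
    D (suc (k ℕ.+ j)) (λ i r → ⟦ suc k ≤ᵇ i ⟧ * term (λ r → 𝒮 r we) i r)
      ≈⟨ D-cong (suc (k ℕ.+ j)) (λ i r _ → *-congˡ (*-congʳ (+-congʳ (*-congˡ (𝒮we≈P r))))) ⟩
    D (suc (k ℕ.+ j)) (λ i r → ⟦ suc k ≤ᵇ i ⟧ * term P i r)
      ≈⟨ reflexive (≡.cong (λ m → D m (λ i r → ⟦ suc k ≤ᵇ i ⟧ * term P i r)) (ℕₚ.+-suc k j)) ⟨
    D (k ℕ.+ suc j) (λ i r → ⟦ suc k ≤ᵇ i ⟧ * term P i r)
      ≈⟨ D-drop k (suc j) (term P) ⟩
    D (suc j) (λ i → term P (k ℕ.+ i))
      ≈⟨ L-last j k ⟩
    L k j ∎)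

  -- The 1 in front gives the empty J a last part. An empty J satisfies the condition only for a at
  -- most 1, and then every nonempty composition in front of it has an admissible last part. The
  -- same 1 makes `e 1 x * V a m` the contribution of a first part 1 in `U+W`.
  V : ℕ → ℕ → Carrier
  V a m = 𝒮 m (λ J → ⟦ a ≤ᵇ lastPart (1 ∷ J) ⟧ * ve J)

  -- The weight behind the cut in the third and fourth sums: j - 2 comes from the factor of the
  -- rotated part in the third, and from (Θ-1)/Θ acting on the factor j - 1 of w in the fourth.
  u : List ℕ → ℕ
  u [] = 0
  u (j ∷ J) = (j ∸ 2) ℕ.* v J

  U : ℕ → ℕ → Carrier
  U a m = 𝒮 m (λ J → ⟦ a ≤ᵇ lastPart J ⟧ * (ι (u J) * eₚ J))

  private
    -- What `U`, `V` and `W` have in common for a first part k: they differ only in the factor k -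
    -- 2, k - 1 or k put on it.
    X : ℕ → ℕ → ℕ → Carrier
    X a k r = 𝒮 r (λ J → ⟦ a ≤ᵇ lastPart (k ∷ J) ⟧ * (e k x * ve J))

    by-first : ∀ a m (c : ℕ → ℕ) {f : List ℕ → Carrier} →
      (∀ k J → f (suc k ∷ J) ≈ ⟦ a ≤ᵇ lastPart (suc k ∷ J) ⟧ * (ι (c (suc k) ℕ.* v J) * (e (suc k) x * eₚ J))) →
      𝒮 (suc m) f ≈ D (suc m) (λ k r → ι (c k) * X a k r)
    by-first a m c {f} eq = trans (𝒮-first m f) (D-cong (suc m) λ k r _ → trans
      (𝒮-cong r (λ J _ → trans (eq k J) (trans (*-congˡ (*-congʳ (ι-* (c (suc k)) (v J))))
        (solve 5 (λ b c v E F → b :* ((c :* v) :* (E :* F)) := c :* (b :* (E :* (v :* F)))) refl _ _ _ _ _))))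
      (𝒮-*ˡ r _ _))

    U-first : ∀ a m → U a (suc m) ≈ D (suc m) (λ k r → ι (k ∸ 2) * X a k r)
    U-first a m = by-first a m (_∸ 2) λ k J → refl

    W-first : ∀ a m → W a (suc m) ≈ D (suc m) (λ k r → ι k * X a k r)
    W-first a m = by-first a m (λ k → k) λ k J → refl

    V-first : ∀ a m → V a (suc m) ≈ D (suc m) (λ k r → ι (k ∸ 1) * X a k r)
    V-first a m = by-first a m (_∸ 1) λ k J →
      *-congʳ (⟦⟧-cong (≡.cong (a ≤ᵇ_) (lastPart-++ (1 ∷ []) (suc k) J)))

  -- For j ≥ 1, (j ∸ 2) + j = 2 (j - 1) + [j = 1].
  U+W : ∀ a m → U a (suc m) + W a (suc m) ≈ ι 2 * V a (suc m) + e 1 x * V a m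
  U+W a m = begin
    U a (suc m) + W a (suc m)
      ≈⟨ +-cong (U-first a m) (W-first a m) ⟩
    D (suc m) (λ k r → ι (k ∸ 2) * X a k r) + D (suc m) (λ k r → ι k * X a k r)
      ≈⟨ +-cong (D-suc m _) (D-suc m _) ⟩
    (0# * X a 1 m + D m (λ k r → ι (k ∸ 1) * X a (suc k) r)) + (ι 1 * X a 1 m + D m (λ k r → ι (suc k) * X a (suc k) r))
      ≈⟨ solve 3 (λ x d d′ → (con (+ 0) :* x :+ d) :+ (con (+ 1) :* x :+ d′) := (d :+ d′) :+ x) refl (X a 1 m) _ _ ⟩
    (D m (λ k r → ι (k ∸ 1) * X a (suc k) r) + D m (λ k r → ι (suc k) * X a (suc k) r)) + X a 1 m
      ≈⟨ +-cong (D-+ m _ _) X₁ ⟨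
    D m (λ k r → ι (k ∸ 1) * X a (suc k) r + ι (suc k) * X a (suc k) r) + e 1 x * V a m
      ≈⟨ +-congʳ (D-cong m λ k r _ → trans (+-cong (refl {ι k * X a (suc (suc k)) r}) (*-congʳ (ι-+ 2 k)))
           (trans (solve 2 (λ k x → k :* x :+ (con (+ 2) :+ k) :* x := (con (+ 1) :+ k) :* x :+ (con (+ 1) :+ k) :* x) refl (ι k) (X a (suc (suc k)) r))
             (sym (+-cong (*-congʳ (ι-+ 1 k)) (*-congʳ (ι-+ 1 k)))))) ⟩
    D m (λ k r → ι k * X a (suc k) r + ι k * X a (suc k) r) + e 1 x * V a m
      ≈⟨ +-congʳ (D-+ m _ _) ⟩
    (D m (λ k r → ι k * X a (suc k) r) + D m (λ k r → ι k * X a (suc k) r)) + e 1 x * V a m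
      ≈⟨ +-congʳ (solve 2 (λ x d → d :+ d := con (+ 2) :* (con (+ 0) :* x :+ d)) refl (X a 1 m) _) ⟩
    ι 2 * (0# * X a 1 m + D m (λ k r → ι k * X a (suc k) r)) + e 1 x * V a m
      ≈⟨ +-congʳ (*-congˡ (trans (V-first a m) (D-suc m _))) ⟨
    ι 2 * V a (suc m) + e 1 x * V a m ∎
    where
    X₁ : e 1 x * V a m ≈ X a 1 m
    X₁ = trans (sym (𝒮-*ˡ m (e 1 x) _)) (𝒮-cong m λ J _ →
      solve 3 (λ a b c → a :* (b :* c) := b :* (a :* c)) refl _ _ _)

  A : ℕ → ℕ → Carrier
  A h r = 𝒮 (h ℕ.+ r) (λ I → ⟦ θ I h ≡ᵇ r ⟧ * we I)

  θ-split-product : ∀ h r m {f g : List ℕ → Carrier} →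
    (∀ i I J → IsComposition (suc h ℕ.+ r) (i ∷ I) → θ (i ∷ I) (suc h) ≡ r → IsComposition m J →
      f ((i ∷ I) ++ J) ≈ we (i ∷ I) * g J) →
    𝒮 (suc h ℕ.+ r ℕ.+ m) (λ K → ⟦ θ K (suc h) ≡ᵇ r ⟧ * f K) ≈ A (suc h) r * 𝒮 m g
  θ-split-product h r m {f} {g} eq = begin
    𝒮 (suc h ℕ.+ r ℕ.+ m) (λ K → ⟦ θ K (suc h) ≡ᵇ r ⟧ * f K)
      ≈⟨ θ-split h r m f ⟩
    𝒮 (suc h ℕ.+ r) (λ I → ⟦ θ I (suc h) ≡ᵇ r ⟧ * 𝒮 m (λ J → f (I ++ J)))
      ≈⟨ 𝒮-cong (suc h ℕ.+ r) (λ { (i ∷ I) cI → trans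
           (*-congʳ-if _ λ p → trans (𝒮-cong m λ J cJ → eq i I J cI (≡ᵇ-≡ p) cJ) (𝒮-*ˡ m _ g))
           (sym (*-assoc _ _ _)) }) ⟩
    𝒮 (suc h ℕ.+ r) (λ I → ⟦ θ I (suc h) ≡ᵇ r ⟧ * we I * 𝒮 m g)
      ≈⟨ 𝒮-*ʳ (suc h ℕ.+ r) (𝒮 m g) _ ⟩
    A (suc h) r * 𝒮 m g ∎
    where
    ≡ᵇ-≡ : ∀ {m n} → (m ≡ᵇ n) ≡ true → m ≡ n
    ≡ᵇ-≡ {m} {n} p = ℕₚ.≡ᵇ⇒≡ m n (≡.subst Data.Bool.T (≡.sym p) _)

  private
    last-++ : ∀ a m i I J → All (1 ≤_) (i ∷ I) → sum J ≡ m → 1 ≤ m ⊎ a ≤ 1 →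
      (a ≤ᵇ lastPart ((i ∷ I) ++ J)) ≡ (a ≤ᵇ lastPart (1 ∷ J))
    last-++ a m i I (j ∷ J) ps s c = ≡.cong (a ≤ᵇ_)
      (≡.trans (lastPart-++ (i ∷ I) j J) (≡.sym (lastPart-++ (1 ∷ []) j J)))
    last-++ a .0 i I [] ps ≡.refl (inj₂ a≤1) = ≡.trans
      (≤ᵇ-true (≡.subst (λ L → a ≤ lastPart L) (≡.sym (Listₚ.++-identityʳ (i ∷ I))) (ℕₚ.≤-trans a≤1 (lastPart-pos ps))))
      (≡.sym (≤ᵇ-true a≤1))

  θ-split-W : ∀ a h r m → 1 ≤ m ⊎ a ≤ 1 →
    𝒮 (suc h ℕ.+ r ℕ.+ m) (λ K → ⟦ θ K (suc h) ≡ᵇ r ⟧ * (⟦ a ≤ᵇ lastPart K ⟧ * we K)) ≈ A (suc h) r * V a m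
  θ-split-W a h r m c = θ-split-product h r m λ i I J (_ , ps) _ (s , _) → trans
    (*-cong (⟦⟧-cong (last-++ a m i I J ps s c)) (we-++ i I J))
    (solve 3 (λ a b c → a :* (b :* c) := b :* (a :* c)) refl _ _ _)

  private
    ≡ᵇ-sum₁ : ∀ t → t ≤ 1 → ⟦ t ≡ᵇ 0 ⟧ + ⟦ t ≡ᵇ 1 ⟧ ≈ 1#
    ≡ᵇ-sum₁ 0 _ = +-identityʳ 1#
    ≡ᵇ-sum₁ 1 _ = +-identityˡ 1#
    ≡ᵇ-sum₁ (suc (suc t)) (s≤s ())

    ≡ᵇ-sum₂ : ∀ t → t ≤ 2 → ⟦ t ≡ᵇ 0 ⟧ + ⟦ t ≡ᵇ 1 ⟧ + ⟦ t ≡ᵇ 2 ⟧ ≈ 1#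
    ≡ᵇ-sum₂ 0 _ = trans (+-identityʳ _) (+-identityʳ 1#)
    ≡ᵇ-sum₂ 1 _ = trans (+-identityʳ _) (+-identityˡ 1#)
    ≡ᵇ-sum₂ 2 _ = trans (+-congʳ (+-identityʳ 0#)) (+-identityˡ 1#)
    ≡ᵇ-sum₂ (suc (suc (suc t))) (s≤s (s≤s ()))

    ≡ᵇ-sum₃ : ∀ t → ⟦ t ≡ᵇ 0 ⟧ + ⟦ t ≡ᵇ 1 ⟧ + ⟦ t ≡ᵇ 2 ⟧ + ⟦ 3 ≤ᵇ t ⟧ ≈ 1#
    ≡ᵇ-sum₃ 0 = trans (+-identityʳ _) (≡ᵇ-sum₂ 0 z≤n)
    ≡ᵇ-sum₃ 1 = trans (+-identityʳ _) (≡ᵇ-sum₂ 1 (s≤s z≤n))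
    ≡ᵇ-sum₃ 2 = trans (+-identityʳ _) (≡ᵇ-sum₂ 2 (s≤s (s≤s z≤n)))
    ≡ᵇ-sum₃ (suc (suc (suc t))) = trans (+-congʳ (trans (+-identityʳ _) (+-identityʳ _))) (+-identityˡ 1#)

  θ-split-we : ∀ h r m →
    𝒮 (suc h ℕ.+ r ℕ.+ m) (λ K → ⟦ θ K (suc h) ≡ᵇ r ⟧ * we K) ≈ A (suc h) r * V 0 m
  θ-split-we h r m = trans
    (𝒮-cong (suc h ℕ.+ r ℕ.+ m) λ K _ → *-congˡ (sym (*-identityˡ _)))
    (θ-split-W 0 h r m (inj₂ z≤n))

  V-0-1 : V 0 1 ≈ 0#
  V-0-1 = trans (𝒮-1 _) (trans (*-congˡ (zeroˡ _)) (zeroʳ _))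

  V-0-2 : V 0 2 ≈ e 2 x
  V-0-2 = begin
    V 0 2
      ≈⟨ trans (𝒮-suc 1 _) (𝒮-1 _) ⟩
    1# * (0# * eₚ (1 ∷ 1 ∷ [])) + 1# * (ι 1 * (e 2 x * 1#))
      ≈⟨ +-cong (trans (*-congˡ (zeroˡ _)) (zeroʳ _))
           (trans (*-identityˡ _) (trans (*-congʳ (+-identityʳ 1#)) (trans (*-identityˡ _) (*-identityʳ _)))) ⟩
    0# + e 2 x
      ≈⟨ +-identityˡ _ ⟩
    e 2 x ∎

  A-0 : ∀ h → A (suc h) 0 ≈ P (suc h)
  A-0 h = begin
    A (suc h) 0
      ≈⟨ 𝒮-cong (suc h ℕ.+ 0) (λ K (s , _) → trans
           (*-congʳ (⟦⟧-cong (≡.cong (_≡ᵇ 0) (ℕₚ.n≤0⇒n≡0 (θ-≤ K (suc h) 0 s))))) (*-identityˡ _)) ⟩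
    𝒮 (suc h ℕ.+ 0) we
      ≈⟨ 𝒮we≈P (suc h ℕ.+ 0) ⟩
    P (suc h ℕ.+ 0)
      ≡⟨ ≡.cong P (ℕₚ.+-identityʳ (suc h)) ⟩
    P (suc h) ∎

  -- A composition of suc h + 1 that also stops at suc h ends in a part 1, which is not its first
  -- part and so contributes the factor 0.
  A-1 : ∀ h → A (suc h) 1 ≈ P (suc h ℕ.+ 1)
  A-1 h = sym (begin
    P (suc h ℕ.+ 1)
      ≈⟨ 𝒮we≈P (suc h ℕ.+ 1) ⟨
    𝒮 (suc h ℕ.+ 1) we
      ≈⟨ 𝒮-cong (suc h ℕ.+ 1) (λ K (s , _) → sym (trans (sym (distribʳ _ _ _))
           (trans (*-congʳ (≡ᵇ-sum₁ (θ K (suc h)) (θ-≤ K (suc h) 1 s))) (*-identityˡ _)))) ⟩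
    𝒮 (suc h ℕ.+ 1) (λ K → ⟦ θ K (suc h) ≡ᵇ 0 ⟧ * we K + ⟦ θ K (suc h) ≡ᵇ 1 ⟧ * we K)
      ≈⟨ 𝒮-+ (suc h ℕ.+ 1) _ _ ⟩
    𝒮 (suc h ℕ.+ 1) (λ K → ⟦ θ K (suc h) ≡ᵇ 0 ⟧ * we K) + A (suc h) 1
      ≈⟨ +-congʳ (reflexive (≡.cong (λ n → 𝒮 (n ℕ.+ 1) (λ K → ⟦ θ K (suc h) ≡ᵇ 0 ⟧ * we K)) (ℕₚ.+-identityʳ (suc h)))) ⟨
    𝒮 (suc h ℕ.+ 0 ℕ.+ 1) (λ K → ⟦ θ K (suc h) ≡ᵇ 0 ⟧ * we K) + A (suc h) 1
      ≈⟨ +-congʳ (trans (θ-split-we h 0 1) (trans (*-congˡ V-0-1) (zeroʳ _))) ⟩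
    0# + A (suc h) 1
      ≈⟨ +-identityˡ _ ⟩
    A (suc h) 1 ∎)

  -- Compositions of suc h + 2 that stop at suc h go on with 2 or with 1, 1, of weights 1 and 0;
  -- those whose cut is suc h + 1 end in a 1, of weight 0. Only the continuation by 2 has to be
  -- subtracted.
  A-2 : ∀ h → A (suc h) 2 ≈ P (suc h ℕ.+ 2) - P (suc h) * e 2 x
  A-2 h = begin
    A (suc h) 2
      ≈⟨ solve 2 (λ a b → b := (a :+ b) :- a) refl (P (suc h) * e 2 x) (A (suc h) 2) ⟩
    P (suc h) * e 2 x + A (suc h) 2 - P (suc h) * e 2 x
      ≈⟨ +-congʳ (sym (begin
          P (suc h ℕ.+ 2)
            ≈⟨ 𝒮we≈P (suc h ℕ.+ 2) ⟨
          𝒮 (suc h ℕ.+ 2) we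
            ≈⟨ 𝒮-cong (suc h ℕ.+ 2) (λ K (s , _) → sym (trans
                 (trans (+-congʳ (sym (distribʳ _ _ _))) (sym (distribʳ _ _ _)))
                 (trans (*-congʳ (≡ᵇ-sum₂ (θ K (suc h)) (θ-≤ K (suc h) 2 s))) (*-identityˡ _)))) ⟩
          𝒮 (suc h ℕ.+ 2) (λ K → ⟦ θ K (suc h) ≡ᵇ 0 ⟧ * we K + ⟦ θ K (suc h) ≡ᵇ 1 ⟧ * we K + ⟦ θ K (suc h) ≡ᵇ 2 ⟧ * we K)
            ≈⟨ trans (𝒮-+ (suc h ℕ.+ 2) _ _) (+-congʳ (𝒮-+ (suc h ℕ.+ 2) _ _)) ⟩
          𝒮 (suc h ℕ.+ 2) (λ K → ⟦ θ K (suc h) ≡ᵇ 0 ⟧ * we K) + 𝒮 (suc h ℕ.+ 2) (λ K → ⟦ θ K (suc h) ≡ᵇ 1 ⟧ * we K) + A (suc h) 2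
            ≈⟨ +-congʳ (+-cong
                 (reflexive (≡.cong (λ n → 𝒮 (n ℕ.+ 2) (λ K → ⟦ θ K (suc h) ≡ᵇ 0 ⟧ * we K)) (ℕₚ.+-identityʳ (suc h))))
                 (reflexive (≡.cong (λ n → 𝒮 n (λ K → ⟦ θ K (suc h) ≡ᵇ 1 ⟧ * we K)) (ℕₚ.+-assoc (suc h) 1 1)))) ⟨
          𝒮 (suc h ℕ.+ 0 ℕ.+ 2) (λ K → ⟦ θ K (suc h) ≡ᵇ 0 ⟧ * we K) + 𝒮 (suc h ℕ.+ 1 ℕ.+ 1) (λ K → ⟦ θ K (suc h) ≡ᵇ 1 ⟧ * we K) + A (suc h) 2
            ≈⟨ +-congʳ (+-cong (θ-split-we h 0 2) (θ-split-we h 1 1)) ⟩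
          A (suc h) 0 * V 0 2 + A (suc h) 1 * V 0 1 + A (suc h) 2
            ≈⟨ +-congʳ (trans (+-cong (*-cong (A-0 h) V-0-2) (trans (*-congˡ V-0-1) (zeroʳ _))) (+-identityʳ _)) ⟩
          P (suc h) * e 2 x + A (suc h) 2 ∎)) ⟩
    P (suc h ℕ.+ 2) - P (suc h) * e 2 x ∎

  -- Taken as a complement: removing the values 0, 1, 2 of `θ` costs three products, however many
  -- larger values there are.
  Θ≥3-sum : ∀ a h m → 1 ≤ m ⊎ a ≤ 1 →
    𝒮 (suc h ℕ.+ 2 ℕ.+ m) (λ K → ⟦ 3 ≤ᵇ θ K (suc h) ⟧ * (⟦ a ≤ᵇ lastPart K ⟧ * we K)) ≈
    W a (suc h ℕ.+ 2 ℕ.+ m) - (A (suc h) 0 * V a (2 ℕ.+ m) + A (suc h) 1 * V a (1 ℕ.+ m) + A (suc h) 2 * V a m)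
  Θ≥3-sum a h m c = begin
    Y₃
      ≈⟨ solve 2 (λ s t → t := (s :+ t) :- s) refl (Y 0 + Y 1 + Y 2) Y₃ ⟩
    (Y 0 + Y 1 + Y 2 + Y₃) - (Y 0 + Y 1 + Y 2)
      ≈⟨ +-cong (sym (trans
           (𝒮-cong n λ K _ → sym (trans
             (trans (+-congʳ (trans (+-congʳ (sym (distribʳ _ _ _))) (sym (distribʳ _ _ _)))) (sym (distribʳ _ _ _)))
             (trans (*-congʳ (≡ᵇ-sum₃ (θ K (suc h)))) (*-identityˡ _))))
           (trans (𝒮-+ n _ _) (+-congʳ (trans (𝒮-+ n _ _) (+-congʳ (𝒮-+ n _ _)))))))
         (-‿cong (+-cong (+-cong (part 0 (2 ℕ.+ m) (inj₁ (s≤s z≤n)) eq₀) (part 1 (1 ℕ.+ m) (inj₁ (s≤s z≤n)) eq₁)) (part 2 m c ≡.refl))) ⟩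
    W a n - (A (suc h) 0 * V a (2 ℕ.+ m) + A (suc h) 1 * V a (1 ℕ.+ m) + A (suc h) 2 * V a m) ∎
    where
    n = suc h ℕ.+ 2 ℕ.+ m
    Y : ℕ → Carrier
    Y r = 𝒮 n (λ K → ⟦ θ K (suc h) ≡ᵇ r ⟧ * (⟦ a ≤ᵇ lastPart K ⟧ * we K))
    Y₃ = 𝒮 n (λ K → ⟦ 3 ≤ᵇ θ K (suc h) ⟧ * (⟦ a ≤ᵇ lastPart K ⟧ * we K))
    eq₀ : suc h ℕ.+ 0 ℕ.+ (2 ℕ.+ m) ≡ n
    eq₀ = ≡.trans (≡.cong (ℕ._+ (2 ℕ.+ m)) (ℕₚ.+-identityʳ (suc h))) (≡.sym (ℕₚ.+-assoc (suc h) 2 m))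
    eq₁ : suc h ℕ.+ 1 ℕ.+ (1 ℕ.+ m) ≡ n
    eq₁ = ≡.trans (ℕₚ.+-assoc (suc h) 1 (1 ℕ.+ m)) (≡.sym (ℕₚ.+-assoc (suc h) 2 m))
    part : ∀ r m′ → 1 ≤ m′ ⊎ a ≤ 1 → suc h ℕ.+ r ℕ.+ m′ ≡ n → Y r ≈ A (suc h) r * V a m′
    part r m′ c eq = trans (reflexive (≡.cong (λ n → 𝒮 n (λ K → ⟦ θ K (suc h) ≡ᵇ r ⟧ * (⟦ a ≤ᵇ lastPart K ⟧ * we K))) (≡.sym eq)))
      (θ-split-W a h r m′ c)

  module ThirdSum (a h r m nh : ℕ) (nh≡ : nh ≡ r ℕ.+ suc m) (a≤ : a ≤ suc m) where
    third : List ℕ → Bool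
    third K = (3 ≤ᵇ lastPart K) ∧ ((2 ≤ᵇ length K) ∧ ((nh ℕ.+ 1 ≤ᵇ lastPart K ℕ.+ secondLast K) ∨ (a ≤ᵇ secondLast K)))

    summand : List ℕ → Carrier
    summand K = ⟦ third K ⟧ * (ι ((lastPart K ∸ 2) ℕ.* w (dropLast K)) * eₚ K)

    private
      -- Moving the first part of J to the end turns the summand of U into this.
      rotated : List ℕ → Carrier
      rotated J = ⟦ a ≤ᵇ lastPart (lastPart J ∷ dropLast J) ⟧ * (ι ((lastPart J ∸ 2) ℕ.* v (dropLast J)) * eₚ J)

      rotated-∷ʳ : ∀ J k → rotated (J ∷ʳ k) ≈ ι (k ∸ 2) * (⟦ a ≤ᵇ lastPart (k ∷ J) ⟧ * (e k x * ve J))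
      rotated-∷ʳ J k = begin
        rotated (J ∷ʳ k)
          ≈⟨ *-cong (⟦⟧-cong (≡.cong₂ (λ j L → a ≤ᵇ lastPart (j ∷ L)) (lastPart-∷ʳ J k) (dropLast-∷ʳ J k)))
               (*-cong (trans (ι-cong (≡.cong₂ (λ j L → (j ∸ 2) ℕ.* v L) (lastPart-∷ʳ J k) (dropLast-∷ʳ J k))) (ι-* (k ∸ 2) (v J)))
                 (trans (eₚ-++ J (k ∷ [])) (*-congˡ (*-identityʳ _)))) ⟩
        ⟦ a ≤ᵇ lastPart (k ∷ J) ⟧ * (ι (k ∸ 2) * ι (v J) * (eₚ J * e k x))
          ≈⟨ solve 5 (λ b c v E F → b :* (c :* v :* (F :* E)) := c :* (b :* (E :* (v :* F)))) refl
               ⟦ a ≤ᵇ lastPart (k ∷ J) ⟧ (ι (k ∸ 2)) (ι (v J)) (e k x) (eₚ J) ⟩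
        ι (k ∸ 2) * (⟦ a ≤ᵇ lastPart (k ∷ J) ⟧ * (e k x * ve J)) ∎

      -- Expanding one side by its last part and the other by its first gives the same sum, so no
      -- bijection between lists is needed.
      rotated-sum : 𝒮 (suc m) rotated ≈ U a (suc m)
      rotated-sum = begin
        𝒮 (suc m) rotated
          ≈⟨ 𝒮-last m rotated ⟩
        D (suc m) (λ k r → 𝒮 r (λ J → rotated (J ∷ʳ k)))
          ≈⟨ D-cong (suc m) (λ k r _ → trans (𝒮-cong r λ J _ → rotated-∷ʳ J (suc k)) (𝒮-*ˡ r _ _)) ⟩
        D (suc m) (λ k r → ι (k ∸ 2) * X a k r)
          ≈⟨ U-first a m ⟨
        U a (suc m) ∎

      -- Behind the cut stand J and k, of total suc m. If J is empty, k is suc m and the part before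
      -- it is at least r + 1 by `last-after-θ`, so the first alternative holds, as does a ≤ k.
      -- Otherwise the last two parts lie behind the cut, their sum is at most suc m, the first
      -- alternative fails and the second is the condition on J.
      condition : ∀ i I J k → IsComposition (suc h ℕ.+ r) (i ∷ I) → θ (i ∷ I) (suc h) ≡ r → sum J ℕ.+ k ≡ suc m →
        ((nh ℕ.+ 1 ≤ᵇ k ℕ.+ lastPart ((i ∷ I) ++ J)) ∨ (a ≤ᵇ lastPart ((i ∷ I) ++ J))) ≡ (a ≤ᵇ lastPart (k ∷ J))
      condition i I [] k (s , ps) θ≡ ≡.refl rewrite nh≡ | Listₚ.++-identityʳ I
        | ≤ᵇ-true {r ℕ.+ suc m ℕ.+ 1} {suc m ℕ.+ lastPart (i ∷ I)}
            (≡.subst (_≤ suc m ℕ.+ lastPart (i ∷ I))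
              (≡.trans (ℕₚ.+-comm (suc m) (suc r)) (≡.sym (ℕₚ.+-comm (r ℕ.+ suc m) 1)))
              (ℕₚ.+-monoʳ-≤ (suc m) (last-after-θ (i ∷ I) h r ps θ≡ s))) = ≡.sym (≤ᵇ-true a≤)
      condition i I (j ∷ J) k (s , ps) θ≡ J+k rewrite nh≡ | lastPart-++ (i ∷ I) j J | lastPart-++ (k ∷ []) j J
        | ≤ᵇ-false {r ℕ.+ suc m ℕ.+ 1} {k ℕ.+ lastPart (j ∷ J)}
            (≡.subst (k ℕ.+ lastPart (j ∷ J) <_) (ℕₚ.+-comm 1 (r ℕ.+ suc m))
              (s≤s (ℕₚ.≤-trans (ℕₚ.+-monoʳ-≤ k (lastPart≤sum (j ∷ J)))
                (ℕₚ.≤-trans (ℕₚ.≤-reflexive (≡.trans (ℕₚ.+-comm k _) J+k)) (ℕₚ.m≤n+m (suc m) r))))) = ≡.refl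

      3≤ᵇ-absorb : ∀ k → ⟦ 3 ≤ᵇ k ⟧ * ι (k ∸ 2) ≈ ι (k ∸ 2)
      3≤ᵇ-absorb 0 = zeroˡ _
      3≤ᵇ-absorb 1 = zeroˡ _
      3≤ᵇ-absorb 2 = zeroˡ _
      3≤ᵇ-absorb (suc (suc (suc k))) = *-identityˡ _

      summand-++ : ∀ i I J → IsComposition (suc h ℕ.+ r) (i ∷ I) → θ (i ∷ I) (suc h) ≡ r → IsComposition (suc m) J →
        summand ((i ∷ I) ++ J) ≈ we (i ∷ I) * rotated J
      summand-++ i I J cI θ≡ (s , _) with initLast J
      summand-++ i I .[] cI θ≡ (() , _) | []
      summand-++ i I .(J ∷ʳ k) cI θ≡ (s , _) | J ∷ʳ′ k = begin
        summand ((i ∷ I) ++ (J ∷ʳ k))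
          ≡⟨ ≡.cong summand (Listₚ.++-assoc (i ∷ I) J (k ∷ [])) ⟨
        summand (K ∷ʳ k)
          ≈⟨ *-cong (trans (⟦⟧-cong third≡) (⟦⟧-∧ (3 ≤ᵇ k) _))
               (*-cong (trans (ι-cong (≡.trans
                   (≡.cong₂ (λ j L → (j ∸ 2) ℕ.* w L) (lastPart-∷ʳ K k) (dropLast-∷ʳ K k)) (≡.cong ((k ∸ 2) ℕ.*_) (w-++ i I J))))
                   (trans (ι-* (k ∸ 2) _) (*-congˡ (ι-* (w (i ∷ I)) (v J)))))
                 (trans (eₚ-++ K (k ∷ [])) (*-cong (eₚ-++ (i ∷ I) J) (*-identityʳ _)))) ⟩
        ⟦ 3 ≤ᵇ k ⟧ * ⟦ a ≤ᵇ lastPart (k ∷ J) ⟧ * (ι (k ∸ 2) * (ι (w (i ∷ I)) * ι (v J)) * (eₚ (i ∷ I) * eₚ J * e k x))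
          ≈⟨ solve 8 (λ t b c w v E F G → t :* b :* (c :* (w :* v) :* (E :* F :* G))
               := (t :* c) :* (w :* E :* (b :* (G :* (v :* F))))) refl
               ⟦ 3 ≤ᵇ k ⟧ ⟦ a ≤ᵇ lastPart (k ∷ J) ⟧ (ι (k ∸ 2)) (ι (w (i ∷ I))) (ι (v J)) (eₚ (i ∷ I)) (eₚ J) (e k x) ⟩
        ⟦ 3 ≤ᵇ k ⟧ * ι (k ∸ 2) * (we (i ∷ I) * (⟦ a ≤ᵇ lastPart (k ∷ J) ⟧ * (e k x * ve J)))
          ≈⟨ *-congʳ (3≤ᵇ-absorb k) ⟩
        ι (k ∸ 2) * (we (i ∷ I) * (⟦ a ≤ᵇ lastPart (k ∷ J) ⟧ * (e k x * ve J)))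
          ≈⟨ solve 3 (λ a b c → a :* (b :* c) := b :* (a :* c)) refl _ _ _ ⟩
        we (i ∷ I) * (ι (k ∸ 2) * (⟦ a ≤ᵇ lastPart (k ∷ J) ⟧ * (e k x * ve J)))
          ≈⟨ *-congˡ (rotated-∷ʳ J k) ⟨
        we (i ∷ I) * rotated (J ∷ʳ k) ∎
        where
        K = (i ∷ I) ++ J
        J+k : sum J ℕ.+ k ≡ suc m
        J+k = ≡.trans (≡.cong (sum J ℕ.+_) (≡.sym (ℕₚ.+-identityʳ k))) (≡.trans (≡.sym (sum-++ J (k ∷ []))) s)
        third≡ : third (K ∷ʳ k) ≡ (3 ≤ᵇ k) ∧ (a ≤ᵇ lastPart (k ∷ J))
        third≡ rewrite lastPart-∷ʳ K k | secondLast-∷ʳ K k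
          | ≤ᵇ-true {2} {length (K ∷ʳ k)} (≡.subst (2 ≤_) (≡.sym (Listₚ.length-++-sucʳ K k [])) (s≤s (s≤s z≤n)))
          | condition i I J k cI θ≡ J+k = ≡.refl

    third-sum : 𝒮 (suc h ℕ.+ r ℕ.+ suc m) (λ K → ⟦ θ K (suc h) ≡ᵇ r ⟧ * summand K) ≈ A (suc h) r * U a (suc m)
    third-sum = trans (θ-split-product h r (suc m) summand-++) (*-congˡ rotated-sum)

  module FourthSum (a h m : ℕ) where
    -- `ι` accepts natural numbers only, so the rational coefficient is given as a quotient, whose
    -- exactness is shown by `θ∣w`.
    coefficient : List ℕ → ℕ
    coefficient K = quotient ((θ K (suc h ℕ.+ 3) ∸ 1) ℕ.* w K) (θ K (suc h ℕ.+ 3))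

    summand : List ℕ → Carrier
    summand K = ⟦ a ≤ᵇ lastPart K ⟧ * (⟦ 2 ≤ᵇ θ K (suc h ℕ.+ 3) ⟧ * (ι (coefficient K) * eₚ K))

    private
      -- For a part j after the cut, θ is j - 1, which cancels against the factor j - 1 of the
      -- weight and leaves j - 2. For j at most 2 both sides are 0.
      quotient-part : ∀ j p q → ⟦ 2 ≤ᵇ j ∸ 1 ⟧ * ι (quotient ((j ∸ 1 ∸ 1) ℕ.* (p ℕ.* ((j ∸ 1) ℕ.* q))) (j ∸ 1))
        ≈ ι p * ι ((j ∸ 2) ℕ.* q)
      quotient-part 0 p q = trans (zeroˡ _) (sym (zeroʳ _))
      quotient-part 1 p q = trans (zeroˡ _) (sym (zeroʳ _))
      quotient-part 2 p q = trans (zeroˡ _) (sym (zeroʳ _))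
      quotient-part (suc (suc (suc j))) p q = trans (*-identityˡ _) (trans
        (ι-cong (≡.trans
          (≡.cong (ℕ._/ suc (suc j)) (ℕ-solve 4 (λ a p b q → a ℕ:* (p ℕ:* (b ℕ:* q)) ℕ:= (p ℕ:* (a ℕ:* q)) ℕ:* b) ≡.refl (suc j) p (suc (suc j)) q))
          (m*n/n≡m (p ℕ.* (suc j ℕ.* q)) (suc (suc j)))))
        (ι-* p (suc j ℕ.* q)))

      summand-++ : ∀ i I J → IsComposition (suc h ℕ.+ 2) (i ∷ I) → IsComposition (suc m) J →
        summand ((i ∷ I) ++ J) ≈ we (i ∷ I) * (⟦ a ≤ᵇ lastPart J ⟧ * (ι (u J) * eₚ J))
      summand-++ i I [] (s , _) (() , _)
      summand-++ i I (zero ∷ J) (s , _) (_ , () ∷ _)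
      summand-++ i I (suc j ∷ J) (s , _) _ = begin
        ⟦ a ≤ᵇ lastPart K ⟧ * (⟦ 2 ≤ᵇ θ K (suc h ℕ.+ 3) ⟧ * (ι (quotient ((θ K (suc h ℕ.+ 3) ∸ 1) ℕ.* w K) (θ K (suc h ℕ.+ 3))) * eₚ K))
          ≡⟨ ≡.cong₂ (λ l t → ⟦ a ≤ᵇ l ⟧ * (⟦ 2 ≤ᵇ t ⟧ * (ι (quotient ((t ∸ 1) ℕ.* w K) t) * eₚ K)))
               (lastPart-++ (i ∷ I) (suc j) J) θ≡ ⟩
        ⟦ a ≤ᵇ lastPart (suc j ∷ J) ⟧ * (⟦ 2 ≤ᵇ j ⟧ * (ι (quotient ((j ∸ 1) ℕ.* w K) j) * eₚ K))
          ≈⟨ *-congˡ (*-congˡ (*-cong (ι-cong (≡.cong (λ W → quotient ((j ∸ 1) ℕ.* W) j) (w-++ i I (suc j ∷ J)))) (eₚ-++ (i ∷ I) (suc j ∷ J)))) ⟩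
        ⟦ a ≤ᵇ lastPart (suc j ∷ J) ⟧ * (⟦ 2 ≤ᵇ j ⟧ * (ι (quotient ((j ∸ 1) ℕ.* (w (i ∷ I) ℕ.* (j ℕ.* v J))) j) * (eₚ (i ∷ I) * eₚ (suc j ∷ J))))
          ≈⟨ *-congˡ (trans (sym (*-assoc _ _ _)) (*-congʳ (quotient-part (suc j) (w (i ∷ I)) (v J)))) ⟩
        ⟦ a ≤ᵇ lastPart (suc j ∷ J) ⟧ * (ι (w (i ∷ I)) * ι (u (suc j ∷ J)) * (eₚ (i ∷ I) * eₚ (suc j ∷ J)))
          ≈⟨ solve 5 (λ b w u E F → b :* (w :* u :* (E :* F)) := w :* E :* (b :* (u :* F))) refl
               ⟦ a ≤ᵇ lastPart (suc j ∷ J) ⟧ (ι (w (i ∷ I))) (ι (u (suc j ∷ J))) (eₚ (i ∷ I)) (eₚ (suc j ∷ J)) ⟩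
        we (i ∷ I) * (⟦ a ≤ᵇ lastPart (suc j ∷ J) ⟧ * (ι (u (suc j ∷ J)) * eₚ (suc j ∷ J))) ∎
        where
        K = (i ∷ I) ++ suc j ∷ J
        θ≡ : θ K (suc h ℕ.+ 3) ≡ j
        θ≡ = ≡.trans (≡.cong (θ K) (≡.trans (≡.sym (ℕₚ.+-assoc (suc h) 2 1)) (≡.cong (ℕ._+ 1) (≡.sym s)))) (θ-++ (i ∷ I) (suc j ∷ J) 0)

    fourth-sum : 𝒮 (suc h ℕ.+ 2 ℕ.+ suc m) (λ K → ⟦ θ K (suc h) ≡ᵇ 2 ⟧ * summand K) ≈ A (suc h) 2 * U a (suc m)
    fourth-sum = θ-split-product h 2 (suc m) λ i I J cI _ cJ → summand-++ i I J cI cJ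

-- Comparison of the two sides.

module TwinExpansion (R : CommutativeRing 0ℓ 0ℓ) {N : ℕ} (x : Fin N → CommutativeRing.Carrier R) where
  open RingTools R
  open CompositionSums R
  open ColourVectors R
  open Transfer R x
  open ElementaryExpansions R x

  private
    -- Settles the boundary case of `Θ≥3-sum` for the second sum, where only k + i is left behind
    -- the partial sum h + 2.
    1≤k+i : ∀ k i → 1 ≤ k ℕ.+ i ⊎ suc k ≤ 1
    1≤k+i zero i = inj₂ (s≤s z≤n)
    1≤k+i (suc k) i = inj₁ (s≤s z≤n)

  module _ (h i k : ℕ) where
    private
      a = suc k
      m = suc k ℕ.+ i
      n = suc h ℕ.+ 2 ℕ.+ m
      n-1 = suc h ℕ.+ 2 ℕ.+ (k ℕ.+ i)

      AU : ∀ r j → A (suc h) r * U a (suc j) ≈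
        ι 2 * (A (suc h) r * V a (suc j)) + e 1 x * (A (suc h) r * V a j) - A (suc h) r * W a (suc j)
      AU r j = begin
        A (suc h) r * U a (suc j)
          ≈⟨ solve 3 (λ A u w → A :* u := A :* ((u :+ w) :- w)) refl _ _ (W a (suc j)) ⟩
        A (suc h) r * (U a (suc j) + W a (suc j) - W a (suc j))
          ≈⟨ *-congˡ (+-congʳ (U+W a j)) ⟩
        A (suc h) r * (ι 2 * V a (suc j) + e 1 x * V a j - W a (suc j))
          ≈⟨ solve 5 (λ A v e v′ w → A :* (con (+ 2) :* v :+ e :* v′ :- w) := con (+ 2) :* (A :* v) :+ e :* (A :* v′) :- A :* w) refl _ _ _ _ _ ⟩
        ι 2 * (A (suc h) r * V a (suc j)) + e 1 x * (A (suc h) r * V a j) - A (suc h) r * W a (suc j) ∎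

      T₁ = 𝒮 n (λ K → ⟦ 3 ≤ᵇ θ K (suc h) ⟧ * (⟦ a ≤ᵇ lastPart K ⟧ * we K))
      T₂ = 𝒮 n-1 (λ K → ⟦ 3 ≤ᵇ θ K (suc h) ⟧ * (⟦ a ≤ᵇ lastPart K ⟧ * we K))
      T₃ = A (suc h) 0 * U a (2 ℕ.+ m) + A (suc h) 1 * U a (1 ℕ.+ m)
      T₄ = A (suc h) 2 * U a m

    -- All products of `A` with `V` cancel: `AU` adds them with the very coefficients, 2 and e_1,
    -- with which `Θ≥3-sum` subtracts them in the first two sums. This explains the factor 2 of the
    -- first sum and the extra part 1 of the second.
    W-sum : ι 2 * T₁ + e 1 x * T₂ + T₃ + T₄ ≈
      ι 2 * W a n + e 1 x * W a n-1
        - A (suc h) 0 * W a (2 ℕ.+ m) - A (suc h) 1 * W a (1 ℕ.+ m) - A (suc h) 2 * W a m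
    W-sum = begin
      ι 2 * T₁ + e 1 x * T₂ + T₃ + T₄
        ≈⟨ +-cong (+-cong (+-cong
             (*-congˡ (Θ≥3-sum a h m (inj₁ (s≤s z≤n)))) (*-congˡ (Θ≥3-sum a h (k ℕ.+ i) (1≤k+i k i))))
             (+-cong (AU 0 (1 ℕ.+ m)) (AU 1 m))) (AU 2 (k ℕ.+ i)) ⟩
      ι 2 * (W a n - (A (suc h) 0 * V a (2 ℕ.+ m) + A (suc h) 1 * V a (1 ℕ.+ m) + A (suc h) 2 * V a m))
        + e 1 x * (W a n-1 - (A (suc h) 0 * V a (1 ℕ.+ m) + A (suc h) 1 * V a m + A (suc h) 2 * V a (k ℕ.+ i)))
        + ((ι 2 * (A (suc h) 0 * V a (2 ℕ.+ m)) + e 1 x * (A (suc h) 0 * V a (1 ℕ.+ m)) - A (suc h) 0 * W a (2 ℕ.+ m))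
          + (ι 2 * (A (suc h) 1 * V a (1 ℕ.+ m)) + e 1 x * (A (suc h) 1 * V a m) - A (suc h) 1 * W a (1 ℕ.+ m)))
        + (ι 2 * (A (suc h) 2 * V a m) + e 1 x * (A (suc h) 2 * V a (k ℕ.+ i)) - A (suc h) 2 * W a m)
        ≈⟨ solve 12 (λ w w′ E AV₀ AV₁ AV₂ AV₀′ AV₁′ AV₂′ AW₀ AW₁ AW₂ →
             con (+ 2) :* (w :- (AV₀ :+ AV₁ :+ AV₂)) :+ E :* (w′ :- (AV₀′ :+ AV₁′ :+ AV₂′))
               :+ ((con (+ 2) :* AV₀ :+ E :* AV₀′ :- AW₀) :+ (con (+ 2) :* AV₁ :+ E :* AV₁′ :- AW₁))
               :+ (con (+ 2) :* AV₂ :+ E :* AV₂′ :- AW₂)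
             := con (+ 2) :* w :+ E :* w′ :- AW₀ :- AW₁ :- AW₂)
             refl (W a n) (W a n-1) (e 1 x)
             (A (suc h) 0 * V a (2 ℕ.+ m)) (A (suc h) 1 * V a (1 ℕ.+ m)) (A (suc h) 2 * V a m)
             (A (suc h) 0 * V a (1 ℕ.+ m)) (A (suc h) 1 * V a m) (A (suc h) 2 * V a (k ℕ.+ i))
             (A (suc h) 0 * W a (2 ℕ.+ m)) (A (suc h) 1 * W a (1 ℕ.+ m)) (A (suc h) 2 * W a m) ⟩
      ι 2 * W a n + e 1 x * W a n-1
        - A (suc h) 0 * W a (2 ℕ.+ m) - A (suc h) 1 * W a (1 ℕ.+ m) - A (suc h) 2 * W a m ∎

    private
      P-1 : P 1 ≈ e 1 x
      P-1 = trans (P≈L 0) (trans (L-0 0) (trans (*-congʳ (+-identityʳ 1#)) (*-identityˡ _)))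

      P-2 : P 2 ≈ ι 2 * e 2 x
      P-2 = begin
        P 2
          ≈⟨ trans (P≈L 1) (L-suc 0 0) ⟩
        L 1 0 + 0# * e 1 x * P 1
          ≈⟨ +-cong (L-0 1) (trans (*-congʳ (zeroˡ _)) (zeroˡ _)) ⟩
        ι 2 * e 2 x + 0#
          ≈⟨ +-identityʳ _ ⟩
        ι 2 * e 2 x ∎

      L-W : ∀ j n → suc k ℕ.+ j ≡ n → L k j ≈ W a n
      L-W j .(suc k ℕ.+ j) ≡.refl = L≈W k j

    twin≈W-sum : ∥ M^ h ∙ T (M^ i ∙ ε k) ∥ ≈ ι 2 * (ι 2 * T₁ + e 1 x * T₂ + T₃ + T₄)
    twin≈W-sum = begin
      ∥ M^ h ∙ T (M^ i ∙ ε k) ∥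
        ≈⟨ twin-expand h i k ⟩
      ι 4 * L k (h ℕ.+ (3 ℕ.+ i)) + ι 2 * P 1 * L k (h ℕ.+ (2 ℕ.+ i))
        - ι 2 * L k i * P (3 ℕ.+ h) - ι 2 * L k (1 ℕ.+ i) * P (2 ℕ.+ h) - ι 2 * L k (2 ℕ.+ i) * P (1 ℕ.+ h)
        + P 2 * L k i * P (1 ℕ.+ h)
        ≈⟨ +-cong (+-cong (+-cong (+-cong (+-cong
             (*-congˡ (L-W _ n (ℕ-solve 3 (λ h i k → (ℕcon 1 ℕ:+ k) ℕ:+ (h ℕ:+ (ℕcon 3 ℕ:+ i)) ℕ:= (ℕcon 1 ℕ:+ h) ℕ:+ ℕcon 2 ℕ:+ ((ℕcon 1 ℕ:+ k) ℕ:+ i)) ≡.refl h i k)))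
             (*-cong (*-congˡ P-1) (L-W _ n-1 (ℕ-solve 3 (λ h i k → (ℕcon 1 ℕ:+ k) ℕ:+ (h ℕ:+ (ℕcon 2 ℕ:+ i)) ℕ:= (ℕcon 1 ℕ:+ h) ℕ:+ ℕcon 2 ℕ:+ (k ℕ:+ i)) ≡.refl h i k))))
             (-‿cong (*-cong (*-congˡ (L-W i m ≡.refl)) (reflexive (≡.cong P (ℕₚ.+-comm 2 (suc h)))))))
             (-‿cong (*-cong (*-congˡ (L-W _ (1 ℕ.+ m) (ℕₚ.+-suc (suc k) i))) (trans (reflexive (≡.cong P (ℕₚ.+-comm 1 (suc h)))) (sym (A-1 h))))))
             (-‿cong (*-cong (*-congˡ (L-W _ (2 ℕ.+ m) (≡.trans (ℕₚ.+-suc (suc k) (suc i)) (≡.cong suc (ℕₚ.+-suc (suc k) i))))) (sym (A-0 h)))))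
             (*-congʳ (*-cong P-2 (L-W i m ≡.refl))) ⟩
      ι 4 * W a n + ι 2 * e 1 x * W a n-1
        - ι 2 * W a m * P (suc h ℕ.+ 2) - ι 2 * W a (1 ℕ.+ m) * A (suc h) 1 - ι 2 * W a (2 ℕ.+ m) * A (suc h) 0
        + ι 2 * e 2 x * W a m * P (suc h)
        ≈⟨ solve 10 (λ w w′ E w₂ w₁ w₀ p p′ A₁ A₀ →
             con (+ 4) :* w :+ con (+ 2) :* E :* w′ :- con (+ 2) :* w₂ :* p :- con (+ 2) :* w₁ :* A₁ :- con (+ 2) :* w₀ :* A₀ :+ p′
             := con (+ 2) :* (con (+ 2) :* w :+ E :* w′ :- A₀ :* w₀ :- A₁ :* w₁ :- p :* w₂) :+ p′)
             refl (W a n) (W a n-1) (e 1 x) (W a m) (W a (1 ℕ.+ m)) (W a (2 ℕ.+ m)) (P (suc h ℕ.+ 2))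
               (ι 2 * e 2 x * W a m * P (suc h)) (A (suc h) 1) (A (suc h) 0) ⟩
      ι 2 * (ι 2 * W a n + e 1 x * W a n-1 - A (suc h) 0 * W a (2 ℕ.+ m) - A (suc h) 1 * W a (1 ℕ.+ m) - P (suc h ℕ.+ 2) * W a m)
        + ι 2 * e 2 x * W a m * P (suc h)
        -- The leftover term, with the 2 e_2 of `P-2`, joins the product of `W a m` with P (suc h +
        -- 2), and together they contain `A (suc h) 2` by `A-2`.
        ≈⟨ solve 5 (λ s p w p′ E → con (+ 2) :* (s :- p :* w) :+ con (+ 2) :* E :* w :* p′
             := con (+ 2) :* (s :- (p :- p′ :* E) :* w)) refl _ (P (suc h ℕ.+ 2)) (W a m) (P (suc h)) (e 2 x) ⟩
      ι 2 * (ι 2 * W a n + e 1 x * W a n-1 - A (suc h) 0 * W a (2 ℕ.+ m) - A (suc h) 1 * W a (1 ℕ.+ m) - (P (suc h ℕ.+ 2) - P (suc h) * e 2 x) * W a m)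
        ≈⟨ *-congˡ (trans (+-congˡ (-‿cong (*-congʳ (sym (A-2 h))))) (sym W-sum)) ⟩
      ι 2 * (ι 2 * T₁ + e 1 x * T₂ + T₃ + T₄) ∎

-- Proper colourings, one vertex at a time.

allB-tabulate : ∀ {A : Set} {n} (p : A → Bool) (f : Fin n → A) → allB p (tabulate f) ≡ allB (p ∘ f) (allFin n)
allB-tabulate {n = zero} p f = ≡.refl
allB-tabulate {n = suc n} p f = ≡.cong (p (f zero) ∧_)
  (≡.trans (allB-tabulate p (f ∘ suc)) (≡.sym (allB-tabulate (p ∘ f) suc)))

allB-suc : ∀ {n} (p : Fin (suc n) → Bool) → allB p (allFin (suc n)) ≡ p zero ∧ allB (p ∘ suc) (allFin n)
allB-suc p = ≡.cong (p zero ∧_) (allB-tabulate p suc)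

allB-cong : ∀ {A : Set} {p q : A → Bool} xs → (∀ x → p x ≡ q x) → allB p xs ≡ allB q xs
allB-cong [] eq = ≡.refl
allB-cong (x ∷ xs) eq = ≡.cong₂ _∧_ (eq x) (allB-cong xs eq)

allB-∧ : ∀ {A : Set} (p q : A → Bool) xs → allB (λ x → p x ∧ q x) xs ≡ allB p xs ∧ allB q xs
allB-∧ p q [] = ≡.refl
allB-∧ p q (x ∷ xs) = ≡.trans (≡.cong ((p x ∧ q x) ∧_) (allB-∧ p q xs)) (interchange (p x) (q x) (allB p xs) (allB q xs))
  where
  interchange : ∀ a b c d → (a ∧ b) ∧ (c ∧ d) ≡ (a ∧ c) ∧ (b ∧ d)
  interchange false b c d = ≡.refl
  interchange true b false d = Boolₚ.∧-zeroʳ b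
  interchange true b true d = ≡.refl

shift : (ℕ → ℕ → Bool) → ℕ → ℕ → Bool
shift adj u v = adj (suc u) (suc v)

record IsSimple (adj : ℕ → ℕ → Bool) : Set where
  field
    symmetric : ∀ u v → adj u v ≡ adj v u
    irreflexive : ∀ u → adj u u ≡ false

shift-simple : ∀ {adj} → IsSimple adj → IsSimple (shift adj)
shift-simple s = record { symmetric = λ u v → symmetric (suc u) (suc v) ; irreflexive = λ u → irreflexive (suc u) }
  where open IsSimple s

avoids : ∀ {N n} → (ℕ → Bool) → Fin N → Vec (Fin N) n → Bool
avoids r i [] = true
avoids r i (j ∷ κ) = (not (r 0) ∨ not (finEq j i)) ∧ avoids (r ∘ suc) i κ

avoids-allB : ∀ {N n} r (i : Fin N) (κ : Vec (Fin N) n) →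
  allB (λ v → not (r (toℕ v)) ∨ not (finEq (lookup κ v) i)) (allFin n) ≡ avoids r i κ
avoids-allB r i [] = ≡.refl
avoids-allB r i (j ∷ κ) = ≡.trans (allB-suc (λ v → not (r (toℕ v)) ∨ not (finEq (lookup (j ∷ κ) v) i)))
  (≡.cong ((not (r 0) ∨ not (finEq j i)) ∧_) (avoids-allB (r ∘ suc) i κ))

-- `proper` tests each pair in both orders and also the diagonal. Symmetry makes the two tests of
-- vertex 0 agree, hence the idempotence below, and irreflexivity disposes of the diagonal.
proper-∷ : ∀ {N n adj} → IsSimple adj → (i : Fin N) (κ : Vec (Fin N) n) →
  proper adj (i ∷ κ) ≡ avoids (λ v → adj 0 (suc v)) i κ ∧ proper (shift adj) κ
proper-∷ {N} {n} {adj} s i κ = begin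
  proper adj (i ∷ κ)
    ≡⟨ allB-suc (λ u → allB (ok u) (allFin (suc n))) ⟩
  allB (ok zero) (allFin (suc n)) ∧ allB (λ u → allB (ok (suc u)) (allFin (suc n))) (allFin n)
    ≡⟨ ≡.cong₂ _∧_
         (≡.trans (allB-suc (ok zero)) (≡.trans (≡.cong (λ b → (not b ∨ not (finEq i i)) ∧ allB (ok zero ∘ suc) (allFin n)) (irreflexive 0))
           (≡.trans (allB-cong (allFin n) ok-sym) (avoids-allB _ i κ))))
         (≡.trans (allB-cong (allFin n) λ u → allB-suc (ok (suc u)))
           (≡.trans (allB-∧ (λ u → ok (suc u) zero) _ (allFin n))
             (≡.cong₂ _∧_ (≡.trans (allB-cong (allFin n) ok-sym′) (avoids-allB _ i κ)) ≡.refl))) ⟩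
  avoids r i κ ∧ (avoids r i κ ∧ proper (shift adj) κ)
    ≡⟨ ≡.trans (≡.sym (Boolₚ.∧-assoc (avoids r i κ) _ _)) (≡.cong (_∧ proper (shift adj) κ) (Boolₚ.∧-idem (avoids r i κ))) ⟩
  avoids r i κ ∧ proper (shift adj) κ ∎
  where
  open IsSimple s
  open ≡.≡-Reasoning
  r : ℕ → Bool
  r v = adj 0 (suc v)
  ok : Fin (suc n) → Fin (suc n) → Bool
  ok u v = not (adj (toℕ u) (toℕ v)) ∨ not (finEq (lookup (i ∷ κ) u) (lookup (i ∷ κ) v))
  ok-sym : ∀ v → ok zero (suc v) ≡ not (r (toℕ v)) ∨ not (finEq (lookup κ v) i)
  ok-sym v = ≡.cong (λ b → not (r (toℕ v)) ∨ not b) (finEq-sym i (lookup κ v))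
  ok-sym′ : ∀ v → ok (suc v) zero ≡ not (r (toℕ v)) ∨ not (finEq (lookup κ v) i)
  ok-sym′ v = ≡.cong (λ b → not b ∨ not (finEq (lookup κ v) i)) (symmetric (suc (toℕ v)) 0)

module ColouringSums (R : CommutativeRing 0ℓ 0ℓ) (N : ℕ) where
  open RingTools R
  open ColourVectors R

  -- Weights depend on the vertex, so that a colour forbidden by a vertex already coloured can be
  -- recorded as weight 0.
  Weights : Set
  Weights = ℕ → Fin N → Carrier

  weight : Weights → ∀ {n} → Vec (Fin N) n → Carrier
  weight g [] = 1#
  weight g (i ∷ κ) = g 0 i * weight (g ∘ suc) κ

  restrict : (ℕ → Bool) → Fin N → Weights → Weights
  restrict r i g v j = ⟦ not (r v) ∨ not (finEq j i) ⟧ * g v j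

  weight-restrict : ∀ r i g {n} (κ : Vec (Fin N) n) → ⟦ avoids r i κ ⟧ * weight g κ ≈ weight (restrict r i g) κ
  weight-restrict r i g [] = *-identityˡ 1#
  weight-restrict r i g (j ∷ κ) = begin
    ⟦ (not (r 0) ∨ not (finEq j i)) ∧ avoids (r ∘ suc) i κ ⟧ * (g 0 j * weight (g ∘ suc) κ)
      ≈⟨ *-congʳ (⟦⟧-∧ (not (r 0) ∨ not (finEq j i)) _) ⟩
    ⟦ not (r 0) ∨ not (finEq j i) ⟧ * ⟦ avoids (r ∘ suc) i κ ⟧ * (g 0 j * weight (g ∘ suc) κ)
      ≈⟨ solve 4 (λ a b c d → a :* b :* (c :* d) := a :* c :* (b :* d)) refl _ _ _ _ ⟩
    restrict r i g 0 j * (⟦ avoids (r ∘ suc) i κ ⟧ * weight (g ∘ suc) κ)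
      ≈⟨ *-congˡ (weight-restrict (r ∘ suc) i (g ∘ suc) κ) ⟩
    restrict r i g 0 j * weight (restrict r i g ∘ suc) κ ∎

  Z : ℕ → (ℕ → ℕ → Bool) → Weights → Carrier
  Z zero adj g = 1#
  Z (suc n) adj g = ∥ (λ i → g 0 i * Z n (shift adj) (restrict (λ v → adj 0 (suc v)) i (g ∘ suc))) ∥

  Z-colourings : ∀ n {adj} g → IsSimple adj →
    Σ (allVecs N n) (λ κ → ⟦ proper adj κ ⟧ * weight g κ) ≈ Z n adj g
  Z-colourings zero g s = trans (+-identityʳ _) (*-identityˡ 1#)
  Z-colourings (suc n) {adj} g s = begin
    Σ (allVecs N (suc n)) F
      ≈⟨ Σ-concatMap _ (allFin N) F ⟩
    Σ (allFin N) (λ i → Σ (map (i ∷_) (allVecs N n)) F)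
      ≈⟨ ∥∥-Σ _ ⟩
    ∥ (λ i → Σ (map (i ∷_) (allVecs N n)) F) ∥
      ≈⟨ ∥∥-cong (λ i → trans (Σ-map (i ∷_) (allVecs N n) F) (trans
           (Σ-cong (allVecs N n) (step i))
           (trans (Σ-*ˡ (allVecs N n) (g 0 i) _) (*-congˡ (Z-colourings n _ (shift-simple s)))))) ⟩
    Z (suc n) adj g ∎
    where
    F : Vec (Fin N) (suc n) → Carrier
    F κ = ⟦ proper adj κ ⟧ * weight g κ
    r : ℕ → Bool
    r v = adj 0 (suc v)
    step : ∀ i κ → F (i ∷ κ) ≈ g 0 i * (⟦ proper (shift adj) κ ⟧ * weight (restrict r i (g ∘ suc)) κ)
    step i κ = begin
      ⟦ proper adj (i ∷ κ) ⟧ * (g 0 i * weight (g ∘ suc) κ)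
        ≈⟨ *-congʳ (trans (⟦⟧-cong (proper-∷ s i κ)) (⟦⟧-∧ (avoids r i κ) _)) ⟩
      ⟦ avoids r i κ ⟧ * ⟦ proper (shift adj) κ ⟧ * (g 0 i * weight (g ∘ suc) κ)
        ≈⟨ solve 4 (λ a b c d → a :* b :* (c :* d) := c :* (b :* (a :* d))) refl _ _ _ _ ⟩
      g 0 i * (⟦ proper (shift adj) κ ⟧ * (⟦ avoids r i κ ⟧ * weight (g ∘ suc) κ))
        ≈⟨ *-congˡ (*-congˡ (weight-restrict r i (g ∘ suc) κ)) ⟩
      g 0 i * (⟦ proper (shift adj) κ ⟧ * weight (restrict r i (g ∘ suc)) κ) ∎

  Z-cong : ∀ n adj {f g : Weights} → (∀ v → v < n → ∀ i → f v i ≈ g v i) → Z n adj f ≈ Z n adj g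
  Z-cong zero adj eq = refl
  Z-cong (suc n) adj eq = ∥∥-cong λ i → *-cong (eq 0 (s≤s z≤n) i)
    (Z-cong n (shift adj) λ v p j → *-congˡ (eq (suc v) (s≤s p) j))

  -- `Z` starts at vertex 0, as the enumeration of colourings does, whereas twin, path and clique
  -- have to be dismantled from the largest index. By induction, the sums over the colours of the
  -- first and last vertices are interchanged.
  Z-peel-last : ∀ n adj g →
    Z (suc n) adj g ≈ ∥ (λ c → g n c * Z n adj (restrict (λ v → adj v n) c g)) ∥
  Z-peel-last zero adj g = refl
  Z-peel-last (suc n) adj g = begin
    ∥ (λ i → g 0 i * Z (suc n) (shift adj) (G i)) ∥
      ≈⟨ ∥∥-cong (λ i → trans (*-congˡ (Z-peel-last n (shift adj) (G i))) (sym (∥∥-*ˡ (g 0 i) _))) ⟩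
    ∥ (λ i → ∥ (λ c → g 0 i * (G i n c * Z n (shift adj) (restrict (λ v → adj (suc v) (suc n)) c (G i)))) ∥) ∥
      ≈⟨ ∥∥-swap _ ⟩
    ∥ (λ c → ∥ (λ i → g 0 i * (G i n c * Z n (shift adj) (restrict (λ v → adj (suc v) (suc n)) c (G i)))) ∥) ∥
      ≈⟨ ∥∥-cong (λ c → trans (∥∥-cong λ i → step c i) (∥∥-*ˡ (g (suc n) c) _)) ⟩
    ∥ (λ c → g (suc n) c * Z (suc n) adj (restrict (λ v → adj v (suc n)) c g)) ∥ ∎
    where
    G : Fin N → Weights
    G i = restrict (λ v → adj 0 (suc v)) i (g ∘ suc)
    step : ∀ c i →
      g 0 i * (G i n c * Z n (shift adj) (restrict (λ v → adj (suc v) (suc n)) c (G i))) ≈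
      g (suc n) c * (restrict (λ v → adj v (suc n)) c g 0 i *
        Z n (shift adj) (restrict (λ v → adj 0 (suc v)) i (restrict (λ v → adj v (suc n)) c g ∘ suc)))
    -- The edge between vertex 0 and the last vertex is tested from opposite ends on the two sides;
    -- the restrictions on all vertices in between commute.
    step c i = trans
      (*-congˡ (*-cong (*-congʳ (⟦⟧-cong (≡.cong (λ b → not (adj 0 (suc n)) ∨ not b) (finEq-sym c i))))
        (Z-cong n (shift adj) λ v _ j → solve 3 (λ a b c → a :* (b :* c) := b :* (a :* c)) refl _ _ _)))
      (solve 4 (λ a b c d → a :* (b :* c :* d) := c :* (b :* a :* d)) refl _ _ _ _)

-- The colouring sum of the twinned lollipop.

≡ᵇ-refl : ∀ m → (m ≡ᵇ m) ≡ true
≡ᵇ-refl zero = ≡.refl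
≡ᵇ-refl (suc m) = ≡ᵇ-refl m

≡ᵇ-false : ∀ {m n} → m ≢ n → (m ≡ᵇ n) ≡ false
≡ᵇ-false {m} {n} p with m ≡ᵇ n in eq
... | false = ≡.refl
... | true = contradiction (ℕₚ.≡ᵇ⇒≡ m n (≡.subst Data.Bool.T (≡.sym eq) _)) p

<ᵇ-true : ∀ {m n} → m < n → (m <ᵇ n) ≡ true
<ᵇ-true = ≤ᵇ-true

<ᵇ-false : ∀ {m n} → n ≤ m → (m <ᵇ n) ≡ false
<ᵇ-false p = ≤ᵇ-false (s≤s p)

-- The adjacencies of tw_h(K_a^l) for a = k + 1 and l = d + (2 + i), where the twin,
-- the vertex k + l + 1, is joined to v_i, v_{i+1} and v_{i+2}.
record IsTwinnedLollipop (k i d : ℕ) (adj : ℕ → ℕ → Bool) : Set where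
  l = d ℕ.+ (2 ℕ.+ i)
  field
    clique : ∀ u v → u < v → v ≤ k → adj u v ≡ true
    path-next : ∀ j → j < l → adj (k ℕ.+ j) (suc (k ℕ.+ j)) ≡ true
    path-far : ∀ u j → u < k ℕ.+ j → j < l → adj u (suc (k ℕ.+ j)) ≡ false
    twin-before : ∀ u → u < k ℕ.+ i → adj u (suc (k ℕ.+ l)) ≡ false
    twin-near : ∀ j → j ≤ 2 → adj (k ℕ.+ (j ℕ.+ i)) (suc (k ℕ.+ l)) ≡ true
    twin-after : ∀ j → j < d → adj (k ℕ.+ (j ℕ.+ (3 ℕ.+ i))) (suc (k ℕ.+ l)) ≡ false

module TwinnedLollipopSum (R : CommutativeRing 0ℓ 0ℓ) {N : ℕ} (x : Fin N → CommutativeRing.Carrier R) where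
  open RingTools R
  open ColourVectors R
  open Transfer R x
  open ColouringSums R N

  -- k! times φ k g j is the weighted sum over the colourings of the lollipop K_{k+1}^j
  -- by the colour of its last vertex v_j.
  φ : ℕ → Weights → ℕ → Fin N → Carrier
  φ k g zero i = g k i * e k (x ∖ i)
  φ k g (suc j) i = g (suc (k ℕ.+ j)) i * (∥ φ k g j ∥ - φ k g j i)

  φ-cong : ∀ k j {f g} → (∀ i → f (k ℕ.+ j) i ≈ g (k ℕ.+ j) i) → (∀ v → v < k ℕ.+ j → ∀ i → f v i ≈ g v i) → φ k f j ≋ φ k g j
  φ-cong k zero {f} {g} eq eqs i = *-congʳ (≡.subst (λ v → f v i ≈ g v i) (ℕₚ.+-identityʳ k) (eq i))
  φ-cong k (suc j) {f} {g} eq eqs i = *-cong (≡.subst (λ v → f v i ≈ g v i) (ℕₚ.+-suc k j) (eq i))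
    (+-cong (∥∥-cong IH) (-‿cong (IH i)))
    where
    below : ∀ {v} → v ≤ k ℕ.+ j → v < k ℕ.+ suc j
    below {v} p = ≡.subst (v <_) (≡.sym (ℕₚ.+-suc k j)) (s≤s p)
    IH : φ k f j ≋ φ k g j
    IH = φ-cong k j (eqs (k ℕ.+ j) (below ℕₚ.≤-refl)) λ v p → eqs v (below (ℕₚ.<⇒≤ p))

  φ-∖ : ∀ k j {f g} c → (∀ i → f (k ℕ.+ j) i ≈ (g (k ℕ.+ j) ∖ c) i) → (∀ v → v < k ℕ.+ j → ∀ i → f v i ≈ g v i) →
    φ k f j ≋ φ k g j ∖ c
  φ-∖ k zero {f} {g} c eq eqs i = trans
    (*-congʳ (≡.subst (λ v → f v i ≈ (g v ∖ c) i) (ℕₚ.+-identityʳ k) (eq i))) (*-assoc _ _ _)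
  φ-∖ k (suc j) {f} {g} c eq eqs i = trans
    (*-cong (≡.subst (λ v → f v i ≈ (g v ∖ c) i) (ℕₚ.+-suc k j) (eq i)) (+-cong (∥∥-cong IH) (-‿cong (IH i))))
    (*-assoc _ _ _)
    where
    below : ∀ {v} → v ≤ k ℕ.+ j → v < k ℕ.+ suc j
    below {v} p = ≡.subst (v <_) (≡.sym (ℕₚ.+-suc k j)) (s≤s p)
    IH : φ k f j ≋ φ k g j
    IH = φ-cong k j (eqs (k ℕ.+ j) (below ℕₚ.≤-refl)) λ v p → eqs v (below (ℕₚ.<⇒≤ p))

  restrict-true : ∀ r v c g i → r v ≡ true → restrict r c g v i ≈ (g v ∖ c) i
  restrict-true r v c g i eq = *-congʳ (⟦⟧-cong (≡.cong (λ b → not b ∨ not (finEq i c)) eq))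

  restrict-false : ∀ r v c g i → r v ≡ false → restrict r c g v i ≈ g v i
  restrict-false r v c g i eq = trans (*-congʳ (⟦⟧-cong (≡.cong (λ b → not b ∨ not (finEq i c)) eq))) (*-identityˡ _)

  module _ {k i d adj} (G : IsTwinnedLollipop k i d adj) where
    open IsTwinnedLollipop G

    -- Peeling a vertex of colour c deletes c from all remaining weights; `e-euler` then supplies
    -- the next factor of the factorial.
    Z-clique : ∀ n g y → n ≤ suc k → (∀ v → v < n → ∀ i → g v i ≈ y i) → Z n adj g ≈ ι (n !) * e n y
    Z-clique zero g y p eq = sym (trans (*-congʳ (+-identityʳ 1#)) (*-identityˡ 1#))
    Z-clique (suc n) g y (s≤s p) eq = begin
      Z (suc n) adj g
        ≈⟨ Z-peel-last n adj g ⟩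
      ∥ (λ c → g n c * Z n adj (restrict (λ v → adj v n) c g)) ∥
        ≈⟨ ∥∥-cong (λ c → trans (*-cong (eq n ℕₚ.≤-refl c) (Z-clique n _ (y ∖ c) (ℕₚ.m≤n⇒m≤1+n p) λ v q i →
             trans (restrict-true (λ v → adj v n) v c g i (clique v n q p)) (*-congˡ (eq v (ℕₚ.m≤n⇒m≤1+n q) i))))
             (solve 3 (λ a b c → a :* (b :* c) := b :* (a :* c)) refl _ _ _)) ⟩
      ∥ (λ c → ι (n !) * (y c * e n (y ∖ c))) ∥
        ≈⟨ trans (∥∥-*ˡ _ _) (*-congˡ (e-euler n y)) ⟩
      ι (n !) * (ι (suc n) * e (suc n) y)
        ≈⟨ solve 3 (λ a b c → a :* (b :* c) := (b :* a) :* c) refl (ι (n !)) (ι (suc n)) (e (suc n) y) ⟩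
      (ι (suc n) * ι (n !)) * e (suc n) y
        ≈⟨ *-congʳ (ι-* (suc n) (n !)) ⟨
      ι (suc n !) * e (suc n) y ∎

    Z-path : ∀ j g → j ≤ l → (∀ v → v < k → ∀ i → g v i ≈ x i) → Z (suc (k ℕ.+ j)) adj g ≈ ι (k !) * ∥ φ k g j ∥
    Z-path zero g p eq rewrite ℕₚ.+-identityʳ k = begin
      Z (suc k) adj g
        ≈⟨ Z-peel-last k adj g ⟩
      ∥ (λ c → g k c * Z k adj (restrict (λ v → adj v k) c g)) ∥
        ≈⟨ ∥∥-cong (λ c → trans (*-congˡ (Z-clique k _ (x ∖ c) (ℕₚ.n≤1+n k) λ v q i →
             trans (restrict-true (λ v → adj v k) v c g i (clique v k q ℕₚ.≤-refl)) (*-congˡ (eq v q i))))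
             (solve 3 (λ a b c → a :* (b :* c) := b :* (a :* c)) refl _ _ _)) ⟩
      ∥ (λ c → ι (k !) * (g k c * e k (x ∖ c))) ∥
        ≈⟨ ∥∥-*ˡ _ _ ⟩
      ι (k !) * ∥ φ k g 0 ∥ ∎
    Z-path (suc j) g p eq rewrite ℕₚ.+-suc k j = begin
      Z (suc (suc (k ℕ.+ j))) adj g
        ≈⟨ Z-peel-last (suc (k ℕ.+ j)) adj g ⟩
      ∥ (λ c → g (suc (k ℕ.+ j)) c * Z (suc (k ℕ.+ j)) adj (g′ c)) ∥
        ≈⟨ ∥∥-cong (λ c → trans (*-congˡ (trans
             (Z-path j (g′ c) (ℕₚ.<⇒≤ p) λ v q i → trans (far c v (ℕₚ.≤-trans q (ℕₚ.m≤m+n k j)) i) (eq v q i))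
             (*-congˡ (trans (∥∥-cong (φ-∖ k j c (λ i → restrict-true (λ v → adj v (suc (k ℕ.+ j))) (k ℕ.+ j) c g i (path-next j p)) (far c))) (∥∥-∖ (φ k g j) c)))))
             (solve 3 (λ a b c → a :* (b :* c) := b :* (a :* c)) refl _ _ _)) ⟩
      ∥ (λ c → ι (k !) * φ k g (suc j) c) ∥
        ≈⟨ ∥∥-*ˡ _ _ ⟩
      ι (k !) * ∥ φ k g (suc j) ∥ ∎
      where
      g′ : Fin N → Weights
      g′ c = restrict (λ v → adj v (suc (k ℕ.+ j))) c g
      far : ∀ c v → v < k ℕ.+ j → ∀ i → g′ c v i ≈ g v i
      far c v q i = restrict-false (λ v → adj v (suc (k ℕ.+ j))) v c g i (path-far v j q p)

    private
      r : ℕ → Bool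
      r v = adj v (suc (k ℕ.+ l))

      gᶜ : Fin N → Weights
      gᶜ c = restrict r c (λ _ → x)

      suc-r : ∀ {b} j → r (k ℕ.+ suc j) ≡ b → r (suc (k ℕ.+ j)) ≡ b
      suc-r {b} j = ≡.subst (λ v → r v ≡ b) (ℕₚ.+-suc k j)

      free : ∀ c j {ψ} → r (k ℕ.+ suc j) ≡ false → φ k (gᶜ c) j ≋ ψ → φ k (gᶜ c) (suc j) ≋ M ψ
      free c j eq φ≋ t = *-cong (restrict-false r (suc (k ℕ.+ j)) c (λ _ → x) t (suc-r j eq)) (+-cong (∥∥-cong φ≋) (-‿cong (φ≋ t)))

      near : ∀ c j {ψ} → r (k ℕ.+ suc j) ≡ true → φ k (gᶜ c) j ≋ ψ → φ k (gᶜ c) (suc j) ≋ M ψ ∖ c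
      near c j eq φ≋ t = trans
        (*-cong (restrict-true r (suc (k ℕ.+ j)) c (λ _ → x) t (suc-r j eq)) (+-cong (∥∥-cong φ≋) (-‿cong (φ≋ t)))) (*-assoc _ _ _)

      φ-before : ∀ c j → j < i → φ k (gᶜ c) j ≋ M^ j ∙ ε k
      φ-before c zero p t = *-congʳ (restrict-false r k c (λ _ → x) t (twin-before k (≡.subst (_< k ℕ.+ i) (ℕₚ.+-identityʳ k) (ℕₚ.+-monoʳ-< k p))))
      φ-before c (suc j) p = free c j (twin-before _ (ℕₚ.+-monoʳ-< k p)) (φ-before c j (ℕₚ.<⇒≤ p))

      -- Stated with an equation so that a case split on i′ is possible: for i = 0 the first
      -- neighbour of the twin lies in the clique.
      φ-at : ∀ c i′ → i′ ≡ i → φ k (gᶜ c) i′ ≋ (M^ i′ ∙ ε k) ∖ c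
      φ-at c zero ≡.refl t = trans
        (*-congʳ (restrict-true r k c (λ _ → x) t (≡.subst (λ v → r v ≡ true) (ℕₚ.+-identityʳ k) (twin-near 0 z≤n)))) (*-assoc _ _ _)
      φ-at c (suc i′) ≡.refl = near c i′ (twin-near 0 z≤n) (φ-before c i′ ℕₚ.≤-refl)

      ψ : Fin N → Fin N → Carrier
      ψ c = M (M ((M^ i ∙ ε k) ∖ c) ∖ c) ∖ c

      φ-near : ∀ c → φ k (gᶜ c) (2 ℕ.+ i) ≋ ψ c
      φ-near c = near c (1 ℕ.+ i) (twin-near 2 ℕₚ.≤-refl) (near c i (twin-near 1 (s≤s z≤n)) (φ-at c i ≡.refl))

      φ-after : ∀ c j → j ≤ d → φ k (gᶜ c) (j ℕ.+ (2 ℕ.+ i)) ≋ M^ j ∙ ψ c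
      φ-after c zero p = φ-near c
      φ-after c (suc j) p = free c (j ℕ.+ (2 ℕ.+ i))
        (≡.subst (λ n → r (k ℕ.+ n) ≡ false) (ℕₚ.+-suc j (2 ℕ.+ i)) (twin-after j p))
        (φ-after c j (ℕₚ.<⇒≤ p))

    -- The twin has the largest index and is peeled first. With its colour c fixed, a lollipop with
    -- weights `gᶜ c` remains, and the sum over c is afterwards drawn inside `M^ d`, where it forms
    -- `T`.
    Z-twinned : Z (suc (suc (k ℕ.+ l))) adj (λ _ → x) ≈ ι (k !) * ∥ M^ d ∙ T (M^ i ∙ ε k) ∥
    Z-twinned = begin
      Z (suc (suc (k ℕ.+ l))) adj (λ _ → x)
        ≈⟨ Z-peel-last (suc (k ℕ.+ l)) adj (λ _ → x) ⟩
      ∥ (λ c → x c * Z (suc (k ℕ.+ l)) adj (gᶜ c)) ∥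
        ≈⟨ ∥∥-cong (λ c → trans (*-congˡ (trans
             (Z-path l (gᶜ c) ℕₚ.≤-refl λ v q t → restrict-false r v c (λ _ → x) t (twin-before v (ℕₚ.≤-trans q (ℕₚ.m≤m+n k i))))
             (*-congˡ (∥∥-cong (φ-after c d ℕₚ.≤-refl)))))
             (solve 3 (λ a b c → a :* (b :* c) := b :* (a :* c)) refl _ _ _)) ⟩
      ∥ (λ c → ι (k !) * (x c * ∥ M^ d ∙ ψ c ∥)) ∥
        ≈⟨ trans (∥∥-*ˡ _ _) (*-congˡ (∥∥-cong λ c → sym (∥∥-*ˡ _ _))) ⟩
      ι (k !) * ∥ (λ c → ∥ (λ t → x c * (M^ d ∙ ψ c) t) ∥) ∥
        ≈⟨ *-congˡ (∥∥-swap _) ⟩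
      ι (k !) * ∥ (λ t → ∥ (λ c → x c * (M^ d ∙ ψ c) t) ∥) ∥
        ≈⟨ *-congˡ (∥∥-cong λ t → trans (∥∥-cong λ c → sym (M^-*ˡ d (x c) (ψ c) t)) (sym (M^-∥∥ d (λ c t → x c * ψ c t) t))) ⟩
      ι (k !) * ∥ M^ d ∙ T (M^ i ∙ ε k) ∥ ∎

-- Adjacencies in the lollipop and in its twinned graph.

module Lollipop (k l : ℕ) where
  private
    lp = lollipop (suc k) l

  lollipop-sym : ∀ u v → lp u v ≡ lp v u
  lollipop-sym u v = Boolₚ.∨-comm (lollipopLt (suc k) l u v) _

  lollipop-irrefl : ∀ u → lp u u ≡ false
  lollipop-irrefl u rewrite <ᵇ-false {u} {u} ℕₚ.≤-refl = ≡.refl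

  lollipop-clique : ∀ u v → u < v → v ≤ k → lp u v ≡ true
  lollipop-clique u v p q rewrite <ᵇ-true p | <ᵇ-true {v} {suc k} (s≤s q) = ≡.refl

  lollipop-next : ∀ j → j < l → lp (k ℕ.+ j) (suc (k ℕ.+ j)) ≡ true
  lollipop-next j p rewrite <ᵇ-true (ℕₚ.n<1+n (k ℕ.+ j)) | <ᵇ-false {suc (k ℕ.+ j)} {suc k} (s≤s (ℕₚ.m≤m+n k j))
    | ≡ᵇ-refl (k ℕ.+ j) | <ᵇ-true {k} {suc (k ℕ.+ j)} (s≤s (ℕₚ.m≤m+n k j)) | <ᵇ-true (ℕₚ.+-monoʳ-< k p) = ≡.refl

  lollipop-far : ∀ u j → u < k ℕ.+ j → lp u (suc (k ℕ.+ j)) ≡ false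
  lollipop-far u j p rewrite <ᵇ-false {suc (k ℕ.+ j)} {u} (ℕₚ.m≤n⇒m≤1+n (ℕₚ.<⇒≤ p))
    | <ᵇ-false {suc (k ℕ.+ j)} {suc k} (s≤s (ℕₚ.m≤m+n k j)) | ≡ᵇ-false {k ℕ.+ j} {u} (ℕₚ.<⇒≢ p ∘ ≡.sym)
    = ≡.trans (Boolₚ.∨-identityʳ _) (Boolₚ.∧-zeroʳ _)

module _ (adj : ℕ → ℕ → Bool) (m x : ℕ) where
  twin-old : ∀ u v → u < m → v < m → twin adj m x u v ≡ adj u v
  twin-old u v p q rewrite <ᵇ-true p | <ᵇ-true q | ≡ᵇ-false (ℕₚ.<⇒≢ p) | ≡ᵇ-false (ℕₚ.<⇒≢ q) = Boolₚ.∨-identityʳ _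

  twin-new : ∀ u → u < m → twin adj m x u m ≡ (u ≡ᵇ x) ∨ adj x u
  twin-new u p rewrite <ᵇ-true p | <ᵇ-false {m} {m} ℕₚ.≤-refl | ≡ᵇ-false (ℕₚ.<⇒≢ p) | ≡ᵇ-refl m = ≡.refl

  twin-simple : IsSimple adj → IsSimple (twin adj m x)
  twin-simple s = record { symmetric = symm ; irreflexive = irrefl }
    where
    open IsSimple s
    symm : ∀ u v → twin adj m x u v ≡ twin adj m x v u
    symm u v = ≡.cong₂ _∨_
      (≡.cong₂ _∧_ (Boolₚ.∧-comm (u <ᵇ m) (v <ᵇ m)) (symmetric u v))
      (Boolₚ.∨-comm ((u ≡ᵇ m) ∧ (v <ᵇ m) ∧ ((v ≡ᵇ x) ∨ adj x v)) _)
    irrefl : ∀ u → twin adj m x u u ≡ false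
    irrefl u rewrite irreflexive u | Boolₚ.∧-zeroʳ ((u <ᵇ m) ∧ (u <ᵇ m)) with u ≡ᵇ m in eq
    ... | false = ≡.refl
    ... | true rewrite ℕₚ.≡ᵇ⇒≡ u m (≡.subst Data.Bool.T (≡.sym eq) _) | <ᵇ-false {m} {m} ℕₚ.≤-refl = ≡.refl

module _ (k i d : ℕ) where
  private
    l = d ℕ.+ (2 ℕ.+ i)
    m = suc k ℕ.+ l
    x = k ℕ.+ suc i
    lp = lollipop (suc k) l
    open Lollipop k l

    lollipop-simple : IsSimple lp
    lollipop-simple = record { symmetric = lollipop-sym ; irreflexive = lollipop-irrefl }

    -- So the vertex that is twinned is v_{i+1}, with v_i and v_{i+2} beside it.
    l∸h : l ∸ suc d ≡ suc i
    l∸h = ≡.trans (≡.cong (_∸ suc d) (≡.trans (ℕₚ.+-suc d (suc i)) (≡.cong suc (ℕₚ.+-suc d i))))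
      (≡.trans (≡.cong (_∸ d) (≡.sym (ℕₚ.+-suc d i))) (ℕₚ.m+n∸m≡n d (suc i)))

    twin-before : ∀ u → u < k ℕ.+ i → twin lp m x u m ≡ false
    twin-before u p rewrite twin-new lp m x u (ℕₚ.<-≤-trans p (ℕₚ.≤-trans (ℕₚ.+-monoʳ-≤ k
        (ℕₚ.≤-trans (ℕₚ.m≤n+m i (2 ℕ.+ d)) (ℕₚ.≤-reflexive (≡.trans (≡.cong (ℕ._+ i) (ℕₚ.+-comm 2 d)) (ℕₚ.+-assoc d 2 i)))))
        (ℕₚ.n≤1+n _)))
      | ℕₚ.+-suc k i | ≡ᵇ-false {u} {suc (k ℕ.+ i)} (ℕₚ.<⇒≢ (ℕₚ.m≤n⇒m≤1+n p))
      = ≡.trans (lollipop-sym (suc (k ℕ.+ i)) u) (lollipop-far u i p)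

    i+j<l : ∀ j → j ≤ 1 → j ℕ.+ i < l
    i+j<l j p = ℕₚ.≤-trans (s≤s (ℕₚ.+-monoˡ-≤ i p)) (ℕₚ.m≤n+m (2 ℕ.+ i) d)

    twin-near : ∀ j → j ≤ 2 → twin lp m x (k ℕ.+ (j ℕ.+ i)) m ≡ true
    twin-near j p = ≡.trans
      (twin-new lp m x (k ℕ.+ (j ℕ.+ i)) (s≤s (ℕₚ.+-monoʳ-≤ k (ℕₚ.≤-trans (ℕₚ.+-monoˡ-≤ i p) (ℕₚ.m≤n+m (2 ℕ.+ i) d)))))
      (adjacent j p)
      where
      adjacent : ∀ j → j ≤ 2 → (k ℕ.+ (j ℕ.+ i) ≡ᵇ x) ∨ lp x (k ℕ.+ (j ℕ.+ i)) ≡ true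
      adjacent 0 _ rewrite ℕₚ.+-suc k i
        | lollipop-sym (suc (k ℕ.+ i)) (k ℕ.+ i) | lollipop-next i (i+j<l 0 z≤n) = Boolₚ.∨-zeroʳ _
      adjacent 1 _ rewrite ≡ᵇ-refl x = ≡.refl
      adjacent 2 _ rewrite ℕₚ.+-suc k (suc i) | lollipop-next (suc i) (i+j<l 1 ℕₚ.≤-refl) = Boolₚ.∨-zeroʳ _
      adjacent (suc (suc (suc j))) (s≤s (s≤s ()))

    twin-after : ∀ j → suc j ≤ d → twin lp m x (k ℕ.+ (j ℕ.+ (3 ℕ.+ i))) m ≡ false
    twin-after j p rewrite twin-new lp m x (k ℕ.+ (j ℕ.+ (3 ℕ.+ i)))
        (s≤s (ℕₚ.+-monoʳ-≤ k (ℕₚ.≤-trans (ℕₚ.≤-reflexive (ℕₚ.+-suc j (2 ℕ.+ i))) (ℕₚ.+-monoˡ-≤ (2 ℕ.+ i) p))))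
      | ≡ᵇ-false {k ℕ.+ (j ℕ.+ (3 ℕ.+ i))} {x} (ℕₚ.<⇒≢ (ℕₚ.+-monoʳ-< k (ℕₚ.≤-trans (s≤s (s≤s (ℕₚ.n≤1+n i))) (ℕₚ.m≤n+m (3 ℕ.+ i) j))) ∘ ≡.sym)
      | ℕₚ.+-suc j (2 ℕ.+ i) | ℕₚ.+-suc k (j ℕ.+ (2 ℕ.+ i))
      = lollipop-far x (j ℕ.+ (2 ℕ.+ i)) (ℕₚ.+-monoʳ-< k (ℕₚ.m≤n+m (2 ℕ.+ i) j))

  twLollipop-simple : IsSimple (twLollipop (suc k) l (suc d))
  twLollipop-simple = twin-simple lp m _ lollipop-simple

  twLollipop-twinned : IsTwinnedLollipop k i d (twLollipop (suc k) l (suc d))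
  twLollipop-twinned rewrite l∸h = record
    { clique = λ u v p q → ≡.trans (twin-old lp m x u v (ℕₚ.<-trans p (below q)) (below q)) (lollipop-clique u v p q)
    ; path-next = λ j p → ≡.trans (twin-old lp m x _ _ (ℕₚ.m≤n⇒m≤1+n (ℕₚ.+-monoʳ-< k p)) (s≤s (ℕₚ.+-monoʳ-< k p))) (lollipop-next j p)
    ; path-far = λ u j p q → ≡.trans
        (twin-old lp m x _ _ (ℕₚ.<-trans p (ℕₚ.m≤n⇒m≤1+n (ℕₚ.+-monoʳ-< k q))) (s≤s (ℕₚ.+-monoʳ-< k q))) (lollipop-far u j p)
    ; twin-before = twin-before
    ; twin-near = twin-near
    ; twin-after = λ j p → twin-after j p
    }
    where
    below : ∀ {v} → v ≤ k → v < m
    below q = s≤s (ℕₚ.≤-trans q (ℕₚ.m≤m+n k l))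

-- Power series and extraction of coefficients.

module PowerSeries (R : CommutativeRing 0ℓ 0ℓ) where
  open RingTools R

  Series : Set
  Series = ℕ → Carrier

  infix 4 _≈ₛ_
  _≈ₛ_ : Series → Series → Set
  f ≈ₛ g = ∀ n → f n ≈ g n

  -- The Cauchy product by recursion on the exponent, after writing f as its constant term plus t
  -- times the shifted series.
  _+ₛ_ _*ₛ_ : Series → Series → Series
  (f +ₛ g) n = f n + g n
  (f *ₛ g) zero = f 0 * g 0
  (f *ₛ g) (suc n) = f 0 * g (suc n) + ((f ∘ suc) *ₛ g) n

  constant : Carrier → Series
  constant c zero = c
  constant c (suc n) = 0#

  *ₛ-cong : ∀ {f f′ g g′} → f ≈ₛ f′ → g ≈ₛ g′ → f *ₛ g ≈ₛ f′ *ₛ g′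
  *ₛ-cong p q zero = *-cong (p 0) (q 0)
  *ₛ-cong p q (suc n) = +-cong (*-cong (p 0) (q (suc n))) (*ₛ-cong (p ∘ suc) q n)

  *ₛ-distribʳ : ∀ h f g → (f +ₛ g) *ₛ h ≈ₛ (f *ₛ h) +ₛ (g *ₛ h)
  *ₛ-distribʳ h f g zero = distribʳ _ _ _
  *ₛ-distribʳ h f g (suc n) = trans (+-congˡ (*ₛ-distribʳ h (f ∘ suc) (g ∘ suc) n))
    (solve 5 (λ a b c d e → (a :+ b) :* c :+ (d :+ e) := (a :* c :+ d) :+ (b :* c :+ e)) refl _ _ _ _ _)

  *ₛ-scale : ∀ c f g → (λ n → c * f n) *ₛ g ≈ₛ (λ n → c * (f *ₛ g) n)
  *ₛ-scale c f g zero = *-assoc _ _ _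
  *ₛ-scale c f g (suc n) = trans (+-cong (*-assoc _ _ _) (*ₛ-scale c (f ∘ suc) g n)) (sym (distribˡ c _ _))

  *ₛ-zeroˡ : ∀ {f} g → (∀ n → f n ≈ 0#) → ∀ n → (f *ₛ g) n ≈ 0#
  *ₛ-zeroˡ g eq zero = trans (*-congʳ (eq 0)) (zeroˡ _)
  *ₛ-zeroˡ g eq (suc n) = trans (+-cong (trans (*-congʳ (eq 0)) (zeroˡ _)) (*ₛ-zeroˡ g (eq ∘ suc) n)) (+-identityʳ 0#)

  constant-* : ∀ c f → constant c *ₛ f ≈ₛ (λ n → c * f n)
  constant-* c f zero = refl
  constant-* c f (suc n) = trans (+-congˡ (*ₛ-zeroˡ f (λ _ → refl) n)) (+-identityʳ _)

  *ₛ-sucʳ : ∀ f g n → (f *ₛ g) (suc n) ≈ (f *ₛ (g ∘ suc)) n + f (suc n) * g 0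
  *ₛ-sucʳ f g zero = refl
  *ₛ-sucʳ f g (suc n) = trans (+-congˡ (*ₛ-sucʳ (f ∘ suc) g n)) (sym (+-assoc _ _ _))

  *ₛ-comm : ∀ f g → f *ₛ g ≈ₛ g *ₛ f
  *ₛ-comm f g zero = *-comm _ _
  *ₛ-comm f g (suc n) = trans (+-cong (*-comm _ _) (*ₛ-comm (f ∘ suc) g n))
    (trans (+-comm _ _) (sym (*ₛ-sucʳ g f n)))

  *ₛ-assoc : ∀ f g h → (f *ₛ g) *ₛ h ≈ₛ f *ₛ (g *ₛ h)
  *ₛ-assoc f g h zero = *-assoc _ _ _
  *ₛ-assoc f g h (suc n) = begin
    (f 0 * g 0) * h (suc n) + (((λ m → f 0 * g (suc m)) +ₛ ((f ∘ suc) *ₛ g)) *ₛ h) n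
      ≈⟨ +-congˡ (trans (*ₛ-distribʳ h _ _ n) (+-cong (*ₛ-scale (f 0) (g ∘ suc) h n) (*ₛ-assoc (f ∘ suc) g h n))) ⟩
    (f 0 * g 0) * h (suc n) + (f 0 * ((g ∘ suc) *ₛ h) n + ((f ∘ suc) *ₛ (g *ₛ h)) n)
      ≈⟨ solve 5 (λ a b c d e → (a :* b) :* c :+ (a :* d :+ e) := a :* (b :* c :+ d) :+ e) refl _ _ _ _ _ ⟩
    f 0 * (g 0 * h (suc n) + ((g ∘ suc) *ₛ h) n) + ((f ∘ suc) *ₛ (g *ₛ h)) n ∎

  *ₛ-identityˡ : ∀ f → constant 1# *ₛ f ≈ₛ f
  *ₛ-identityˡ f n = trans (constant-* 1# f n) (*-identityˡ _)

  powerSeries : CommutativeRing 0ℓ 0ℓ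
  powerSeries = record
    { Carrier = Series
    ; _≈_ = _≈ₛ_
    ; _+_ = _+ₛ_
    ; _*_ = _*ₛ_
    ; -_ = λ f n → - f n
    ; 0# = λ _ → 0#
    ; 1# = constant 1#
    ; isCommutativeRing = record
      { isRing = record
        { +-isAbelianGroup = Algebra.Construct.Pointwise.isAbelianGroup ℕ +-isAbelianGroup
        ; *-cong = *ₛ-cong
        ; *-assoc = *ₛ-assoc
        ; *-identity = *ₛ-identityˡ , λ f n → trans (*ₛ-comm f _ n) (*ₛ-identityˡ f n)
        ; distrib = (λ h f g n → trans (*ₛ-comm h (f +ₛ g) n) (trans (*ₛ-distribʳ h f g n) (+-cong (*ₛ-comm f h n) (*ₛ-comm g h n))))
            , *ₛ-distribʳ
        }
      ; *-comm = *ₛ-comm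
      }
    }

  t : Series
  t zero = 0#
  t (suc n) = constant 1# n

  t-*-zero : ∀ f → (t *ₛ f) 0 ≈ 0#
  t-*-zero f = zeroˡ _

  t-*-suc : ∀ f n → (t *ₛ f) (suc n) ≈ f n
  t-*-suc f n = trans (+-cong (zeroˡ _) (*ₛ-identityˡ f n)) (+-identityˡ _)

  private
    module V = ColourVectors R
    module Vₛ = ColourVectors powerSeries

  constant-e : ∀ k {n} (y : Fin n → Carrier) → Vₛ.e k (constant ∘ y) ≈ₛ constant (V.e k y)
  constant-e zero y n = refl
  constant-e (suc k) {zero} y zero = refl
  constant-e (suc k) {zero} y (suc n) = refl
  constant-e (suc k) {suc m} y n = trans
    (+-cong (constant-e (suc k) (y ∘ suc) n)
      (trans (constant-* (y zero) _ n) (*-congˡ (constant-e k (y ∘ suc) n))))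
    (additive n)
    where
    additive : ∀ n → constant (V.e (suc k) (y ∘ suc)) n + y zero * constant (V.e k (y ∘ suc)) n
      ≈ constant (V.e (suc k) y) n
    additive zero = refl
    additive (suc n) = trans (+-congˡ (zeroʳ _)) (+-identityʳ 0#)

-- Power series over the integers with one variable adjoined at a time, so that an exponent vector
-- is read off entry by entry and equality of series is equality of all coefficients.
Poly : ℕ → CommutativeRing 0ℓ 0ℓ
Poly zero = ℤₚ.+-*-commutativeRing
Poly (suc N) = PowerSeries.powerSeries (Poly N)

var : ∀ N → Fin N → CommutativeRing.Carrier (Poly N)
var (suc N) zero = PowerSeries.t (Poly N)
var (suc N) (suc i) = PowerSeries.constant (Poly N) (var N i)

coef : ∀ N → CommutativeRing.Carrier (Poly N) → Vec ℕ N → ℤ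
coef zero c [] = c
coef (suc N) f (n ∷ α) = coef N (f n) α

module _ where
  open CommutativeRing using (0#; 1#) renaming (_≈_ to _⊢_≈_; _+_ to _⊢_+_; _*_ to _⊢_*_)

  coef-cong : ∀ N {f g} α → Poly N ⊢ f ≈ g → coef N f α ≡ coef N g α
  coef-cong zero [] eq = eq
  coef-cong (suc N) (n ∷ α) eq = coef-cong N α (eq n)

  coef-+ : ∀ N f g α → coef N (Poly N ⊢ f + g) α ≡ coef N f α ℤ.+ coef N g α
  coef-+ zero f g [] = ≡.refl
  coef-+ (suc N) f g (n ∷ α) = coef-+ N (f n) (g n) α

  coef-0 : ∀ N α → coef N (0# (Poly N)) α ≡ + 0
  coef-0 zero [] = ≡.refl
  coef-0 (suc N) (n ∷ α) = coef-0 N α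

  coef-1 : ∀ N α → coef N (1# (Poly N)) α ≡ + (if allZero α then 1 else 0)
  coef-1 zero [] = ≡.refl
  coef-1 (suc N) (zero ∷ α) = coef-1 N α
  coef-1 (suc N) (suc n ∷ α) = coef-0 N α

  coef-0* : ∀ N f α → coef N (Poly N ⊢ 0# (Poly N) * f) α ≡ + 0
  coef-0* N f α = ≡.trans (coef-cong N α (CommutativeRing.zeroˡ (Poly N) f)) (coef-0 N α)

  coef-1* : ∀ N f α → coef N (Poly N ⊢ 1# (Poly N) * f) α ≡ coef N f α
  coef-1* N f α = coef-cong N α (CommutativeRing.*-identityˡ (Poly N) f)

  decrement : ∀ {N} → Fin N → Vec ℕ N → Vec ℕ N
  decrement zero (x ∷ α) = x ∸ 1 ∷ α
  decrement (suc i) (x ∷ α) = x ∷ decrement i α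

  coef-var* : ∀ N i f α → coef N (Poly N ⊢ var N i * f) α ≡
    (if 1 ≤ᵇ lookup α i then coef N f (decrement i α) else + 0)
  coef-var* (suc N) zero f (zero ∷ α) = ≡.trans
    (coef-cong N α (PowerSeries.t-*-zero (Poly N) f)) (coef-0 N α)
  coef-var* (suc N) zero f (suc n ∷ α) = coef-cong N α (PowerSeries.t-*-suc (Poly N) f n)
  coef-var* (suc N) (suc i) f (n ∷ α) = ≡.trans
    (coef-cong N α (PowerSeries.constant-* (Poly N) (var N i) f n)) (coef-var* N i (f n) α)

module _ (N : ℕ) where
  open RingTools (Poly N)

  coef-ι* : ∀ n f α {m} → coef N f α ≡ + m → coef N (ι n * f) α ≡ + (n ℕ.* m)
  coef-ι* zero f α eq = coef-0* N f α
  coef-ι* (suc n) f α eq = ≡.trans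
    (coef-cong N α (trans (distribʳ f 1# (ι n)) (+-congʳ (*-identityˡ f))))
    (≡.trans (coef-+ N f (ι n * f) α) (≡.cong₂ ℤ._+_ eq (coef-ι* n f α eq)))

  coef-⟦⟧* : ∀ b f α {m} → coef N f α ≡ + m → coef N (⟦ b ⟧ * f) α ≡ + (if b then m else 0)
  coef-⟦⟧* true f α eq = ≡.trans (coef-1* N f α) eq
  coef-⟦⟧* false f α eq = coef-0* N f α

  coef-Σ : ∀ {A : Set} (xs : List A) {f : A → Carrier} {g : A → ℕ} α →
    (∀ x → coef N (f x) α ≡ + g x) → coef N (Σ xs f) α ≡ + sum (map g xs)
  coef-Σ [] α eq = coef-0 N α
  coef-Σ (x ∷ xs) {f} α eq = ≡.trans (coef-+ N (f x) _ α) (≡.cong₂ ℤ._+_ (eq x) (coef-Σ xs α eq))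

-- Coefficients of the colouring sum.

length-filterᵇ : ∀ {A : Set} (p : A → Bool) xs → length (filterᵇ p xs) ≡ sum (map (λ x → if p x then 1 else 0) xs)
length-filterᵇ p [] = ≡.refl
length-filterᵇ p (x ∷ xs) with p x
... | true = ≡.cong suc (length-filterᵇ p xs)
... | false = length-filterᵇ p xs

length-filterᵇ-tabulate : ∀ {A : Set} {n} (p : A → Bool) (f : Fin n → A) →
  length (filterᵇ p (tabulate f)) ≡ length (filterᵇ (p ∘ f) (allFin n))
length-filterᵇ-tabulate {n = zero} p f = ≡.refl
length-filterᵇ-tabulate {n = suc n} p f with p (f zero)
... | true = ≡.cong suc (≡.trans (length-filterᵇ-tabulate p (f ∘ suc)) (≡.sym (length-filterᵇ-tabulate (p ∘ f) suc)))
... | false = ≡.trans (length-filterᵇ-tabulate p (f ∘ suc)) (≡.sym (length-filterᵇ-tabulate (p ∘ f) suc))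

classSize-∷ : ∀ {N n} (i : Fin N) (κ : Vec (Fin N) n) j →
  classSize (i ∷ κ) j ≡ (if finEq i j then suc (classSize κ j) else classSize κ j)
classSize-∷ i κ j with finEq i j
... | true = ≡.cong suc (length-filterᵇ-tabulate (λ v → finEq (lookup (i ∷ κ) v) j) suc)
... | false = length-filterᵇ-tabulate (λ v → finEq (lookup (i ∷ κ) v) j) suc

-- `hasContent` with an arbitrary function for the class sizes, which survives the removal of the
-- first colour in an induction on N.
matches : ∀ {N} → (Fin N → ℕ) → Vec ℕ N → Bool
matches s α = allB (λ j → s j ≡ᵇ lookup α j) (allFin _)

matches-bump : ∀ {N} (i : Fin N) (s : Fin N → ℕ) α →
  matches (λ j → if finEq i j then suc (s j) else s j) α ≡ (1 ≤ᵇ lookup α i) ∧ matches s (decrement i α)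
matches-bump {suc N} zero s (zero ∷ α) = ≡.refl
matches-bump {suc N} zero s (suc n ∷ α) = ≡.cong ((s zero ≡ᵇ n) ∧_)
  (≡.trans (allB-tabulate (λ j → (if finEq zero j then suc (s j) else s j) ≡ᵇ lookup (suc n ∷ α) j) suc)
    (≡.sym (allB-tabulate (λ j → s j ≡ᵇ lookup (n ∷ α) j) suc)))
matches-bump {suc N} (suc i) s (n ∷ α) = begin
  (s zero ≡ᵇ n) ∧ allB (λ j → (if finEq (suc i) j then suc (s j) else s j) ≡ᵇ lookup (n ∷ α) j) (tabulate suc)
    ≡⟨ ≡.cong ((s zero ≡ᵇ n) ∧_) (≡.trans (allB-tabulate (λ j → (if finEq (suc i) j then suc (s j) else s j) ≡ᵇ lookup (n ∷ α) j) suc)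
         (matches-bump i (s ∘ suc) α)) ⟩
  (s zero ≡ᵇ n) ∧ ((1 ≤ᵇ lookup α i) ∧ matches (s ∘ suc) (decrement i α))
    ≡⟨ swap (s zero ≡ᵇ n) (1 ≤ᵇ lookup α i) _ ⟩
  (1 ≤ᵇ lookup α i) ∧ ((s zero ≡ᵇ n) ∧ matches (s ∘ suc) (decrement i α))
    ≡⟨ ≡.cong (λ b → (1 ≤ᵇ lookup α i) ∧ ((s zero ≡ᵇ n) ∧ b)) (allB-tabulate (λ j → s j ≡ᵇ lookup (n ∷ decrement i α) j) suc) ⟨
  (1 ≤ᵇ lookup α i) ∧ matches s (n ∷ decrement i α) ∎
  where
  open ≡.≡-Reasoning
  swap : ∀ a b c → a ∧ (b ∧ c) ≡ b ∧ (a ∧ c)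
  swap false b c = ≡.sym (Boolₚ.∧-zeroʳ b)
  swap true b c = ≡.refl

hasContent-[] : ∀ {N} (α : Vec ℕ N) → hasContent [] α ≡ allZero α
hasContent-[] [] = ≡.refl
hasContent-[] (n ∷ α) = ≡.cong₂ _∧_ (≡ᵇ-sym 0 n)
  (≡.trans (allB-tabulate (λ j → 0 ≡ᵇ lookup (n ∷ α) j) suc) (hasContent-[] α))

hasContent-∷ : ∀ {N n} (i : Fin N) (κ : Vec (Fin N) n) α →
  hasContent (i ∷ κ) α ≡ (1 ≤ᵇ lookup α i) ∧ hasContent κ (decrement i α)
hasContent-∷ i κ α = ≡.trans
  (allB-cong (allFin _) λ j → ≡.cong (_≡ᵇ lookup α j) (classSize-∷ i κ j))
  (matches-bump i (classSize κ) α)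

module _ (N : ℕ) where
  open RingTools (Poly N)
  open ColouringSums (Poly N) N

  coef-weight : ∀ {n} (κ : Vec (Fin N) n) α → coef N (weight (λ _ → var N) κ) α ≡ + (if hasContent κ α then 1 else 0)
  coef-weight [] α = ≡.trans (coef-1 N α) (≡.cong (λ b → + (if b then 1 else 0)) (≡.sym (hasContent-[] α)))
  coef-weight (i ∷ κ) α = ≡.trans (coef-var* N i _ α) (≡.trans (step (1 ≤ᵇ lookup α i))
    (≡.cong (λ b → + (if b then 1 else 0)) (≡.sym (hasContent-∷ i κ α))))
    where
    step : ∀ b → (if b then coef N (weight (λ _ → var N) κ) (decrement i α) else + 0) ≡
      + (if b ∧ hasContent κ (decrement i α) then 1 else 0)
    step true = coef-weight κ (decrement i α)
    step false = ≡.refl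

  coef-colourings : ∀ adj n α →
    coef N (Σ (allVecs N n) (λ κ → ⟦ proper adj κ ⟧ * weight (λ _ → var N) κ)) α ≡ + coeffX adj n α
  coef-colourings adj n α = ≡.trans
    (coef-Σ N (allVecs N n) α λ κ → ≡.trans (coef-⟦⟧* N (proper adj κ) _ α (coef-weight κ α))
      (≡.cong +_ (if-∧ (proper adj κ) (hasContent κ α))))
    (≡.cong +_ (≡.sym (length-filterᵇ (λ κ → proper adj κ ∧ hasContent κ α) (allVecs N n))))
    where
    if-∧ : ∀ a b → (if a then (if b then 1 else 0) else 0) ≡ (if a ∧ b then 1 else 0)
    if-∧ true b = ≡.refl
    if-∧ false b = ≡.refl

-- Coefficients of products of elementary symmetric functions.

sumIf : ∀ {A : Set} → (A → Bool) → (A → ℕ) → List A → ℕ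
sumIf p g xs = sum (map g (filterᵇ p xs))

sumIf-cong : ∀ {A : Set} {p q : A → Bool} {g h : A → ℕ} xs → (∀ x → p x ≡ q x) → (∀ x → g x ≡ h x) → sumIf p g xs ≡ sumIf q h xs
sumIf-cong [] eq eq′ = ≡.refl
sumIf-cong {p = p} {q} (x ∷ xs) eq eq′ with p x | q x | eq x
... | true | .true | ≡.refl = ≡.cong₂ ℕ._+_ (eq′ x) (sumIf-cong xs eq eq′)
... | false | .false | ≡.refl = sumIf-cong xs eq eq′

sumIf-none : ∀ {A : Set} {p : A → Bool} (g : A → ℕ) xs → (∀ x → p x ≡ false) → sumIf p g xs ≡ 0
sumIf-none g [] eq = ≡.refl
sumIf-none {p = p} g (x ∷ xs) eq with p x | eq x
... | .false | ≡.refl = sumIf-none g xs eq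

sumIf-++ : ∀ {A : Set} (p : A → Bool) (g : A → ℕ) xs ys → sumIf p g (xs ++ ys) ≡ sumIf p g xs ℕ.+ sumIf p g ys
sumIf-++ p g [] ys = ≡.refl
sumIf-++ p g (x ∷ xs) ys with p x
... | true = ≡.trans (≡.cong (g x ℕ.+_) (sumIf-++ p g xs ys)) (≡.sym (ℕₚ.+-assoc (g x) _ _))
... | false = sumIf-++ p g xs ys

sumIf-map : ∀ {A B : Set} (p : B → Bool) (g : B → ℕ) (f : A → B) xs → sumIf p g (map f xs) ≡ sumIf (p ∘ f) (g ∘ f) xs
sumIf-map p g f [] = ≡.refl
sumIf-map p g f (x ∷ xs) with p (f x)
... | true = ≡.cong (g (f x) ℕ.+_) (sumIf-map p g f xs)
... | false = sumIf-map p g f xs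

-- One step of `coeffE`, with F for the coefficients of the remaining factors: fixing the first
-- exponent changes F but not the shape.
subsetSum : ∀ {N} → ℕ → (Vec ℕ N → ℕ) → Vec ℕ N → ℕ
subsetSum {N} k F α = sumIf (λ S → (card S ≡ᵇ k) ∧ fitsB S α) (λ S → F (minusS α S)) (subsets N)

subsetSum-∷ : ∀ {N} k F n (α : Vec ℕ N) → subsetSum k F (n ∷ α) ≡
  sumIf (λ S → (suc (card S) ≡ᵇ k) ∧ ((1 ≤ᵇ n) ∧ fitsB S α)) (λ S → F (n ∸ 1 ∷ minusS α S)) (subsets N)
  ℕ.+ subsetSum k (λ β → F (n ∷ β)) α
subsetSum-∷ {N} k F n α = ≡.trans
  (sumIf-++ _ _ (map (true ∷_) (subsets N)) _)
  (≡.cong₂ ℕ._+_ (sumIf-map _ _ (true ∷_) (subsets N))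
    (≡.trans (≡.cong (sumIf _ _) (Listₚ.++-identityʳ (map (false ∷_) (subsets N)))) (sumIf-map _ _ (false ∷_) (subsets N))))

module _ where
  open CommutativeRing using () renaming (_*_ to _⊢_*_)
  open ColourVectors using (e)

  -- Subsets are sorted by whether they contain the first variable, which is how `e` is defined.
  coef-e* : ∀ N k f F α → (∀ β → coef N f β ≡ + F β) → coef N (Poly N ⊢ e (Poly N) k (var N) * f) α ≡ + subsetSum k F α
  coef-e* zero zero f F [] eq = ≡.trans (coef-1* zero f []) (≡.trans (eq []) (≡.cong +_ (≡.sym (ℕₚ.+-identityʳ _))))
  coef-e* zero (suc k) f F [] eq = ≡.refl
  coef-e* (suc N) zero f F (n ∷ α) eq = ≡.trans (coef-1* (suc N) f (n ∷ α)) (≡.trans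
    (≡.trans (≡.sym (coef-1* N (f n) α)) (coef-e* N zero (f n) (λ β → F (n ∷ β)) α (λ β → eq (n ∷ β))))
    (≡.cong +_ (≡.sym (≡.trans (subsetSum-∷ zero F n α)
      (≡.cong (ℕ._+ subsetSum zero (λ β → F (n ∷ β)) α)
        (sumIf-none {p = λ S → (suc (card S) ≡ᵇ zero) ∧ ((1 ≤ᵇ n) ∧ fitsB S α)} _ (subsets N) λ S → ≡.refl))))))
  coef-e* (suc N) (suc k) f F (n ∷ α) eq = ≡.trans
    (coef-cong N α (expand n))
    (≡.trans (coef-+ N _ _ α)
      (≡.trans (≡.cong₂ ℤ._+_ (coef-e* N (suc k) (f n) (λ β → F (n ∷ β)) α (λ β → eq (n ∷ β))) (with-first n))
        (≡.cong +_ (≡.trans (ℕₚ.+-comm (subsetSum (suc k) (λ β → F (n ∷ β)) α) _) (≡.sym (subsetSum-∷ (suc k) F n α))))))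
    where
    open RingTools (Poly N) using (_≈_; _+_; trans; +-cong; *-congʳ)
    open PowerSeries (Poly N)
    E₁ = e (Poly N) (suc k) (var N)
    E₀ = e (Poly N) k (var N)
    expand : ∀ n → (Poly (suc N) ⊢ e (Poly (suc N)) (suc k) (var (suc N)) * f) n ≈
      ((Poly N ⊢ E₁ * f n) + (t *ₛ (constant E₀ *ₛ f)) n)
    expand n = trans (*ₛ-distribʳ f _ _ n) (+-cong
      (trans (*ₛ-cong (constant-e (suc k) (var N)) (λ _ → CommutativeRing.refl (Poly N)) n) (constant-* E₁ f n))
      (trans (*ₛ-assoc t _ f n) (*ₛ-cong (λ _ → CommutativeRing.refl (Poly N))
        (*ₛ-cong (constant-e k (var N)) λ _ → CommutativeRing.refl (Poly N)) n)))
    with-first : ∀ n → coef N ((t *ₛ (constant E₀ *ₛ f)) n) α ≡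
      + sumIf (λ S → (suc (card S) ≡ᵇ suc k) ∧ ((1 ≤ᵇ n) ∧ fitsB S α)) (λ S → F (n ∸ 1 ∷ minusS α S)) (subsets N)
    with-first zero = ≡.trans (≡.trans (coef-cong N α (t-*-zero (constant E₀ *ₛ f))) (coef-0 N α))
      (≡.cong +_ (≡.sym (sumIf-none {p = λ S → (card S ≡ᵇ k) ∧ false} _ (subsets N) λ S → Boolₚ.∧-zeroʳ (card S ≡ᵇ k))))
    with-first (suc n) = ≡.trans
      (coef-cong N α (trans (t-*-suc (constant E₀ *ₛ f) n) (constant-* E₀ f n)))
      (coef-e* N k (f n) (λ β → F (n ∷ β)) α (λ β → eq (n ∷ β)))

  coef-eₚ : ∀ N K α → coef N (ElementaryExpansions.eₚ (Poly N) (var N) K) α ≡ + coeffE K α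
  coef-eₚ N [] α = coef-1 N α
  coef-eₚ N (k ∷ K) α = coef-e* N k _ (coeffE K) α (coef-eₚ N K)

-- From natural to rational coefficients.

ℕ→ℚ-+ : ∀ m n → ℕ→ℚ (m ℕ.+ n) ≡ ℕ→ℚ m ℚ.+ ℕ→ℚ n
ℕ→ℚ-+ m n = ℚₚ.toℚᵘ-injective (begin
  ℚ.toℚᵘ (ℕ→ℚ (m ℕ.+ n))                ≈⟨ ℚₚ.toℚᵘ-fromℚᵘ (mkℚᵘ (+ (m ℕ.+ n)) 0) ⟩
  mkℚᵘ (+ (m ℕ.+ n)) 0                   ≈⟨ *≡* (≡.cong (ℤ._* + 1) (≡.sym (≡.cong₂ ℤ._+_ (ℤₚ.*-identityʳ (+ m)) (ℤₚ.*-identityʳ (+ n))))) ⟩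
  mkℚᵘ (+ m) 0 ℚᵘ.+ mkℚᵘ (+ n) 0         ≈⟨ ℚᵘₚ.+-cong (ℚₚ.toℚᵘ-fromℚᵘ (mkℚᵘ (+ m) 0)) (ℚₚ.toℚᵘ-fromℚᵘ (mkℚᵘ (+ n) 0)) ⟨
  ℚ.toℚᵘ (ℕ→ℚ m) ℚᵘ.+ ℚ.toℚᵘ (ℕ→ℚ n)     ≈⟨ ℚₚ.toℚᵘ-homo-+ (ℕ→ℚ m) (ℕ→ℚ n) ⟨
  ℚ.toℚᵘ (ℕ→ℚ m ℚ.+ ℕ→ℚ n)               ∎)
  where open import Relation.Binary.Reasoning.Setoid ℚᵘₚ.≃-setoid

frac-cancel : ∀ q r → 1 ≤ q → frac (q ℕ.* r) q ≡ ℕ→ℚ r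
frac-cancel (suc q) r _ = ℚₚ.fromℚᵘ-cong {mkℚᵘ (+ (suc q ℕ.* r)) q} {mkℚᵘ (+ r) 0}
  (*≡* (≡.trans (ℤₚ.*-identityʳ _) (≡.trans (≡.cong +_ (ℕₚ.*-comm (suc q) r)) (ℤₚ.pos-* r (suc q)))))

frac-* : ∀ p q r → frac p (suc q) ℚ.* ℕ→ℚ (suc q ℕ.* r) ≡ ℕ→ℚ (p ℕ.* r)
frac-* p q r = ℚₚ.toℚᵘ-injective (begin
  ℚ.toℚᵘ (frac p (suc q) ℚ.* ℕ→ℚ s)          ≈⟨ ℚₚ.toℚᵘ-homo-* (frac p (suc q)) (ℕ→ℚ s) ⟩
  ℚ.toℚᵘ (frac p (suc q)) ℚᵘ.* ℚ.toℚᵘ (ℕ→ℚ s) ≈⟨ ℚᵘₚ.*-cong (ℚₚ.toℚᵘ-fromℚᵘ (mkℚᵘ (+ p) q)) (ℚₚ.toℚᵘ-fromℚᵘ (mkℚᵘ (+ s) 0)) ⟩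
  mkℚᵘ (+ p) q ℚᵘ.* mkℚᵘ (+ s) 0              ≈⟨ *≡* cross ⟩
  mkℚᵘ (+ (p ℕ.* r)) 0                        ≈⟨ ℚₚ.toℚᵘ-fromℚᵘ (mkℚᵘ (+ (p ℕ.* r)) 0) ⟨
  ℚ.toℚᵘ (ℕ→ℚ (p ℕ.* r))                      ∎)
  where
  open import Relation.Binary.Reasoning.Setoid ℚᵘₚ.≃-setoid
  s = suc q ℕ.* r
  cross : (+ p ℤ.* + s) ℤ.* + 1 ≡ + (p ℕ.* r) ℤ.* (+ suc q ℤ.* + 1)
  cross = ≡.trans (ℤₚ.*-identityʳ _) (≡.trans (≡.sym (ℤₚ.pos-* p s))
    (≡.trans (≡.cong +_ (ℕ-solve 3 (λ p q r → p ℕ:* (q ℕ:* r) ℕ:= (p ℕ:* r) ℕ:* q) ≡.refl p (suc q) r))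
      (≡.trans (ℤₚ.pos-* (p ℕ.* r) (suc q)) (≡.cong (+ (p ℕ.* r) ℤ.*_) (≡.sym (ℤₚ.*-identityʳ (+ suc q)))))))

Σℚ-ℕ→ℚ : ∀ {A : Set} (xs : List A) (g : A → ℕ) → Σℚ xs (λ x → ℕ→ℚ (g x)) ≡ ℕ→ℚ (sum (map g xs))
Σℚ-ℕ→ℚ [] g = ≡.refl
Σℚ-ℕ→ℚ (x ∷ xs) g = ≡.trans (≡.cong (ℕ→ℚ (g x) ℚ.+_) (Σℚ-ℕ→ℚ xs g)) (≡.sym (ℕ→ℚ-+ (g x) _))

Σℚ-filter-cong : ∀ {A : Set} (p : A → Bool) {f g : A → ℚ} {xs} →
  All (λ x → p x ≡ true → f x ≡ g x) xs → Σℚ (filterᵇ p xs) f ≡ Σℚ (filterᵇ p xs) g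
Σℚ-filter-cong p [] = ≡.refl
Σℚ-filter-cong p {xs = x ∷ xs} (eq ∷ eqs) with p x
... | true = ≡.cong₂ ℚ._+_ (eq ≡.refl) (Σℚ-filter-cong p eqs)
... | false = Σℚ-filter-cong p eqs

compositions-areCompositions : ∀ n → All (IsComposition n) (compositions n)
compositions-areCompositions zero = (≡.refl , []) ∷ []
compositions-areCompositions (suc n) = concat⁺ (map⁺ (All.map
  (λ { {[]} (≡.refl , []) → (≡.refl , s≤s z≤n ∷ []) ∷ []
     ; {k ∷ K} (s , p ∷ ps) → (≡.cong suc s , s≤s z≤n ∷ p ∷ ps) ∷ (≡.cong suc s , s≤s z≤n ∷ ps) ∷ [] })
  (compositions-areCompositions n)))

-- The part following the partial sum h + 2 is Θ K (h + 3) + 1.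
θ∣w : ∀ h m K → IsComposition (suc h ℕ.+ 2 ℕ.+ suc m) K → θ K (suc h) ≡ 2 →
  ∃ λ s → w K ≡ θ K (suc h ℕ.+ 3) ℕ.* s
θ∣w h m K (s , ps) θ≡ with θ-prefix K (suc h) (ℕₚ.≤-trans (ℕₚ.m≤m+n (suc h) (2 ℕ.+ suc m)) (ℕₚ.≤-reflexive (≡.sym (≡.trans s (ℕₚ.+-assoc (suc h) 2 (suc m))))))
... | [] , J , ≡.refl , ()
... | (i ∷ I) , J , ≡.refl , sI with J | ++⁻ʳ (i ∷ I) ps
... | [] | _ = ⊥-elim (ℕₚ.m+1+n≢m (suc h ℕ.+ 2) (≡.sym (≡.trans (≡.sym sI′) (≡.trans (≡.sym (ℕₚ.+-identityʳ _)) (≡.trans (≡.sym (sum-++ (i ∷ I) [])) s)))))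
  where
  sI′ : sum (i ∷ I) ≡ suc h ℕ.+ 2
  sI′ = ≡.trans sI (≡.cong (suc h ℕ.+_) θ≡)
... | zero ∷ J | () ∷ _
... | suc j ∷ J | _ = w (i ∷ I) ℕ.* v J , ≡.trans (w-++ i I (suc j ∷ J))
  (≡.trans (ℕ-solve 3 (λ a b c → a ℕ:* (b ℕ:* c) ℕ:= b ℕ:* (a ℕ:* c)) ≡.refl (w (i ∷ I)) j (v J))
    (≡.cong (ℕ._* (w (i ∷ I) ℕ.* v J)) (≡.sym θ₃)))
  where
  θ₃ : θ ((i ∷ I) ++ suc j ∷ J) (suc h ℕ.+ 3) ≡ j
  θ₃ = ≡.trans (≡.cong (θ ((i ∷ I) ++ suc j ∷ J)) (≡.trans (≡.sym (ℕₚ.+-assoc (suc h) 2 1))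
      (≡.cong (ℕ._+ 1) (≡.sym (≡.trans sI (≡.cong (suc h ℕ.+_) θ≡))))))
    (θ-++ (i ∷ I) (suc j ∷ J) 0)

-- Divisibility makes the natural division exact; for t = 0 the default values of `frac` and
-- `quotient` are both 0.
quotient-frac : ∀ t w′ s c → w′ ≡ t ℕ.* s →
  frac (t ∸ 1) t ℚ.* ℕ→ℚ (w′ ℕ.* c) ≡ ℕ→ℚ (quotient ((t ∸ 1) ℕ.* w′) t ℕ.* c)
quotient-frac zero w′ s c eq = ℚₚ.*-zeroˡ (ℕ→ℚ (w′ ℕ.* c))
quotient-frac (suc q) .(suc q ℕ.* s) s c ≡.refl = ≡.trans
  (≡.trans (≡.cong (λ r → frac q (suc q) ℚ.* ℕ→ℚ r) (ℕₚ.*-assoc (suc q) s c)) (frac-* q q (s ℕ.* c)))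
  (≡.cong ℕ→ℚ (≡.trans (≡.sym (ℕₚ.*-assoc q s c)) (≡.cong (ℕ._* c) (≡.sym
    (≡.trans (≡.cong (ℕ._/ suc q) (ℕ-solve 3 (λ p q s → p ℕ:* (q ℕ:* s) ℕ:= (p ℕ:* s) ℕ:* q) ≡.refl q (suc q) s))
      (m*n/n≡m (q ℕ.* s) (suc q)))))))

-- Assembly of the coefficient identity.

module TwinnedLollipop (k i d N : ℕ) (α : Vec ℕ N) where
  private
    a = suc k
    l = d ℕ.+ (2 ℕ.+ i)
    h = suc d
    n = a ℕ.+ l ℕ.+ 1
    -- Chosen so that n is h + 2 + suc m: suc m is what remains beyond the partial sum h + 2.
    m = k ℕ.+ i

  open RingTools (Poly N)
  open CompositionSums (Poly N)
  open ColourVectors (Poly N)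
  open Transfer (Poly N) (var N)
  open ElementaryExpansions (Poly N) (var N)
  open ColouringSums (Poly N) N
  open TwinExpansion (Poly N) (var N)

  private
    n≡ : n ≡ h ℕ.+ 2 ℕ.+ suc m
    n≡ = ℕ-solve 3 (λ k i d → ℕcon 1 ℕ:+ k ℕ:+ (d ℕ:+ (ℕcon 2 ℕ:+ i)) ℕ:+ ℕcon 1 ℕ:= ℕcon 1 ℕ:+ d ℕ:+ ℕcon 2 ℕ:+ (ℕcon 1 ℕ:+ (k ℕ:+ i))) ≡.refl k i d

    n≡₀ : n ≡ h ℕ.+ 0 ℕ.+ (2 ℕ.+ suc m)
    n≡₀ = ≡.trans n≡ (ℕ-solve 2 (λ h m → h ℕ:+ ℕcon 2 ℕ:+ m ℕ:= h ℕ:+ ℕcon 0 ℕ:+ (ℕcon 2 ℕ:+ m)) ≡.refl h (suc m))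

    n≡₁ : n ≡ h ℕ.+ 1 ℕ.+ (1 ℕ.+ suc m)
    n≡₁ = ≡.trans n≡ (ℕ-solve 2 (λ h m → h ℕ:+ ℕcon 2 ℕ:+ m ℕ:= h ℕ:+ ℕcon 1 ℕ:+ (ℕcon 1 ℕ:+ m)) ≡.refl h (suc m))

    n-1≡ : n ∸ 1 ≡ h ℕ.+ 2 ℕ.+ m
    n-1≡ = ≡.trans (≡.cong (_∸ 1) n≡) (≡.cong (_∸ 1) (ℕₚ.+-suc (h ℕ.+ 2) m))

    h≤n-1 : h ≤ n ∸ 1
    h≤n-1 = ≡.subst (h ≤_) (≡.sym (≡.trans n-1≡ (ℕₚ.+-assoc h 2 m))) (ℕₚ.m≤m+n h _)

    h≤n : h ≤ n
    h≤n = ℕₚ.≤-trans h≤n-1 (ℕₚ.m∸n≤m n 1)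

    h+3≤n : h ℕ.+ 3 ≤ n
    h+3≤n = ≡.subst (h ℕ.+ 3 ≤_) (≡.sym (≡.trans n≡ (ℕ-solve 2 (λ h m → h ℕ:+ ℕcon 2 ℕ:+ (ℕcon 1 ℕ:+ m) ℕ:= h ℕ:+ ℕcon 3 ℕ:+ m) ≡.refl h m))) (ℕₚ.m≤m+n (h ℕ.+ 3) m)

    n∸h : n ∸ h ≡ 2 ℕ.+ suc m
    n∸h = ≡.trans (≡.cong (_∸ h) (≡.trans n≡ (ℕₚ.+-assoc h 2 (suc m)))) (ℕₚ.m+n∸m≡n h _)

    a≤ : a ≤ suc m
    a≤ = s≤s (ℕₚ.m≤m+n k i)

    𝒮-≡ : ∀ {n n′} f → n ≡ n′ → 𝒮 n f ≈ 𝒮 n′ f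
    𝒮-≡ f eq = reflexive (≡.cong (λ n → 𝒮 n f) eq)

    c₁ c₃ c₄ : List ℕ → Bool
    c₁ K = (a ≤ᵇ lastPart K) ∧ (3 ≤ᵇ Θ K h)
    c₃ K = (Θ K h ≤ᵇ 1) ∧ (3 ≤ᵇ lastPart K) ∧
           ((2 ≤ᵇ length K) ∧ (((n ∸ h) ℕ.+ 1 ≤ᵇ lastPart K ℕ.+ secondLast K) ∨ (a ≤ᵇ secondLast K)))
    c₄ K = (a ≤ᵇ lastPart K) ∧ (Θ K h ≡ᵇ 2) ∧ (2 ≤ᵇ Θ K (h ℕ.+ 3))

    coefficient = FourthSum.coefficient a d m

    Θ-at-h : ∀ {n K} → h ≤ n → IsComposition n K → Θ K h ≡ θ K h
    Θ-at-h {n} {K} p (s , _) = Θ≡θ K h (≡.subst (h ≤_) (≡.sym s) p)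

    Θ-at-h+3 : ∀ {K} → IsComposition n K → Θ K (h ℕ.+ 3) ≡ θ K (h ℕ.+ 3)
    Θ-at-h+3 {K} (s , _) = Θ≡θ K (h ℕ.+ 3) (≡.subst (h ℕ.+ 3 ≤_) (≡.sym s) h+3≤n)

    S₁ S₂ S₃ S₄ : Carrier
    S₁ = Σ (filterᵇ c₁ (compositions n)) (λ K → ι (2 ℕ.* w K) * eₚ K)
    S₂ = Σ (filterᵇ c₁ (compositions (n ∸ 1))) (λ K → ι (w K) * eₚ (1 ∷ K))
    S₃ = Σ (filterᵇ c₃ (compositions n)) (λ K → ι ((lastPart K ∸ 2) ℕ.* w (dropLast K)) * eₚ K)
    S₄ = Σ (filterᵇ c₄ (compositions n)) (λ K → ι (coefficient K) * eₚ K)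

    ⟦c₁⟧ : ∀ {n K} → h ≤ n → IsComposition n K → ⟦ c₁ K ⟧ ≈ ⟦ 3 ≤ᵇ θ K h ⟧ * ⟦ a ≤ᵇ lastPart K ⟧
    ⟦c₁⟧ {K = K} p c = trans (⟦⟧-∧ (a ≤ᵇ lastPart K) _)
      (trans (*-comm _ _) (*-congʳ (⟦⟧-cong (≡.cong (3 ≤ᵇ_) (Θ-at-h p c)))))

    S₁≈ : S₁ ≈ ι 2 * 𝒮 (h ℕ.+ 2 ℕ.+ suc m) (λ K → ⟦ 3 ≤ᵇ θ K h ⟧ * (⟦ a ≤ᵇ lastPart K ⟧ * we K))
    S₁≈ = begin
      S₁
        ≈⟨ 𝒮-filter c₁ n _ ⟩
      𝒮 n (λ K → ⟦ c₁ K ⟧ * (ι (2 ℕ.* w K) * eₚ K))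
        ≈⟨ 𝒮-cong n (λ K c → trans (*-cong (⟦c₁⟧ h≤n c) (*-congʳ (ι-* 2 (w K))))
             (solve 5 (λ b c t w E → (b :* c) :* (t :* w :* E) := t :* (b :* (c :* (w :* E)))) refl _ _ _ _ _)) ⟩
      𝒮 n (λ K → ι 2 * (⟦ 3 ≤ᵇ θ K h ⟧ * (⟦ a ≤ᵇ lastPart K ⟧ * we K)))
        ≈⟨ trans (𝒮-*ˡ n _ _) (*-congˡ (𝒮-≡ _ n≡)) ⟩
      ι 2 * 𝒮 (h ℕ.+ 2 ℕ.+ suc m) (λ K → ⟦ 3 ≤ᵇ θ K h ⟧ * (⟦ a ≤ᵇ lastPart K ⟧ * we K)) ∎

    S₂≈ : S₂ ≈ e 1 (var N) * 𝒮 (h ℕ.+ 2 ℕ.+ m) (λ K → ⟦ 3 ≤ᵇ θ K h ⟧ * (⟦ a ≤ᵇ lastPart K ⟧ * we K))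
    S₂≈ = begin
      S₂
        ≈⟨ 𝒮-filter c₁ (n ∸ 1) _ ⟩
      𝒮 (n ∸ 1) (λ K → ⟦ c₁ K ⟧ * (ι (w K) * (e 1 (var N) * eₚ K)))
        ≈⟨ 𝒮-cong (n ∸ 1) (λ K c → trans (*-congʳ (⟦c₁⟧ h≤n-1 c))
             (solve 5 (λ b c w t E → (b :* c) :* (w :* (t :* E)) := t :* (b :* (c :* (w :* E)))) refl _ _ _ _ _)) ⟩
      𝒮 (n ∸ 1) (λ K → e 1 (var N) * (⟦ 3 ≤ᵇ θ K h ⟧ * (⟦ a ≤ᵇ lastPart K ⟧ * we K)))
        ≈⟨ trans (𝒮-*ˡ (n ∸ 1) _ _) (*-congˡ (𝒮-≡ _ n-1≡)) ⟩
      e 1 (var N) * 𝒮 (h ℕ.+ 2 ℕ.+ m) (λ K → ⟦ 3 ≤ᵇ θ K h ⟧ * (⟦ a ≤ᵇ lastPart K ⟧ * we K)) ∎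

    module Third₀ = ThirdSum a d 0 (suc (suc m)) (n ∸ h) n∸h (ℕₚ.m≤n⇒m≤1+n (ℕₚ.m≤n⇒m≤1+n a≤))
    module Third₁ = ThirdSum a d 1 (suc m) (n ∸ h) n∸h (ℕₚ.m≤n⇒m≤1+n a≤)

    S₃≈ : S₃ ≈ A h 0 * U a (2 ℕ.+ suc m) + A h 1 * U a (1 ℕ.+ suc m)
    S₃≈ = begin
      S₃
        ≈⟨ 𝒮-filter c₃ n _ ⟩
      𝒮 n (λ K → ⟦ c₃ K ⟧ * (ι ((lastPart K ∸ 2) ℕ.* w (dropLast K)) * eₚ K))
        -- Both instances have the same a and n - h, so `Third₀.summand` and `Third₁.summand` are
        -- one function.
        ≈⟨ 𝒮-cong n (λ K c → trans
             (*-congʳ (trans (⟦⟧-∧ (Θ K h ≤ᵇ 1) _) (*-congʳ (trans (⟦⟧-cong (≡.cong (_≤ᵇ 1) (Θ-at-h h≤n c))) (≤1 (θ K h))))))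
             (solve 4 (λ a b c d → ((a :+ b) :* c) :* d := a :* (c :* d) :+ b :* (c :* d)) refl _ _ _ _)) ⟩
      𝒮 n (λ K → ⟦ θ K h ≡ᵇ 0 ⟧ * Third₀.summand K + ⟦ θ K h ≡ᵇ 1 ⟧ * Third₁.summand K)
        ≈⟨ 𝒮-+ n _ _ ⟩
      𝒮 n (λ K → ⟦ θ K h ≡ᵇ 0 ⟧ * Third₀.summand K) + 𝒮 n (λ K → ⟦ θ K h ≡ᵇ 1 ⟧ * Third₁.summand K)
        ≈⟨ +-cong (trans (𝒮-≡ _ n≡₀) Third₀.third-sum) (trans (𝒮-≡ _ n≡₁) Third₁.third-sum) ⟩
      A h 0 * U a (2 ℕ.+ suc m) + A h 1 * U a (1 ℕ.+ suc m) ∎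
      where
      ≤1 : ∀ t → ⟦ t ≤ᵇ 1 ⟧ ≈ ⟦ t ≡ᵇ 0 ⟧ + ⟦ t ≡ᵇ 1 ⟧
      ≤1 0 = sym (+-identityʳ 1#)
      ≤1 1 = sym (+-identityˡ 1#)
      ≤1 (suc (suc t)) = sym (+-identityˡ 0#)

    S₄≈ : S₄ ≈ A h 2 * U a (suc m)
    S₄≈ = begin
      S₄
        ≈⟨ 𝒮-filter c₄ n _ ⟩
      𝒮 n (λ K → ⟦ c₄ K ⟧ * (ι (coefficient K) * eₚ K))
        ≈⟨ 𝒮-cong n (λ K c → trans
             (*-congʳ (trans (⟦⟧-∧ (a ≤ᵇ lastPart K) _) (*-congˡ (trans (⟦⟧-∧ (Θ K h ≡ᵇ 2) _)
               (*-cong (⟦⟧-cong (≡.cong (_≡ᵇ 2) (Θ-at-h h≤n c))) (⟦⟧-cong (≡.cong (2 ≤ᵇ_) (Θ-at-h+3 c))))))))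
             (solve 4 (λ a b c d → (a :* (b :* c)) :* d := b :* (a :* (c :* d))) refl _ _ _ _)) ⟩
      𝒮 n (λ K → ⟦ θ K h ≡ᵇ 2 ⟧ * FourthSum.summand a d m K)
        ≈⟨ trans (𝒮-≡ _ n≡) (FourthSum.fourth-sum a d m) ⟩
      A h 2 * U a (suc m) ∎

    colouring-sum : Σ (allVecs N n) (λ κ → ⟦ proper (twLollipop a l h) κ ⟧ * weight (λ _ → var N) κ) ≈
      ι (2 ℕ.* k !) * (S₁ + S₂ + S₃ + S₄)
    colouring-sum = begin
      Σ (allVecs N n) (λ κ → ⟦ proper (twLollipop a l h) κ ⟧ * weight (λ _ → var N) κ)
        ≈⟨ Z-colourings n _ (twLollipop-simple k i d) ⟩
      Z n (twLollipop a l h) (λ _ → var N)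
        ≡⟨ ≡.cong (λ n → Z n (twLollipop a l h) (λ _ → var N)) (ℕₚ.+-comm (a ℕ.+ l) 1) ⟩
      Z (suc (suc (k ℕ.+ l))) (twLollipop a l h) (λ _ → var N)
        ≈⟨ TwinnedLollipopSum.Z-twinned (Poly N) (var N) (twLollipop-twinned k i d) ⟩
      ι (k !) * ∥ M^ d ∙ T (M^ i ∙ ε k) ∥
        ≈⟨ *-congˡ (twin≈W-sum d i k) ⟩
      _ ≈⟨ *-congˡ (*-congˡ (+-cong (+-cong (+-cong S₁≈ S₂≈) S₃≈) S₄≈)) ⟨
      ι (k !) * (ι 2 * (S₁ + S₂ + S₃ + S₄))
        ≈⟨ trans (solve 3 (λ a b c → a :* (b :* c) := (b :* a) :* c) refl _ _ _) (*-congʳ (sym (ι-* 2 (k !)))) ⟩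
      ι (2 ℕ.* k !) * (S₁ + S₂ + S₃ + S₄) ∎

    g₁ g₂ g₃ g₄ : List ℕ → ℕ
    g₁ K = 2 ℕ.* w K ℕ.* coeffE K α
    g₂ K = w K ℕ.* coeffE (1 ∷ K) α
    g₃ K = (lastPart K ∸ 2) ℕ.* w (dropLast K) ℕ.* coeffE K α
    g₄ K = coefficient K ℕ.* coeffE K α

    n₁ n₂ n₃ n₄ : ℕ
    n₁ = sum (map g₁ (filterᵇ c₁ (compositions n)))
    n₂ = sum (map g₂ (filterᵇ c₁ (compositions (n ∸ 1))))
    n₃ = sum (map g₃ (filterᵇ c₃ (compositions n)))
    n₄ = sum (map g₄ (filterᵇ c₄ (compositions n)))

    coef-S : coef N (S₁ + S₂ + S₃ + S₄) α ≡ + (n₁ ℕ.+ n₂ ℕ.+ n₃ ℕ.+ n₄)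
    coef-S = ≡.trans (coef-+ N _ _ α) (≡.cong₂ ℤ._+_
      (≡.trans (coef-+ N _ _ α) (≡.cong₂ ℤ._+_
        (≡.trans (coef-+ N _ _ α) (≡.cong₂ ℤ._+_ (part (λ K → 2 ℕ.* w K) (λ K → K) (filterᵇ c₁ (compositions n))) (part w (1 ∷_) (filterᵇ c₁ (compositions (n ∸ 1))))))
        (part (λ K → (lastPart K ∸ 2) ℕ.* w (dropLast K)) (λ K → K) (filterᵇ c₃ (compositions n)))))
      (part coefficient (λ K → K) (filterᵇ c₄ (compositions n))))
      where
      part : ∀ (c : List ℕ → ℕ) (f : List ℕ → List ℕ) xs →
        coef N (Σ xs (λ K → ι (c K) * eₚ (f K))) α ≡ + sum (map (λ K → c K ℕ.* coeffE (f K) α) xs)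
      part c f xs = coef-Σ N xs α λ K → coef-ι* N (c K) _ α (coef-eₚ N (f K) α)

    -- The theorem with denominators cleared, obtained by comparing integer coefficients of
    -- `colouring-sum`.
    coeffX≡ : coeffX (twLollipop a l h) n α ≡ 2 ℕ.* k ! ℕ.* (n₁ ℕ.+ n₂ ℕ.+ n₃ ℕ.+ n₄)
    coeffX≡ = ℤₚ.+-injective (≡.trans (≡.sym (coef-colourings N (twLollipop a l h) n α))
      (≡.trans (coef-cong N α colouring-sum) (coef-ι* N (2 ℕ.* k !) _ α coef-S)))

    rhs≡ : rhs a l h α ≡ ℕ→ℚ (n₁ ℕ.+ n₂ ℕ.+ n₃ ℕ.+ n₄)
    rhs≡ = ≡.trans
      (≡.cong₂ ℚ._+_ (≡.cong₂ ℚ._+_ (≡.cong₂ ℚ._+_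
          (Σℚ-ℕ→ℚ (filterᵇ c₁ (compositions n)) g₁)
          (Σℚ-ℕ→ℚ (filterᵇ c₁ (compositions (n ∸ 1))) g₂))
          (Σℚ-ℕ→ℚ (filterᵇ c₃ (compositions n)) g₃))
        (≡.trans (Σℚ-filter-cong c₄ (All.map (λ {K} → fourth K) (compositions-areCompositions n)))
          (Σℚ-ℕ→ℚ (filterᵇ c₄ (compositions n)) g₄)))
      (≡.sym (≡.trans (ℕ→ℚ-+ (n₁ ℕ.+ n₂ ℕ.+ n₃) n₄) (≡.cong (ℚ._+ ℕ→ℚ n₄)
        (≡.trans (ℕ→ℚ-+ (n₁ ℕ.+ n₂) n₃) (≡.cong (ℚ._+ ℕ→ℚ n₃) (ℕ→ℚ-+ n₁ n₂))))))
      where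
      ∧-true : ∀ {b c d} → b ∧ c ∧ d ≡ true → c ≡ true
      ∧-true {true} {true} eq = ≡.refl
      fourth : ∀ K → IsComposition n K → c₄ K ≡ true →
        frac (Θ K (h ℕ.+ 3) ∸ 1) (Θ K (h ℕ.+ 3)) ℚ.* ℕ→ℚ (w K ℕ.* coeffE K α) ≡ ℕ→ℚ (g₄ K)
      -- Membership in the fourth sum gives Θ = 2 at h, which is what `θ∣w` needs.
      fourth K c c₄≡ with θ∣w d m K (≡.subst (λ n → IsComposition n K) n≡ c)
          (≡.trans (≡.sym (Θ-at-h h≤n c)) (ℕₚ.≡ᵇ⇒≡ _ 2 (≡.subst Data.Bool.T (≡.sym (∧-true {a ≤ᵇ lastPart K} c₄≡)) _)))
      ... | s , w≡ rewrite Θ-at-h+3 c = quotient-frac (θ K (h ℕ.+ 3)) (w K) s (coeffE K α) w≡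

  expansion : lhs a l h α ≡ rhs a l h α
  expansion = ≡.trans (≡.trans (≡.cong (λ c → frac c (2 ℕ.* k !)) coeffX≡) cancel) (≡.sym rhs≡)
    where
    cancel : frac (2 ℕ.* k ! ℕ.* (n₁ ℕ.+ n₂ ℕ.+ n₃ ℕ.+ n₄)) (2 ℕ.* k !) ≡ ℕ→ℚ (n₁ ℕ.+ n₂ ℕ.+ n₃ ℕ.+ n₄)
    cancel = frac-cancel (2 ℕ.* k !) (n₁ ℕ.+ n₂ ℕ.+ n₃ ℕ.+ n₄) (ℕₚ.*-mono-≤ {1} {2} {1} {k !} (s≤s z≤n) (ℕₚ.1≤n! k))

theorem4p3 : (a l h : ℕ) → 1 ≤ a → 2 ≤ l → 1 ≤ h → h ≤ l ∸ 1 →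
    (N : ℕ) (α : Vec ℕ N) → lhs a l h α ≡ rhs a l h α
theorem4p3 (suc k) (suc l) (suc d) _ _ _ h≤l N α =
  ≡.subst (λ l → lhs (suc k) l (suc d) α ≡ rhs (suc k) l (suc d) α)
    (≡.trans (ℕₚ.+-suc d (suc i)) (≡.cong suc (≡.trans (ℕₚ.+-suc d i) (ℕₚ.m+[n∸m]≡n h≤l))))
    (TwinnedLollipop.expansion k i d N α)
  -- The l matched here is one less than the path length, so v_{i+1} is the twinned vertex and h ≤ l
  -- - 1 makes the difference exact.
  where i = l ∸ suc d
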